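{- Let $a,b,c$ be positive integers and let $V = V_{a+b-1}\otimes V_{a+c-1}\otimes V_{b+c-1}$, a tensor product of three irreducible representations of $\mathfrak{sl}(2,\mathbb{C})$, with representation map $\alpha$, equipped with the basis $\{e_i\otimes e_j\otimes e_k\}$ formed from the weight bases of the three factors. Let $V|_\lambda$ denote the eigenspace of $\alpha(H)$ with eigenvalue $\lambda$, and let $\alpha(X)|_{ -1}:V|_{ -1}\to V|_{1}$ be the restriction of $\alpha(X)$. Then there is a bijection between the basis vectors of $V|_{ -1}$ and the vertices of one colour class of $Z(a,b,c)$, and between the basis vectors of $V|_{1}$ and the vertices of the other colour class, under which the matrix of $\alpha(X)|_{ -1}$ is a Kasteleyn-flat weighted bipartite adjacency matrix of $Z(a,b,c)$. Consequently, all nonzero terms in the Leibniz expansion of $\det(\alpha(X)|_{ -1})$ have a common value $m$, and $\det(\alpha(X)|_{ -1})/m$ equals the number of plane partitions in an $a\times b\times c$ box.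
   Context: A plane partition in an $a\times b\times c$ box is an $a\times b$ matrix of integers between $0$ and $c$, weakly decreasing along rows and columns (equivalently a stack of unit cubes in $[0,a]\times[0,b]\times[0,c]$ stable under gravity toward the origin). Let $H(a,b,c)$ be the hexagon in the triangular lattice (of unit equilateral triangles) with all angles $120^\circ$ and side lengths $a,b,c,a,b,c$ in cyclic order; it is tiled by unit triangles. $Z(a,b,c)$ is the bipartite planar graph whose vertices are these unit triangles (the two colour classes being the two orientations of triangles) and whose edges join triangles sharing a side; its perfect matchings are in bijection with lozenge tilings of $H(a,b,c)$ and hence with plane partitions in an $a\times b\times c$ box. The bounded faces of $Z(a,b,c)$ are hexagons (the six triangles around an interior lattice vertex). A weighted bipartite adjacency matrix of a bipartite graph with colour classes $U,W$ of equal size is a matrix with rows indexed by one class and columns by the other, whose $(u,w)$ entry is a nonzero weight if $u,w$ are adjacent and $0$ otherwise. It is Kasteleyn-flat if for every hexagonal face, with edge weights $w_1,\dots,w_6$ in cyclic order around the face, $w_1w_3w_5=w_2w_4w_6$. $\mathfrak{sl}(2,\mathbb{C})$ has basis $H=\begin{pmatrix}1&0\\0&-1\end{pmatrix}$, $X=\begin{pmatrix}0&1\\0&0\end{pmatrix}$, $Y=\begin{pmatrix}0&0\\1&0\end{pmatrix}$. For $n\ge 0$, $V_n$ is the irreducible $(n+1)$-dimensional representation on homogeneous polynomials of degree $n$ in $x,y$, with $X=x\,\partial/\partial y$, $Y=y\,\partial/\partial x$, $H=x\,\partial/\partial x-y\,\partial/\partial y$. Its weight basis is $e_{n-2j}=x^{n-j}y^j$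 ($j=0,\dots,n$), so $He_{n-2j}=(n-2j)e_{n-2j}$, $Xe_{n-2j}=j\,e_{n-2j+2}$, $Ye_{n-2j}=(n-j)e_{n-2j-2}$. On a tensor product, an element $L$ acts by $L\otimes I\otimes I+I\otimes L\otimes I+I\otimes I\otimes L$. -}

module Defs where

open import Data.Nat as ℕ using (ℕ; zero; suc; _∸_)
open import Data.Integer as ℤ using (ℤ; +_; 0ℤ; 1ℤ; -1ℤ; _+_; _-_; _*_; -_; _≤_)
open import Data.Fin as Fin using (Fin; toℕ; punchIn)
open import Data.Fin.Properties using (all?)
open import Data.List using (List; []; _∷_; [_]; map; concatMap; foldr; filter; length; allFin; upTo)
open import Data.Vec as Vec using (Vec; lookup)
open import Data.Product using (Σ; Σ-syntax; _×_; _,_; proj₁; proj₂)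
open import Data.Sum using (_⊎_)
open import Data.Bool using (if_then_else_)
open import Relation.Binary.PropositionalEquality using (_≡_; _≢_)
open import Relation.Nullary using (¬_; does; Dec)
open import Relation.Nullary.Decidable using (_×-dec_; _→-dec_)

-- sl(2,C) representations V_n.
-- The weight basis of V_n is e_{n-2j} = x^(n-j) y^j, j = 0..n; we index
-- it by j : Fin (suc n).  Matrices are given by coefficients:
-- (L n i j) = coefficient of basis vector i in L (basis vector j).

Xmat : (n : ℕ) → Fin (suc n) → Fin (suc n) → ℤ
Xmat n i j = if does (toℕ j ℕ.≟ suc (toℕ i)) then + toℕ j else 0ℤ

Imat : (n : ℕ) → Fin (suc n) → Fin (suc n) → ℤ
Imat n i j = if does (i Fin.≟ j) then 1ℤ else 0ℤ

Hweight : (n : ℕ) → Fin (suc n) → ℤ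
Hweight n j = + n - + (2 ℕ.* toℕ j)

Basis : ℕ → ℕ → ℕ → Set
Basis n₁ n₂ n₃ = Fin (suc n₁) × Fin (suc n₂) × Fin (suc n₃)

tensorAct : ((n : ℕ) → Fin (suc n) → Fin (suc n) → ℤ) →
            (n₁ n₂ n₃ : ℕ) → Basis n₁ n₂ n₃ → Basis n₁ n₂ n₃ → ℤ
tensorAct L n₁ n₂ n₃ (i₁ , i₂ , i₃) (j₁ , j₂ , j₃) =
    L n₁ i₁ j₁ * Imat n₂ i₂ j₂ * Imat n₃ i₃ j₃
  + Imat n₁ i₁ j₁ * L n₂ i₂ j₂ * Imat n₃ i₃ j₃
  + Imat n₁ i₁ j₁ * Imat n₂ i₂ j₂ * L n₃ i₃ j₃

tensorWeight : (n₁ n₂ n₃ : ℕ) → Basis n₁ n₂ n₃ → ℤ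
tensorWeight n₁ n₂ n₃ (j₁ , j₂ , j₃) = Hweight n₁ j₁ + Hweight n₂ j₂ + Hweight n₃ j₃

Bas : ℕ → ℕ → ℕ → Set
Bas a b c = Basis (a ℕ.+ b ∸ 1) (a ℕ.+ c ∸ 1) (b ℕ.+ c ∸ 1)

αX : (a b c : ℕ) → Bas a b c → Bas a b c → ℤ
αX a b c = tensorAct Xmat (a ℕ.+ b ∸ 1) (a ℕ.+ c ∸ 1) (b ℕ.+ c ∸ 1)

wt : (a b c : ℕ) → Bas a b c → ℤ
wt a b c = tensorWeight (a ℕ.+ b ∸ 1) (a ℕ.+ c ∸ 1) (b ℕ.+ c ∸ 1)

EigBasis : (a b c : ℕ) → ℤ → Set
EigBasis a b c λ' = Σ[ t ∈ Bas a b c ] (wt a b c t ≡ λ')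

XRes : (a b c : ℕ) → EigBasis a b c 1ℤ → EigBasis a b c -1ℤ → ℤ
XRes a b c s t = αX a b c (proj₁ s) (proj₁ t)

-- The hexagon H(a,b,c) and the graph Z(a,b,c).
-- Lattice point (x,y) ∈ ℤ² denotes x·e₁ + y·e₂ with e₁ = (1,0),
-- e₂ = (1/2, √3/2).  H(a,b,c) has corners (0,0),(a,0),(a,b),(a-c,b+c),
-- (-c,b+c),(-c,c), i.e. H = {0 ≤ y ≤ b+c, -c ≤ x ≤ a, 0 ≤ x+y ≤ a+b}.
-- Up triangle at (x,y): corners (x,y),(x+1,y),(x,y+1).
-- Down triangle at (x,y): corners (x+1,y),(x,y+1),(x+1,y+1).

UpIn : (a b c : ℕ) → ℤ → ℤ → Set
UpIn a b c x y =
  (0ℤ ≤ y) × (y + 1ℤ ≤ + (b ℕ.+ c)) × (- (+ c) ≤ x) × (x + 1ℤ ≤ + a) ×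
  (0ℤ ≤ x + y) × (x + y + 1ℤ ≤ + (a ℕ.+ b))

DownIn : (a b c : ℕ) → ℤ → ℤ → Set
DownIn a b c x y =
  (0ℤ ≤ y) × (y + 1ℤ ≤ + (b ℕ.+ c)) × (- (+ c) ≤ x) × (x + 1ℤ ≤ + a) ×
  (0ℤ ≤ x + y + 1ℤ) × (x + y + 1ℤ + 1ℤ ≤ + (a ℕ.+ b))

Up : ℕ → ℕ → ℕ → Set
Up a b c = Σ[ x ∈ ℤ ] Σ[ y ∈ ℤ ] UpIn a b c x y

Down : ℕ → ℕ → ℕ → Set
Down a b c = Σ[ x ∈ ℤ ] Σ[ y ∈ ℤ ] DownIn a b c x y

-- edges of Z(a,b,c): triangles sharing a side.  Up (x,y) shares its
-- sides with Down (x,y), Down (x-1,y) and Down (x,y-1).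
Adj : {a b c : ℕ} → Up a b c → Down a b c → Set
Adj (x , y , _) (x' , y' , _) =
  (x' ≡ x × y' ≡ y) ⊎ (x' ≡ x - 1ℤ × y' ≡ y) ⊎ (x' ≡ x × y' ≡ y - 1ℤ)

IsWeightedAdj : (a b c : ℕ) → (Up a b c → Down a b c → ℤ) → Set
IsWeightedAdj a b c N =
  ∀ u d → (Adj u d → N u d ≢ 0ℤ) × (¬ Adj u d → N u d ≡ 0ℤ)

-- Bounded faces of Z(a,b,c): hexagons around an interior lattice vertex
-- (p,q), i.e. one all six of whose surrounding triangles lie in H.  In
-- cyclic order these are Up(p,q), Down(p-1,q), Up(p-1,q), Down(p-1,q-1),
-- Up(p,q-1), Down(p,q-1).
IsKFlat : (a b c : ℕ) → (Up a b c → Down a b c → ℤ) → Set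
IsKFlat a b c N =
  ∀ p q →
  (u₁ : UpIn a b c p q) (d₁ : DownIn a b c (p - 1ℤ) q)
  (u₂ : UpIn a b c (p - 1ℤ) q) (d₂ : DownIn a b c (p - 1ℤ) (q - 1ℤ))
  (u₃ : UpIn a b c p (q - 1ℤ)) (d₃ : DownIn a b c p (q - 1ℤ)) →
  let U₁ = p , q , u₁ ; D₁ = p - 1ℤ , q , d₁
      U₂ = p - 1ℤ , q , u₂ ; D₂ = p - 1ℤ , q - 1ℤ , d₂
      U₃ = p , q - 1ℤ , u₃ ; D₃ = p , q - 1ℤ , d₃
  in N U₁ D₁ * N U₂ D₂ * N U₃ D₃ ≡ N U₂ D₁ * N U₃ D₂ * N U₁ D₃

IsKFlatAdj : (a b c : ℕ) → (Up a b c → Down a b c → ℤ) → Set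
IsKFlatAdj a b c N = IsWeightedAdj a b c N × IsKFlat a b c N

sgn : ℕ → ℤ
sgn zero = 1ℤ
sgn (suc k) = - sgn k

consPerm : {n : ℕ} → Fin (suc n) → (Fin n → Fin n) → Fin (suc n) → Fin (suc n)
consPerm k p Fin.zero = k
consPerm k p (Fin.suc i) = punchIn k (p i)

-- all permutations of Fin n, each exactly once, paired with their sign
-- (sign of consPerm k p = (-1)^k · sign p, k = #inversions involving 0)
perms : (n : ℕ) → List (ℤ × (Fin n → Fin n))
perms zero = [ 1ℤ , (λ ()) ]
perms (suc n) =
  concatMap (λ k → map (λ sp → sgn (toℕ k) * proj₁ sp , consPerm k (proj₂ sp)) (perms n))
            (allFin (suc n))

prodFin : (n : ℕ) → (Fin n → ℤ) → ℤ
prodFin zero f = 1ℤ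
prodFin (suc n) f = f Fin.zero * prodFin n (λ i → f (Fin.suc i))

leibnizTerms : {n : ℕ} → (Fin n → Fin n → ℤ) → List ℤ
leibnizTerms {n} A = map (λ sp → proj₁ sp * prodFin n (λ i → A i (proj₂ sp i))) (perms n)

det : {n : ℕ} → (Fin n → Fin n → ℤ) → ℤ
det A = foldr _+_ 0ℤ (leibnizTerms A)

IsPP : (a b c : ℕ) → Vec (Vec ℕ b) a → Set
IsPP a b c M =
  (∀ (i : Fin a) (j : Fin b) → lookup (lookup M i) j ℕ.≤ c) ×
  (∀ (i : Fin a) (j j' : Fin b) → j Fin.≤ j' → lookup (lookup M i) j' ℕ.≤ lookup (lookup M i) j) ×
  (∀ (i i' : Fin a) (j : Fin b) → i Fin.≤ i' → lookup (lookup M i') j ℕ.≤ lookup (lookup M i) j)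

isPP? : (a b c : ℕ) → (M : Vec (Vec ℕ b) a) → Dec (IsPP a b c M)
isPP? a b c M =
  all? (λ i → all? (λ j → lookup (lookup M i) j ℕ.≤? c)) ×-dec
  all? (λ i → all? (λ j → all? (λ j' → (j Fin.≤? j') →-dec
         (lookup (lookup M i) j' ℕ.≤? lookup (lookup M i) j)))) ×-dec
  all? (λ i → all? (λ i' → all? (λ j → (i Fin.≤? i') →-dec
         (lookup (lookup M i') j ℕ.≤? lookup (lookup M i) j))))

allVecs : {A : Set} → List A → (n : ℕ) → List (Vec A n)
allVecs xs zero = [ Vec.[] ]
allVecs xs (suc n) = concatMap (λ x → map (x Vec.∷_) (allVecs xs n)) xs

numPP : ℕ → ℕ → ℕ → ℕ
numPP a b c = length (filter (isPP? a b c) (allVecs (allVecs (upTo (suc c)) b) a))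

-- The basis vector with indices (j₁ , j₂ , j₃) is a triangle of the hexagon and α(X) lowers one index,
-- so the nonzero entries j₁, j₂, j₃ sit on the edges of Z(a,b,c).  They form a coboundary: an entry
-- from t to s equals F(t) / F(s) with F = j₁! j₂! j₃!, so every perfect matching has the same weight.
--
-- Signs: order both colour classes lexicographically by (j₁ , j₂).  A pair of edges of a matching is
-- inverted only if exactly one of them is vertical (lowers j₁), and the number of inversions through a
-- vertical edge depends only on its level j₁; since Σ f(j₁) over vertical edges telescopes, the number
-- of inversions is the same for all matchings.
--
-- Counting: a matching is determined by its height function, which counts vertical edges along a
-- level, and the height functions are exactly the surfaces of the plane partitions in the box.

module Submission where

open import Defs
open import Algebra.Bundles using (CommutativeMonoid)
import Algebra.Properties.CommutativeMonoid.Sum as CommutativeMonoidSum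
import Algebra.Properties.CommutativeSemigroup as CommutativeSemigroupProperties
import Algebra.Properties.Semiring.Sum as SemiringSum
open import Axiom.UniquenessOfIdentityProofs.WithK using (uip)
open import Data.Bool.Base using (Bool; true; false; T; _∧_; _∨_; if_then_else_)
open import Data.Empty using (⊥; ⊥-elim)
open import Data.Fin.Base as Fin using (Fin; toℕ; fromℕ<; punchIn; punchOut)
import Data.Fin.Properties as Fₚ
open import Data.Integer.Base as ℤ using (ℤ; 0ℤ; 1ℤ; -1ℤ)
import Data.Integer.Properties as ℤₚ
open import Data.Integer.Tactic.RingSolver using (solve-∀)
open import Data.List.Base as List using (List; []; _∷_; _++_)
open import Data.List.Membership.Propositional using (_∈_; find)
import Data.List.Membership.Propositional.Properties as ∈ₚ
open import Data.List.Relation.Unary.All as All using (All; []; _∷_)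
import Data.List.Relation.Unary.All.Properties as Allₚ
open import Data.List.Relation.Unary.AllPairs as AllPairs using (AllPairs; []; _∷_)
import Data.List.Relation.Unary.AllPairs.Properties as AllPairsₚ
open import Data.List.Relation.Unary.Any as Any using (here; there)
import Data.List.Relation.Unary.Any.Properties as Anyₚ
import Data.List.Relation.Unary.Unique.Propositional.Properties as Uniqueₚ
open import Data.Nat.Base as ℕ using (ℕ; zero; suc; s≤s; z≤n)
import Data.Nat.Properties as ℕₚ
open import Data.Nat.Tactic.RingSolver using () renaming (solve-∀ to solveℕ-∀)
open import Data.Product.Base as Product using (Σ-syntax; ∃-syntax; _×_; _,_; proj₁; proj₂)
open import Data.Sum.Base as Sum using (_⊎_; inj₁; inj₂; [_,_]′)
open import Data.Unit.Base using (tt)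
open import Data.Vec.Base as Vec using (Vec)
open import Data.Vec.N-ary using (N-ary; _$ⁿ_; ∀ⁿ; curryⁿ)
import Data.Vec.Properties as Vecₚ
open import Function.Base using (_∘_)
open import Function.Bundles using (_↔_; Inverse; mk↔ₛ′)
open import Relation.Binary.Definitions using (tri<; tri≈; tri>)
open import Relation.Binary.PropositionalEquality using (_≡_; _≢_; refl; sym; trans; cong; cong₂; subst; subst₂; module ≡-Reasoning)
import Relation.Binary.Reasoning.Setoid as SetoidReasoning
open import Relation.Nullary using (Dec; yes; no; ¬_; ¬?)
open import Relation.Nullary.Decidable using (dec-true; dec-false; decidable-stable)
open import Relation.Unary using (Decidable)
open import Algebra.Properties.AbelianGroup ℤₚ.+-0-abelianGroup using (∙-cancelʳ)

-- Linear arithmetic over ℕ by Fourier–Motzkin elimination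

-- The theorem admits every numbering of the two bases, while inversions are natural only for the
-- lexicographic order. A change of numbering multiplies the signs of all matchings by the same
-- factor, so signs are only compared with each other and that factor stays unevaluated. The
-- geometry enters through sums of the 0/1 indicators `δ` and `θ` in the plane of `(j₁ , j₂)`. In
-- the rectangle of possible pairs each colour fills a band of antidiagonals, and the two bands are
-- shifted against each other by one, so rows of the two colours can be compared exactly. These
-- comparisons yield both the count of inversions through a vertical edge and the rule by which
-- heights change from one level to the next. That some term is nonzero needs one matching, and the
-- empty partition provides it. Flatness is a separate local fact: opposite edges of a face carry
-- equal weights.

module LinearArithmetic where

  open import Data.Integer.Base using (+_; -[1+_])
  open import Data.Vec.Base using ([]; _∷_; lookup; replicate; zipWith)

  infixl 6 _:+_
  infix 4 _:≤_ _:<_ _:≡_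
  infixr 3 _:→_

  data Exp (n : ℕ) : Set where
    :var : Fin n → Exp n
    :con : ℕ → Exp n
    _:+_ : Exp n → Exp n → Exp n

  :suc : ∀ {n} → Exp n → Exp n
  :suc e = :con 1 :+ e

  data Form (n : ℕ) : Set where
    _:≤_ _:<_ _:≡_ : Exp n → Exp n → Form n
    :⊥ : Form n

  data Problem (n : ℕ) : Set where
    :goal : Form n → Problem n
    _:→_ : Form n → Problem n → Problem n

  ⟦_⟧ᵉ : ∀ {n} → Exp n → Vec ℕ n → ℕ
  ⟦ :var i ⟧ᵉ ρ = lookup ρ i
  ⟦ :con k ⟧ᵉ ρ = k
  ⟦ e :+ f ⟧ᵉ ρ = ⟦ e ⟧ᵉ ρ ℕ.+ ⟦ f ⟧ᵉ ρ

  ⟦_⟧ᶠ : ∀ {n} → Form n → Vec ℕ n → Set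
  ⟦ e :≤ f ⟧ᶠ ρ = ⟦ e ⟧ᵉ ρ ℕ.≤ ⟦ f ⟧ᵉ ρ
  ⟦ e :< f ⟧ᶠ ρ = ⟦ e ⟧ᵉ ρ ℕ.< ⟦ f ⟧ᵉ ρ
  ⟦ e :≡ f ⟧ᶠ ρ = ⟦ e ⟧ᵉ ρ ≡ ⟦ f ⟧ᵉ ρ
  ⟦ :⊥ ⟧ᶠ ρ = ⊥

  ⟦_⟧ : ∀ {n} → Problem n → Vec ℕ n → Set
  ⟦ :goal g ⟧ ρ = ⟦ g ⟧ᶠ ρ
  ⟦ h :→ P ⟧ ρ = ⟦ h ⟧ᶠ ρ → ⟦ P ⟧ ρ

  -- A row (k , v) stands for the inequality 0 ≤ k + v · ρ.
  Row : ℕ → Set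
  Row n = ℤ × Vec ℤ n

  dot : ∀ {n} → Vec ℤ n → Vec ℕ n → ℤ
  dot [] [] = 0ℤ
  dot (x ∷ v) (y ∷ ρ) = x ℤ.* + y ℤ.+ dot v ρ

  value : ∀ {n} → Row n → Vec ℕ n → ℤ
  value (k , v) ρ = k ℤ.+ dot v ρ

  Holds : ∀ {n} → Vec ℕ n → Row n → Set
  Holds ρ R = 0ℤ ℤ.≤ value R ρ

  scale : ∀ {n} → ℤ → Row n → Row n
  scale x (k , v) = x ℤ.* k , Vec.map (x ℤ.*_) v

  _⊞_ : ∀ {n} → Row n → Row n → Row n
  (k , v) ⊞ (l , w) = k ℤ.+ l , zipWith ℤ._+_ v w

  constant : ∀ {n} → ℤ → Row n
  constant k = k , replicate _ 0ℤ

  unit : ∀ {n} → Fin n → Vec ℤ n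
  unit Fin.zero = 1ℤ ∷ replicate _ 0ℤ
  unit (Fin.suc i) = 0ℤ ∷ unit i

  row : ∀ {n} → Exp n → Row n
  row (:var i) = 0ℤ , unit i
  row (:con k) = constant (+ k)
  row (e :+ f) = row e ⊞ row f

  dot-0 : ∀ {n} (ρ : Vec ℕ n) → dot (replicate n 0ℤ) ρ ≡ 0ℤ
  dot-0 [] = refl
  dot-0 (y ∷ ρ) = trans (ℤₚ.+-identityˡ _) (dot-0 ρ)

  dot-unit : ∀ {n} (i : Fin n) ρ → dot (unit i) ρ ≡ + lookup ρ i
  dot-unit Fin.zero (y ∷ ρ) =
    trans (cong₂ ℤ._+_ (ℤₚ.*-identityˡ (+ y)) (dot-0 ρ)) (ℤₚ.+-identityʳ (+ y))
  dot-unit (Fin.suc i) (y ∷ ρ) = trans (ℤₚ.+-identityˡ _) (dot-unit i ρ)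

  dot-+ : ∀ {n} (v w : Vec ℤ n) ρ → dot (zipWith ℤ._+_ v w) ρ ≡ dot v ρ ℤ.+ dot w ρ
  dot-+ [] [] [] = refl
  dot-+ (x ∷ v) (x' ∷ w) (y ∷ ρ) rewrite dot-+ v w ρ = rearrange x x' (+ y) (dot v ρ) (dot w ρ)
    where
    rearrange : ∀ a b y p q →
      (a ℤ.+ b) ℤ.* y ℤ.+ (p ℤ.+ q) ≡ a ℤ.* y ℤ.+ p ℤ.+ (b ℤ.* y ℤ.+ q)
    rearrange = solve-∀

  dot-* : ∀ {n} x (v : Vec ℤ n) ρ → dot (Vec.map (x ℤ.*_) v) ρ ≡ x ℤ.* dot v ρ
  dot-* x [] [] = sym (ℤₚ.*-zeroʳ x)
  dot-* x (z ∷ v) (y ∷ ρ) rewrite dot-* x v ρ = rearrange x z (+ y) (dot v ρ)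
    where
    rearrange : ∀ a b y p → a ℤ.* b ℤ.* y ℤ.+ a ℤ.* p ≡ a ℤ.* (b ℤ.* y ℤ.+ p)
    rearrange = solve-∀

  value-⊞ : ∀ {n} (R S : Row n) ρ → value (R ⊞ S) ρ ≡ value R ρ ℤ.+ value S ρ
  value-⊞ (k , v) (l , w) ρ rewrite dot-+ v w ρ = rearrange k l (dot v ρ) (dot w ρ)
    where
    rearrange : ∀ a b p q → a ℤ.+ b ℤ.+ (p ℤ.+ q) ≡ a ℤ.+ p ℤ.+ (b ℤ.+ q)
    rearrange = solve-∀

  value-scale : ∀ {n} x (R : Row n) ρ → value (scale x R) ρ ≡ x ℤ.* value R ρ
  value-scale x (k , v) ρ rewrite dot-* x v ρ = sym (ℤₚ.*-distribˡ-+ x k (dot v ρ))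

  value-row : ∀ {n} (e : Exp n) ρ → value (row e) ρ ≡ + ⟦ e ⟧ᵉ ρ
  value-row (:var i) ρ = trans (ℤₚ.+-identityˡ _) (dot-unit i ρ)
  value-row (:con k) ρ = trans (cong (ℤ._+_ (+ k)) (dot-0 ρ)) (ℤₚ.+-identityʳ (+ k))
  value-row (e :+ f) ρ = trans (value-⊞ (row e) (row f) ρ) (cong₂ ℤ._+_ (value-row e ρ) (value-row f ρ))

  row≤ : ∀ {n} → Exp n → Exp n → Row n
  row≤ e f = row f ⊞ scale -1ℤ (row e)

  row≤-holds : ∀ {n} (e f : Exp n) {ρ} → ⟦ e ⟧ᵉ ρ ℕ.≤ ⟦ f ⟧ᵉ ρ → Holds ρ (row≤ e f)
  row≤-holds e f {ρ} e≤f =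
    subst (0ℤ ℤ.≤_) (sym (trans (value-⊞ (row f) _ ρ) (cong₂ ℤ._+_ (value-row f ρ)
        (trans (value-scale -1ℤ (row e) ρ) (trans (cong (-1ℤ ℤ.*_) (value-row e ρ)) (ℤₚ.-1*i≡-i _))))))
      (ℤₚ.i≤j⇒0≤j-i (ℤ.+≤+ e≤f))

  rows : ∀ {n} → Form n → List (Row n)
  rows (e :≤ f) = row≤ e f ∷ []
  rows (e :< f) = row≤ (:con 1 :+ e) f ∷ []
  rows (e :≡ f) = row≤ e f ∷ row≤ f e ∷ []
  rows :⊥ = constant -1ℤ ∷ []

  rows-hold : ∀ {n} (h : Form n) {ρ} → ⟦ h ⟧ᶠ ρ → All (Holds ρ) (rows h)
  rows-hold (e :≤ f) p = row≤-holds e f p ∷ []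
  rows-hold (e :< f) p = row≤-holds (:con 1 :+ e) f p ∷ []
  rows-hold (e :≡ f) p = row≤-holds e f (ℕₚ.≤-reflexive p) ∷ row≤-holds f e (ℕₚ.≤-reflexive (sym p)) ∷ []

  neg? : ℤ → Bool
  neg? (+ _) = false
  neg? -[1+ _ ] = true

  -- A row without a negative coefficient or constant holds at every natural point, so discarding it
  -- loses no information and curbs the growth of the elimination.
  useful : ∀ {n} → Row n → Bool
  useful (k , v) = neg? k ∨ Vec.foldr (λ _ → Bool) (λ z s → neg? z ∨ s) false v

  add : ∀ {n} → Row n → List (Row n) → List (Row n)
  add R Rs = if useful R then R ∷ Rs else Rs

  add-holds : ∀ {n ρ} {R : Row n} {Rs} → Holds ρ R → All (Holds ρ) Rs → All (Holds ρ) (add R Rs)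
  add-holds {R = R} p ps with useful R
  ... | true = p ∷ ps
  ... | false = ps

  data Sign : ℤ → Set where
    zer : Sign 0ℤ
    pos : ∀ m → Sign (+ suc m)
    neg : ∀ m → Sign -[1+ m ]

  sign : ∀ x → Sign x
  sign (+ zero) = zer
  sign (+ suc m) = pos m
  sign -[1+ m ] = neg m

  -- A bound (m , R) stands for 0 ≤ (1 + m) x + R (lower) or 0 ≤ - (1 + m) x + R (upper),
  -- where x is the variable being eliminated.
  Bound : ℕ → Set
  Bound n = ℕ × Row n

  record Split (n : ℕ) : Set where
    constructor split
    field
      lower upper : List (Bound n)
      free : List (Row n)

  HoldsL HoldsU : ∀ {n} → ℕ → Vec ℕ n → Bound n → Set
  HoldsL x ρ (m , R) = 0ℤ ℤ.≤ + suc m ℤ.* + x ℤ.+ value R ρ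
  HoldsU x ρ (m , R) = 0ℤ ℤ.≤ -[1+ m ] ℤ.* + x ℤ.+ value R ρ

  record SplitHolds {n} (x : ℕ) (ρ : Vec ℕ n) (S : Split n) : Set where
    constructor split
    open Split S
    field
      lowerH : All (HoldsL x ρ) lower
      upperH : All (HoldsU x ρ) upper
      freeH : All (Holds ρ) free

  splitRows : ∀ {n} → List (Row (suc n)) → Split n
  -- The extra lower bound `0 ≤ 1 · x + 0` records that the eliminated variable is a natural number.
  splitRows [] = split ((0 , constant 0ℤ) ∷ []) [] []
  splitRows ((k , z ∷ v) ∷ Rs) with splitRows Rs | sign z
  ... | split l u f | zer = split l u ((k , v) ∷ f)
  ... | split l u f | pos m = split ((m , k , v) ∷ l) u f
  ... | split l u f | neg m = split l ((m , k , v) ∷ u) f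

  splitRows-hold : ∀ {n x} {ρ : Vec ℕ n} Rs → All (Holds (x ∷ ρ)) Rs → SplitHolds x ρ (splitRows Rs)
  splitRows-hold {x = x} {ρ} [] [] = split (0≤x ∷ []) [] []
    where
    0≤x : HoldsL x ρ (0 , constant 0ℤ)
    0≤x = subst (0ℤ ℤ.≤_)
      (sym (trans (cong₂ ℤ._+_ (ℤₚ.*-identityˡ (+ x)) (trans (ℤₚ.+-identityˡ _) (dot-0 ρ)))
        (ℤₚ.+-identityʳ (+ x))))
      (ℤ.+≤+ ℕ.z≤n)
  splitRows-hold {x = x} {ρ} ((k , z ∷ v) ∷ Rs) (p ∷ ps)
    with splitRows Rs | splitRows-hold Rs ps | sign z
  ... | split l u f | split L U F | zer =
    split L U (subst (0ℤ ℤ.≤_) (cong (ℤ._+_ k) (ℤₚ.+-identityˡ _)) p ∷ F)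
  ... | split l u f | split L U F | pos m = split (subst (0ℤ ℤ.≤_) (swap k (+ suc m ℤ.* + x) (dot v ρ)) p ∷ L)
    U F
    where
    swap : ∀ a b c → a ℤ.+ (b ℤ.+ c) ≡ b ℤ.+ (a ℤ.+ c)
    swap = solve-∀
  ... | split l u f | split L U F | neg m = split L
    (subst (0ℤ ℤ.≤_) (swap k (-[1+ m ] ℤ.* + x) (dot v ρ)) p ∷ U) F
    where
    swap : ∀ a b c → a ℤ.+ (b ℤ.+ c) ≡ b ℤ.+ (a ℤ.+ c)
    swap = solve-∀

  -- The multipliers are the absolute values of the two coefficients, crosswise; both are positive,
  -- so the variable cancels and the direction of the inequality survives.
  combine : ∀ {n} → Bound n → Bound n → Row n
  combine (m , R) (l , S) = scale (+ suc l) R ⊞ scale (+ suc m) S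

  0≤-* : ∀ m {i} → 0ℤ ℤ.≤ i → 0ℤ ℤ.≤ + suc m ℤ.* i
  0≤-* m {i} p = subst (ℤ._≤ + suc m ℤ.* i) (ℤₚ.*-zeroʳ (+ suc m)) (ℤₚ.*-monoˡ-≤-nonNeg (+ suc m) p)

  combine-holds : ∀ {n} x (ρ : Vec ℕ n) B C → HoldsL x ρ B → HoldsU x ρ C → Holds ρ (combine B C)
  combine-holds x ρ (m , R) (l , S) p q =
    subst (0ℤ ℤ.≤_)
      (trans (cancel (+ suc m) (+ suc l) (+ x) (value R ρ) (value S ρ))
        (sym (trans (value-⊞ (scale (+ suc l) R) _ ρ)
          (cong₂ ℤ._+_ (value-scale (+ suc l) R ρ) (value-scale (+ suc m) S ρ)))))
      (ℤₚ.+-mono-≤ (0≤-* l p) (0≤-* m q))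
    where
    cancel : ∀ m l x r s →
      l ℤ.* (m ℤ.* x ℤ.+ r) ℤ.+ m ℤ.* (ℤ.- l ℤ.* x ℤ.+ s) ≡ l ℤ.* r ℤ.+ m ℤ.* s
    cancel = solve-∀

  combineAll : ∀ {n} → List (Bound n) → List (Bound n) → List (Row n) → List (Row n)
  combineAll [] us f = f
  combineAll (B ∷ ls) us f = List.foldr (λ C → add (combine B C)) (combineAll ls us f) us

  combineAll-holds : ∀ {n} x (ρ : Vec ℕ n) ls us f → All (HoldsL x ρ) ls → All (HoldsU x ρ) us →
    All (Holds ρ) f → All (Holds ρ) (combineAll ls us f)
  combineAll-holds x ρ [] us f [] hu hf = hf
  combineAll-holds x ρ (B ∷ ls) us f (p ∷ hl) hu hf = go us hu
    where
    go : ∀ vs → All (HoldsU x ρ) vs →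
      All (Holds ρ) (List.foldr (λ C → add (combine B C)) (combineAll ls us f) vs)
    go [] [] = combineAll-holds x ρ ls us f hl hu hf
    go (C ∷ vs) (q ∷ qs) = add-holds {R = combine B C} (combine-holds x ρ B C p q) (go vs qs)

  refutable : ∀ {n} → List (Row n) → Bool
  refutable {zero} Rs = List.foldr (λ R s → neg? (proj₁ R) ∨ s) false Rs
  refutable {suc n} Rs = let split l u f = splitRows Rs in refutable (combineAll l u f)

  -- Every row that elimination produces is a nonnegative combination of rows that hold, hence holds
  -- itself; once all variables are gone, a negative constant is absurd.
  refute : ∀ {n} (Rs : List (Row n)) ρ → All (Holds ρ) Rs → T (refutable Rs) → ⊥
  refute {zero} ((+ k , []) ∷ Rs) [] (p ∷ ps) t = refute Rs [] ps t
  refute {zero} ((-[1+ k ] , []) ∷ Rs) [] (() ∷ ps) t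
  refute {suc n} Rs (x ∷ ρ) ps t with splitRows Rs | splitRows-hold Rs ps
  ... | split l u f | split L U F = refute (combineAll l u f) ρ (combineAll-holds x ρ l u f L U F) t

  -- Goals are proved by contradiction. Integrality enters here: the negation of `e ≤ f` is taken in
  -- the stronger form `1 + f ≤ e`.
  valid : ∀ {n} → List (Row n) → Form n → Bool
  valid Rs (e :≤ f) = refutable (row≤ (:con 1 :+ f) e ∷ Rs)
  valid Rs (e :< f) = refutable (row≤ f e ∷ Rs)
  valid Rs (e :≡ f) = valid Rs (e :≤ f) ∧ valid Rs (f :≤ e)
  valid Rs :⊥ = refutable Rs

  T-∧ˡ : ∀ x {y} → T (x ∧ y) → T x
  T-∧ˡ true _ = tt

  T-∧ʳ : ∀ x {y} → T (x ∧ y) → T y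
  T-∧ʳ true t = t

  valid-sound : ∀ {n} Rs (g : Form n) ρ → All (Holds ρ) Rs → T (valid Rs g) → ⟦ g ⟧ᶠ ρ
  valid-sound Rs (e :≤ f) ρ ps t with ⟦ e ⟧ᵉ ρ ℕₚ.≤? ⟦ f ⟧ᵉ ρ
  ... | yes e≤f = e≤f
  ... | no e≰f = ⊥-elim (refute _ ρ (row≤-holds (:con 1 :+ f) e (ℕₚ.≰⇒> e≰f) ∷ ps) t)
  valid-sound Rs (e :< f) ρ ps t with ⟦ e ⟧ᵉ ρ ℕₚ.<? ⟦ f ⟧ᵉ ρ
  ... | yes e<f = e<f
  ... | no e≮f = ⊥-elim (refute _ ρ (row≤-holds f e (ℕₚ.≮⇒≥ e≮f) ∷ ps) t)
  valid-sound Rs (e :≡ f) ρ ps t = ℕₚ.≤-antisym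
    (valid-sound Rs (e :≤ f) ρ ps (T-∧ˡ (valid Rs (e :≤ f)) t))
    (valid-sound Rs (f :≤ e) ρ ps (T-∧ʳ (valid Rs (e :≤ f)) t))
  valid-sound Rs :⊥ ρ ps t = refute Rs ρ ps t

  check : ∀ {n} → List (Row n) → Problem n → Bool
  check Rs (:goal g) = valid Rs g
  check Rs (h :→ P) = check (rows h ++ Rs) P

  check-sound : ∀ {n} Rs (P : Problem n) ρ → All (Holds ρ) Rs → T (check Rs P) → ⟦ P ⟧ ρ
  check-sound Rs (:goal g) ρ ps t = valid-sound Rs g ρ ps t
  check-sound Rs (h :→ P) ρ ps t p = check-sound _ P ρ (Allₚ.++⁺ (rows-hold h p) ps) t

  variables : ∀ n → Vec (Exp n) n
  variables n = Vec.map :var (Vec.allFin n)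

  Statement : ∀ n → N-ary n (Exp n) (Problem n) → Vec ℕ n → Set
  Statement n f = ⟦ f $ⁿ variables n ⟧

  curry-∀ : ∀ n {A : Set} {B : Vec A n → Set} → (∀ xs → B xs) → ∀ⁿ n (curryⁿ B)
  curry-∀ zero f = f []
  curry-∀ (suc n) f = λ x → curry-∀ n (λ xs → f (x ∷ xs))

  -- A problem is given as a function of its variables, so that calls can name them. The type of `t`
  -- computes to the unit type when elimination succeeds, and `t` is then filled in without being
  -- written. Nonlinear quantities are passed as variables and facts about them as hypotheses.
  lia : ∀ n (f : N-ary n (Exp n) (Problem n)) {t : T (check [] (f $ⁿ variables n))} →
    ∀ⁿ n (curryⁿ (Statement n f))
  lia n f {t} = curry-∀ n λ ρ → check-sound [] (f $ⁿ variables n) ρ [] t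

open LinearArithmetic using (lia; :con; :suc; :goal; :⊥; _:+_; _:≤_; _:<_; _:≡_; _:→_)

-- Permutations

module _ {n : ℕ} where

  extend : Fin (suc n) → ℤ × (Fin n → Fin n) → ℤ × (Fin (suc n) → Fin (suc n))
  extend k sp = sgn (toℕ k) ℤ.* proj₁ sp , consPerm k (proj₂ sp)

  perms-suc : ∀ {sp} → sp ∈ perms (suc n) → ∃[ k ] ∃[ sp' ] sp' ∈ perms n × sp ≡ extend k sp'
  perms-suc sp∈
    with k , _ , sp∈k ← find (∈ₚ.∈-concatMap⁻ (λ k → List.map (extend k) (perms n)) {xs = List.allFin (suc n)}
      sp∈)
    with sp' , sp'∈ , eq ← ∈ₚ.∈-map⁻ (extend k) sp∈k
    = k , sp' , sp'∈ , eq

-- Stated for a commutative monoid because it serves twice: for counting in `(ℕ , +)` and for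
-- products of signs and weights in `(ℤ , *)`.
module PermutationSums {ℓ₁ ℓ₂} (M : CommutativeMonoid ℓ₁ ℓ₂) where
  open CommutativeMonoid M renaming (refl to ≈-refl; sym to ≈-sym; trans to ≈-trans)
  open CommutativeMonoidSum M
  open CommutativeSemigroupProperties commutativeSemigroup using (interchange)
  open SetoidReasoning setoid

  sum-reindex : ∀ {n sp} → sp ∈ perms n → ∀ f → sum (λ i → f (proj₂ sp i)) ≈ sum f
  sum-reindex {zero} _ f = ≈-refl
  sum-reindex {suc n} sp∈ f with k , sp' , sp'∈ , refl ← perms-suc sp∈ = begin
    f k ∙ sum (λ i → f (punchIn k (proj₂ sp' i))) ≈⟨ ∙-congˡ (sum-reindex sp'∈ (λ i → f (punchIn k i))) ⟩
    f k ∙ sum (λ i → f (punchIn k i))             ≈⟨ sum-remove f ⟨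
    sum f                                         ∎

  -- Only pairs with `i < j` enter, the smaller index first, so a weight has to be symmetric before
  -- it can be reindexed by a permutation.
  pairs : ∀ n → (Fin n → Fin n → Carrier) → Carrier
  pairs zero w = ε
  pairs (suc n) w = sum (λ j → w Fin.zero (Fin.suc j)) ∙ pairs n (λ i j → w (Fin.suc i) (Fin.suc j))

  pairs-cong : ∀ n {w w'} → (∀ i j → i ≢ j → w i j ≈ w' i j) → pairs n w ≈ pairs n w'
  pairs-cong zero eq = ≈-refl
  pairs-cong (suc n) eq = ∙-cong (sum-cong-≋ (λ j → eq Fin.zero (Fin.suc j) λ ()))
    (pairs-cong n (λ i j i≢j → eq (Fin.suc i) (Fin.suc j) (i≢j ∘ Fₚ.suc-injective)))

  pairs-distrib : ∀ n w w' → pairs n (λ i j → w i j ∙ w' i j) ≈ pairs n w ∙ pairs n w'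
  pairs-distrib zero w w' = ≈-sym (identityˡ ε)
  pairs-distrib (suc n) w w' =
    ≈-trans (∙-cong (∑-distrib-+ (λ j → w Fin.zero (Fin.suc j)) _) (pairs-distrib n _ _)) (interchange _ _ _ _)

  pairs-ε : ∀ n → pairs n (λ _ _ → ε) ≈ ε
  pairs-ε zero = ≈-refl
  pairs-ε (suc n) = ≈-trans (∙-cong (sum-replicate-zero n) (pairs-ε n)) (identityˡ ε)

  -- The pairs split into those that contain `k` and those that avoid it. Symmetry turns around the
  -- pairs in which `k` is the larger index.
  pairs-remove : ∀ n (k : Fin (suc n)) w → (∀ i j → w i j ≈ w j i) →
    sum (λ j → w k (punchIn k j)) ∙ pairs n (λ i j → w (punchIn k i) (punchIn k j)) ≈ pairs (suc n) w
  pairs-remove n Fin.zero w w-sym = ≈-refl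
  pairs-remove (suc n) (Fin.suc k) w w-sym = begin
    (w (Fin.suc k) Fin.zero ∙ A) ∙ (B ∙ C) ≈⟨ ∙-congʳ (∙-congʳ (w-sym _ _)) ⟩
    (w Fin.zero (Fin.suc k) ∙ A) ∙ (B ∙ C) ≈⟨ interchange _ _ _ _ ⟩
    (w Fin.zero (Fin.suc k) ∙ B) ∙ (A ∙ C) ≈⟨ ∙-cong (≈-sym (sum-remove {i = k} (λ j → w Fin.zero (Fin.suc j))))
                                            (pairs-remove n k (λ i j → w (Fin.suc i) (Fin.suc j))
                                              (λ i j → w-sym _ _)) ⟩
    pairs (suc (suc n)) w              ∎
    where
    A = sum (λ j → w (Fin.suc k) (Fin.suc (punchIn k j)))
    B = sum (λ j → w Fin.zero (Fin.suc (punchIn k j)))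
    C = pairs n (λ i j → w (Fin.suc (punchIn k i)) (Fin.suc (punchIn k j)))

  pairs-reindex : ∀ {n sp} → sp ∈ perms n → ∀ w → (∀ i j → w i j ≈ w j i) →
    pairs n (λ i j → w (proj₂ sp i) (proj₂ sp j)) ≈ pairs n w
  pairs-reindex {zero} _ w w-sym = ≈-refl
  pairs-reindex {suc n} sp∈ w w-sym with k , sp' , sp'∈ , refl ← perms-suc sp∈ = begin
    sum (λ j → w k (punchIn k (proj₂ sp' j))) ∙
      pairs n (λ i j → w (punchIn k (proj₂ sp' i)) (punchIn k (proj₂ sp' j)))
      ≈⟨ ∙-cong (sum-reindex sp'∈ (λ j → w k (punchIn k j)))
                (pairs-reindex sp'∈ (λ i j → w (punchIn k i) (punchIn k j)) (λ i j → w-sym _ _)) ⟩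
    sum (λ j → w k (punchIn k j)) ∙ pairs n (λ i j → w (punchIn k i) (punchIn k j))
      ≈⟨ pairs-remove n k w w-sym ⟩
    pairs (suc n) w ∎

module Π where
  open CommutativeMonoidSum ℤₚ.*-1-commutativeMonoid public
  open PermutationSums ℤₚ.*-1-commutativeMonoid public

open SemiringSum ℕₚ.+-*-semiring public
  using (sum; sum-syntax; sum-cong-≗; sum-replicate-zero; ∑-distrib-+; ∑-comm; *-distribˡ-sum; sum-remove)
open PermutationSums ℕₚ.+-0-commutativeMonoid public using (sum-reindex)

-- The 0/1 indicators of x ≡ y and of x < y.
δ θ : ℕ → ℕ → ℕ
δ zero zero = 1
δ zero (suc y) = 0
δ (suc x) zero = 0
δ (suc x) (suc y) = δ x y

θ x zero = 0
θ zero (suc y) = 1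
θ (suc x) (suc y) = θ x y

δ-refl : ∀ x → δ x x ≡ 1
δ-refl zero = refl
δ-refl (suc x) = δ-refl x

δ-≢ : ∀ {x y} → x ≢ y → δ x y ≡ 0
δ-≢ {zero} {zero} p = ⊥-elim (p refl)
δ-≢ {zero} {suc y} p = refl
δ-≢ {suc x} {zero} p = refl
δ-≢ {suc x} {suc y} p = δ-≢ (p ∘ cong suc)

δ-sym : ∀ x y → δ x y ≡ δ y x
δ-sym zero zero = refl
δ-sym zero (suc y) = refl
δ-sym (suc x) zero = refl
δ-sym (suc x) (suc y) = δ-sym x y

δ-+ : ∀ k x y → δ (k ℕ.+ x) (k ℕ.+ y) ≡ δ x y
δ-+ zero x y = refl
δ-+ (suc k) x y = δ-+ k x y

θ-< : ∀ {x y} → x ℕ.< y → θ x y ≡ 1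
θ-< {zero} (s≤s p) = refl
θ-< {suc x} (s≤s p) = θ-< p

θ-≥ : ∀ {x y} → y ℕ.≤ x → θ x y ≡ 0
θ-≥ z≤n = refl
θ-≥ (s≤s p) = θ-≥ p

θ-sucʳ : ∀ x y → θ x (suc y) ≡ θ x y ℕ.+ δ x y
θ-sucʳ zero zero = refl
θ-sucʳ zero (suc y) = refl
θ-sucʳ (suc x) zero = refl
θ-sucʳ (suc x) (suc y) = θ-sucʳ x y

θ-sucˡ : ∀ x y → θ x y ≡ θ (suc x) y ℕ.+ δ (suc x) y
θ-sucˡ x zero = refl
θ-sucˡ zero (suc zero) = refl
θ-sucˡ zero (suc (suc y)) = refl
θ-sucˡ (suc x) (suc y) = θ-sucˡ x y

trichotomy : ∀ x y → θ x y ℕ.+ θ y x ℕ.+ δ x y ≡ 1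
trichotomy zero zero = refl
trichotomy zero (suc y) = refl
trichotomy (suc x) zero = refl
trichotomy (suc x) (suc y) = trichotomy x y

-- Sums against indicators

sum-zero : ∀ {n} (f : Fin n → ℕ) → (∀ i → f i ≡ 0) → sum f ≡ 0
sum-zero {n} f f≡0 = trans (sum-cong-≗ f≡0) (sum-replicate-zero n)

sum-single : ∀ {n} (f : Fin n → ℕ) i → (∀ j → j ≢ i → f j ≡ 0) → sum f ≡ f i
sum-single f Fin.zero f≡0 =
  trans (cong (f Fin.zero ℕ.+_) (sum-zero _ (λ j → f≡0 (Fin.suc j) λ ()))) (ℕₚ.+-identityʳ _)
sum-single f (Fin.suc i) f≡0 = trans (cong (λ z → z ℕ.+ sum (λ j → f (Fin.suc j))) (f≡0 Fin.zero λ ()))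
  (sum-single (λ j → f (Fin.suc j)) i (λ j j≢i → f≡0 (Fin.suc j) (j≢i ∘ Fₚ.suc-injective)))

sum-δ : ∀ {K x} → x ℕ.< K → ∀ (f : ℕ → ℕ) → ∑[ p < K ] (δ x (toℕ p) ℕ.* f (toℕ p)) ≡ f x
sum-δ {K} {x} x<K f = trans (sum-single _ (fromℕ< x<K) off) on
  where
  off : ∀ j → j ≢ fromℕ< x<K → δ x (toℕ j) ℕ.* f (toℕ j) ≡ 0
  off j j≢ = cong (ℕ._* f (toℕ j))
    (δ-≢ (λ eq → j≢ (Fₚ.toℕ-injective (trans (sym eq) (sym (Fₚ.toℕ-fromℕ< x<K))))))
  on : δ x (toℕ (fromℕ< x<K)) ℕ.* f (toℕ (fromℕ< x<K)) ≡ f x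
  on rewrite Fₚ.toℕ-fromℕ< x<K | δ-refl x = ℕₚ.+-identityʳ (f x)

-- Signs

sgn-+ : ∀ m n → sgn (m ℕ.+ n) ≡ sgn m ℤ.* sgn n
sgn-+ zero n = sym (ℤₚ.*-identityˡ _)
sgn-+ (suc m) n = trans (cong ℤ.-_ (sgn-+ m n)) (ℤₚ.neg-distribˡ-* (sgn m) (sgn n))

neg*neg : ∀ x y → ℤ.- x ℤ.* ℤ.- y ≡ x ℤ.* y
neg*neg = solve-∀

sgn-square : ∀ m → sgn m ℤ.* sgn m ≡ 1ℤ
sgn-square zero = refl
sgn-square (suc m) = trans (neg*neg (sgn m) (sgn m)) (sgn-square m)

-- The value is 1 for `i < j` and -1 otherwise, the `suc` making the exponent even in the first
-- case. Off the diagonal it is antisymmetric, as a comparison of two orders requires.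
order : ∀ {n} → Fin n → Fin n → ℤ
order i j = sgn (suc (θ (toℕ i) (toℕ j)))

θ-punchIn : ∀ {n} (k : Fin (suc n)) i j →
  θ (toℕ (punchIn k i)) (toℕ (punchIn k j)) ≡ θ (toℕ i) (toℕ j)
θ-punchIn Fin.zero i j = refl
θ-punchIn (Fin.suc k) Fin.zero Fin.zero = refl
θ-punchIn (Fin.suc k) Fin.zero (Fin.suc j) = refl
θ-punchIn (Fin.suc k) (Fin.suc i) Fin.zero = refl
θ-punchIn (Fin.suc k) (Fin.suc i) (Fin.suc j) = θ-punchIn k i j

-- Exactly the `toℕ k` indices below `k` contribute a factor -1.
order-row : ∀ {n} (k : Fin (suc n)) → Π.sum (λ j → order k (punchIn k j)) ≡ sgn (toℕ k)
order-row {zero} Fin.zero = refl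
order-row {suc n} Fin.zero = trans (ℤₚ.*-identityˡ _) (order-row {n} Fin.zero)
order-row {suc n} (Fin.suc k) = trans (cong (-1ℤ ℤ.*_) (order-row k)) (ℤₚ.-1*i≡-i _)

-- The first value `k` accounts for `sgn (toℕ k)`, and `punchIn k` preserves the order of the
-- remaining values.
perm-sign : ∀ {n sp} → sp ∈ perms n → proj₁ sp ≡ Π.pairs n (λ i j → order (proj₂ sp i) (proj₂ sp j))
perm-sign {zero} (here refl) = refl
perm-sign {suc n} sp∈ with k , sp' , sp'∈ , refl ← perms-suc sp∈ = cong₂ ℤ._*_
  (sym (trans (Π.sum-reindex sp'∈ (λ j → order k (punchIn k j))) (order-row k)))
  (trans (perm-sign sp'∈) (sym (Π.pairs-cong n (λ i j _ → cong (sgn ∘ suc) (θ-punchIn k _ _)))))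

-- Each unordered pair carries both of its ordered contributions and the diagonal is zero, so the
-- exponents add up to the full double sum.
pairs-sgn : ∀ n (e : Fin n → Fin n → ℕ) → (∀ i → e i i ≡ 0) →
  Π.pairs n (λ i j → sgn (e i j ℕ.+ e j i)) ≡ sgn (∑[ i < n ] ∑[ j < n ] e i j)
pairs-sgn zero e e≡0 = refl
pairs-sgn (suc n) e e≡0 = begin
  Π.sum (λ j → sgn (e Fin.zero (Fin.suc j) ℕ.+ e (Fin.suc j) Fin.zero)) ℤ.*
    Π.pairs n (λ i j → sgn (e (Fin.suc i) (Fin.suc j) ℕ.+ e (Fin.suc j) (Fin.suc i)))
    ≡⟨ cong₂ ℤ._*_ (prod-sgn (λ j → e Fin.zero (Fin.suc j) ℕ.+ e (Fin.suc j) Fin.zero))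
      (pairs-sgn n (λ i j → e (Fin.suc i) (Fin.suc j)) (λ i → e≡0 (Fin.suc i))) ⟩
  sgn (∑[ j < n ] (e Fin.zero (Fin.suc j) ℕ.+ e (Fin.suc j) Fin.zero)) ℤ.* sgn C
    ≡⟨ sgn-+ (∑[ j < n ] (e Fin.zero (Fin.suc j) ℕ.+ e (Fin.suc j) Fin.zero)) C ⟨
  sgn (∑[ j < n ] (e Fin.zero (Fin.suc j) ℕ.+ e (Fin.suc j) Fin.zero) ℕ.+ C)
    ≡⟨ cong (λ z → sgn (z ℕ.+ C)) (∑-distrib-+ (λ j → e Fin.zero (Fin.suc j)) _) ⟩
  sgn (A ℕ.+ B ℕ.+ C)
    ≡⟨ cong sgn (trans (ℕₚ.+-assoc A B C) (cong₂ ℕ._+_ (sym (cong (ℕ._+ A) (e≡0 Fin.zero)))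
         (sym (∑-distrib-+ (λ i → e (Fin.suc i) Fin.zero) (λ i → ∑[ j < n ] e (Fin.suc i) (Fin.suc j)))))) ⟩
  sgn (∑[ i < suc n ] ∑[ j < suc n ] e i j) ∎
  where
  open ≡-Reasoning
  A = ∑[ j < n ] e Fin.zero (Fin.suc j)
  B = ∑[ i < n ] e (Fin.suc i) Fin.zero
  C = ∑[ i < n ] ∑[ j < n ] e (Fin.suc i) (Fin.suc j)
  prod-sgn : ∀ {n} (f : Fin n → ℕ) → Π.sum (λ j → sgn (f j)) ≡ sgn (sum f)
  prod-sgn {zero} f = refl
  prod-sgn {suc n} f = trans (cong (sgn (f Fin.zero) ℤ.*_) (prod-sgn (λ j → f (Fin.suc j))))
    (sym (sgn-+ (f Fin.zero) _))

module Lozenges where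

  open import Data.Nat.Base using (_+_; _*_; _<_; _≤_; _∸_)
  open import Data.Vec.Base using (lookup; tabulate)

  -- Enumerations of the triangles

  -- No order is imposed on the numbering, because the theorem quantifies over all numberings of the
  -- bases.
  record Enumeration (In : ℕ → ℕ → Set) {N} (x y : Fin N → ℕ) : Set where
    field
      inside : ∀ i → In (x i) (y i)
      injective : ∀ {i j} → x i ≡ x j → y i ≡ y j → i ≡ j
      surjective : ∀ {r p} → In r p → ∃[ i ] x i ≡ r × y i ≡ p

  δδ-≢ : ∀ {r r' p p'} → ¬ (r ≡ r' × p ≡ p') → δ r r' * δ p p' ≡ 0
  δδ-≢ {r} {r'} {p} {p'} ne with r ℕₚ.≟ r'
  ... | no r≢ rewrite δ-≢ r≢ = refl
  ... | yes r≡ rewrite δ-≢ {p} {p'} (λ p≡ → ne (r≡ , p≡)) = ℕₚ.*-zeroʳ (δ r r')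

  module _ {N} (x y : Fin N → ℕ) where

    count : ℕ → ℕ → ℕ
    count r p = ∑[ i < N ] (δ (x i) r * δ (y i) p)

    -- Grouping by position replaces the arbitrary numbering by the counts at each place, which is
    -- what makes rows of different colours comparable.
    row-sum : ∀ {K} → (∀ i → y i < K) → ∀ r (ψ : ℕ → ℕ) →
      ∑[ i < N ] (δ (x i) r * ψ (y i)) ≡ ∑[ p < K ] (ψ (toℕ p) * count r (toℕ p))
    row-sum {K} y<K r ψ = begin
      ∑[ i < N ] (δ (x i) r * ψ (y i))
        ≡⟨ sum-cong-≗ (λ i → cong (δ (x i) r *_) (sum-δ (y<K i) ψ)) ⟨
      ∑[ i < N ] (δ (x i) r * ∑[ p < K ] (δ (y i) (toℕ p) * ψ (toℕ p)))
        ≡⟨ sum-cong-≗ (λ i → *-distribˡ-sum {K} (δ (x i) r) (λ p → δ (y i) (toℕ p) * ψ (toℕ p))) ⟩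
      ∑[ i < N ] ∑[ p < K ] (δ (x i) r * (δ (y i) (toℕ p) * ψ (toℕ p)))
        ≡⟨ ∑-comm {N} {K} (λ i p → δ (x i) r * (δ (y i) (toℕ p) * ψ (toℕ p))) ⟩
      ∑[ p < K ] ∑[ i < N ] (δ (x i) r * (δ (y i) (toℕ p) * ψ (toℕ p)))
        ≡⟨ sum-cong-≗ (λ (p : Fin K) → trans
             (sum-cong-≗ (λ i → rearrange (δ (x i) r) (δ (y i) (toℕ p)) (ψ (toℕ p))))
             (sym (*-distribˡ-sum {N} (ψ (toℕ p)) (λ i → δ (x i) r * δ (y i) (toℕ p))))) ⟩
      ∑[ p < K ] (ψ (toℕ p) * count r (toℕ p)) ∎
      where
      open ≡-Reasoning
      rearrange : ∀ u v w → u * (v * w) ≡ w * (u * v)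
      rearrange = solveℕ-∀

    module _ {In} (enum : Enumeration In x y) where
      open Enumeration enum

      count-in : ∀ {r p} → In r p → count r p ≡ 1
      count-in {r} {p} In-rp with k , refl , refl ← surjective In-rp =
        trans (sum-single _ k (λ j j≢k → δδ-≢ (λ (x≡ , y≡) → j≢k (injective x≡ y≡))))
              (cong₂ _*_ (δ-refl (x k)) (δ-refl (y k)))

      count-out : ∀ {r p} → ¬ In r p → count r p ≡ 0
      count-out ¬In = sum-zero _ (λ i → δδ-≢ (λ (x≡ , y≡) →
        ¬In (subst (λ r → In r _) x≡ (subst (In (x i)) y≡ (inside i)))))

  -- A row meets the antidiagonal in at most one position, `s - r - 1`; the two factors on the right
  -- say that it is a natural number and that it lies below `P`.
  θ-sum : ∀ {P K} → P ≤ K → ∀ r s →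
    ∑[ p < K ] (θ (toℕ p) P * δ (suc (r + toℕ p)) s) ≡ θ r s * θ s (suc (r + P))
  θ-sum {P} {K} P≤K r s with r ℕₚ.<? s
  ... | no r≮s rewrite θ-≥ (ℕₚ.≮⇒≥ r≮s) = sum-zero {K} _ (λ p →
    trans (cong (θ (toℕ p) P *_) (δ-≢ (λ eq → r≮s (subst (r <_) eq (s≤s (ℕₚ.m≤m+n r (toℕ p)))))))
          (ℕₚ.*-zeroʳ (θ (toℕ p) P)))
  ... | yes r<s with x , refl ← ℕₚ.m≤n⇒∃[o]m+o≡n r<s = begin
    ∑[ p < K ] (θ (toℕ p) P * δ (suc (r + toℕ p)) (suc (r + x)))
      ≡⟨ sum-cong-≗ (λ (p : Fin K) → trans (cong (θ (toℕ p) P *_) (trans (δ-+ r (toℕ p) x) (δ-sym (toℕ p) x)))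
           (ℕₚ.*-comm (θ (toℕ p) P) (δ x (toℕ p)))) ⟩
    ∑[ p < K ] (δ x (toℕ p) * θ (toℕ p) P)
      ≡⟨ evaluate ⟩
    θ x P
      ≡⟨ trans (cong₂ _*_ (θ-< r<s) (θ-+ r)) (ℕₚ.*-identityˡ (θ x P)) ⟨
    θ r (suc (r + x)) * θ (suc (r + x)) (suc (r + P)) ∎
    where
    open ≡-Reasoning
    θ-+ : ∀ r → θ (r + x) (r + P) ≡ θ x P
    θ-+ zero = refl
    θ-+ (suc r) = θ-+ r
    evaluate : ∑[ p < K ] (δ x (toℕ p) * θ (toℕ p) P) ≡ θ x P
    evaluate with x ℕₚ.<? K
    ... | yes x<K = sum-δ x<K (λ p → θ p P)
    ... | no x≮K = trans
      (sum-zero {K} _ (λ p → cong (_* θ (toℕ p) P) (δ-≢ (λ x≡p → x≮K (subst (_< K) (sym x≡p) (Fₚ.toℕ<n p))))))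
      (sym (θ-≥ (ℕₚ.≤-trans P≤K (ℕₚ.≮⇒≥ x≮K))))

  -- Lozenges

  -- Step r p r' p' relates the up triangle (r , p) and the down triangle (r' , p')
  -- when the second lowers one of the three indices of the first.
  data Step : ℕ → ℕ → ℕ → ℕ → Set where
    v : ∀ {r p} → Step (suc r) p r p
    e : ∀ {r p} → Step r (suc p) r p
    f : ∀ {r p} → Step r p r p

  module _ {r p r' p' : ℕ} where

    V E F NV : Step r p r' p' → ℕ
    V v = 1
    V e = 0
    V f = 0
    E v = 0
    E e = 1
    E f = 0
    F v = 0
    F e = 0
    F f = 1
    NV v = 0
    NV e = 1
    NV f = 1

  V-* : ∀ {r p r' p'} (s : Step r p r' p') {m n} → (r ≡ suc r' → p ≡ p' → m ≡ n) → V s * m ≡ V s * n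
  V-* v eq = cong (1 *_) (eq refl refl)
  V-* e eq = refl
  V-* f eq = refl

  -- Two disjoint lozenges are ordered differently by their up and by their down triangles
  -- only if exactly one of them is vertical; inv s s' counts this case with s vertical.
  inv : ∀ {r p x y r' p' x' y'} → Step r p x y → Step r' p' x' y' → ℕ
  inv {r} {p} {r' = r'} {p'} {x'} {y'} s s' =
    V s * (NV s' * (δ (suc x') r * θ p y' + δ r' r * θ p' p))

  lex : ℕ → ℕ → ℕ → ℕ → ℕ
  lex r p r' p' = θ r r' + δ r r' * θ p p'

  lex-antisym : ∀ {r p r' p'} → ¬ (r ≡ r' × p ≡ p') → lex r p r' p' + lex r' p' r p ≡ 1
  lex-antisym {r} {p} {r'} {p'} ne = trans
    (cong (λ z → lex r p r' p' + (θ r' r + z * θ p' p)) (δ-sym r' r))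
    (arith (θ r r') (θ r' r) (δ r r') (θ p p') (θ p' p) (δ p p') (trichotomy r r') (trichotomy p p') (δδ-≢ ne))
    where
    rearrange : ∀ A B D t t' q → A + D * t + (B + D * t') + D * q ≡ A + B + D * (t + t' + q)
    rearrange = solveℕ-∀
    arith : ∀ A B D t t' q → A + B + D ≡ 1 → t + t' + q ≡ 1 → D * q ≡ 0 →
      A + D * t + (B + D * t') ≡ 1
    arith A B D t t' q eq eq' eq'' = trans
      (sym (trans (cong ((A + D * t + (B + D * t')) +_) eq'') (ℕₚ.+-identityʳ _)))
      (trans (rearrange A B D t t' q)
        (trans (cong (λ z → A + B + D * z) eq') (trans (cong ((A + B) +_) (ℕₚ.*-identityʳ D)) eq)))

  sgn-flip : ∀ m n → m + n ≡ 1 → sgn (suc m) ≡ ℤ.- sgn (suc n)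
  sgn-flip zero (suc zero) refl = refl
  sgn-flip (suc zero) zero refl = refl

  sgn-flip₂ : ∀ {m n m' n'} → m + m' ≡ 1 → n + n' ≡ 1 →
    sgn (suc m) ℤ.* sgn (suc n) ≡ sgn (suc m') ℤ.* sgn (suc n')
  sgn-flip₂ {m} {n} {m'} {n'} eq eq' rewrite sgn-flip m m' eq | sgn-flip n n' eq' =
    neg*neg (sgn (suc m')) (sgn (suc n'))

  sgn-even : ∀ m n l k → m + n + l ≡ k + k → sgn (suc m) ℤ.* sgn (suc n) ≡ sgn l
  sgn-even m n l k eq = begin
    ℤ.- sgn m ℤ.* ℤ.- sgn n                             ≡⟨ neg*neg (sgn m) (sgn n) ⟩
    sgn m ℤ.* sgn n                                     ≡⟨ ℤₚ.*-identityʳ _ ⟨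
    sgn m ℤ.* sgn n ℤ.* 1ℤ                              ≡⟨ cong ((sgn m ℤ.* sgn n) ℤ.*_) (sgn-square l) ⟨
    sgn m ℤ.* sgn n ℤ.* (sgn l ℤ.* sgn l)               ≡⟨ ℤₚ.*-assoc (sgn m ℤ.* sgn n) (sgn l) (sgn l) ⟨
    sgn m ℤ.* sgn n ℤ.* sgn l ℤ.* sgn l
      ≡⟨ cong (ℤ._* sgn l) (trans (cong (ℤ._* sgn l) (sym (sgn-+ m n))) (sym (sgn-+ (m + n) l))) ⟩
    sgn (m + n + l) ℤ.* sgn l                           ≡⟨ cong (λ z → sgn z ℤ.* sgn l) eq ⟩
    sgn (k + k) ℤ.* sgn l
      ≡⟨ cong (ℤ._* sgn l) (trans (sgn-+ k k) (sgn-square k)) ⟩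
    1ℤ ℤ.* sgn l                                        ≡⟨ ℤₚ.*-identityˡ (sgn l) ⟩
    sgn l                                               ∎
    where open ≡-Reasoning

  -- `A`, `D` and `D₀` say that the other edge lies above level `suc x`, on it, or on level `x`. The
  -- three summands are the order of the up triangles, the order of the down triangles and the
  -- inversions. `D * Q ≡ 0` excludes a tie, so `D * (T + T')` is `D` and the total is even. The
  -- factors 1 and the 0 are those left by unfolding `inv`.
  even-arith : ∀ A D D₀ t T T' Q → T + T' + Q ≡ 1 → D * Q ≡ 0 →
    A + D * T + (A + D + D₀ * t) + (1 * (1 * (D₀ * t + D * T')) + 0) ≡ A + D₀ * t + D + (A + D₀ * t + D)
  even-arith A D D₀ t T T' Q eq DQ =
    trans (rearrange A D D₀ t T T') (trans (cong ((A + A + D + (D₀ * t + D₀ * t)) +_) D≡) (finish A D (D₀ * t)))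
    where
    rearrange : ∀ A D D₀ t T T' → A + D * T + (A + D + D₀ * t) + (1 * (1 * (D₀ * t + D * T')) + 0)
      ≡ A + A + D + (D₀ * t + D₀ * t) + D * (T + T')
    rearrange = solveℕ-∀
    finish : ∀ A D E → A + A + D + (E + E) + D ≡ A + E + D + (A + E + D)
    finish = solveℕ-∀
    D≡ : D * (T + T') ≡ D
    D≡ = trans (sym (trans (cong ((D * (T + T')) +_) DQ) (ℕₚ.+-identityʳ _)))
      (trans (sym (ℕₚ.*-distribˡ-+ D (T + T') Q)) (trans (cong (D *_) eq) (ℕₚ.*-identityʳ D)))

  vertical-first : ∀ x x' t T T' Q → T + T' + Q ≡ 1 → δ (suc x) x' * Q ≡ 0 →
    sgn (suc (θ (suc x) x' + δ (suc x) x' * T)) ℤ.* sgn (suc (θ x x' + δ x x' * t))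
    ≡ sgn (1 * (1 * (δ (suc x') (suc x) * t + δ x' (suc x) * T')) + 0)
  vertical-first x x' t T T' Q eq eq' = sgn-even
    (θ (suc x) x' + δ (suc x) x' * T) (θ x x' + δ x x' * t)
    (1 * (1 * (δ (suc x') (suc x) * t + δ x' (suc x) * T')) + 0)
    (θ (suc x) x' + δ x x' * t + δ (suc x) x') (trans
    (cong₂ (λ B E → θ (suc x) x' + δ (suc x) x' * T + (B + δ x x' * t) + (1 * (1 * E) + 0))
      (θ-sucˡ x x') (cong₂ (λ D₀ D → D₀ * t + D * T') (δ-sym x' x) (δ-sym x' (suc x))))
    (even-arith (θ (suc x) x') (δ (suc x) x') (δ x x') t T T' Q eq eq'))

  module _ {r p x y r' p' x' y' : ℕ} (s : Step r p x y) (s' : Step r' p' x' y')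
    (u≢ : ¬ (r ≡ r' × p ≡ p')) (d≢ : ¬ (x ≡ x' × y ≡ y')) where

    pair-sign-swap :
      sgn (suc (lex r' p' r p)) ℤ.* sgn (suc (lex x' y' x y)) ≡ sgn (inv s' s + inv s s') →
      sgn (suc (lex r p r' p')) ℤ.* sgn (suc (lex x y x' y')) ≡ sgn (inv s s' + inv s' s)
    pair-sign-swap eq = trans (sgn-flip₂ {lex r p r' p'} {lex x y x' y'} (lex-antisym u≢) (lex-antisym d≢))
      (trans eq (cong sgn (ℕₚ.+-comm (inv s' s) (inv s s'))))

  -- Edges of equal type translate their triangles alike, so both orders agree by computation. For
  -- an `e` and an `f` on one level the positions move past each other by a single step, and a
  -- change of order would need a tie, which `u≢` excludes. What remains is a parity computation
  -- with one vertical edge.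
  pair-sign : ∀ {r p x y r' p' x' y'} (s : Step r p x y) (s' : Step r' p' x' y') →
    ¬ (r ≡ r' × p ≡ p') → ¬ (x ≡ x' × y ≡ y') →
    sgn (suc (lex r p r' p')) ℤ.* sgn (suc (lex x y x' y')) ≡ sgn (inv s s' + inv s' s)
  pair-sign {x = x} {y} {x' = x'} {y'} v v u≢ d≢ = sgn-square (suc (lex x y x' y'))
  pair-sign {x = x} {y} {x' = x'} {y'} e e u≢ d≢ = sgn-square (suc (lex x y x' y'))
  pair-sign {x = x} {y} {x' = x'} {y'} f f u≢ d≢ = sgn-square (suc (lex x y x' y'))
  pair-sign {x = x} {y} {x' = x'} {y'} e f u≢ d≢ =
    trans (cong (λ z → sgn (suc (lex x (suc y) x' y')) ℤ.* sgn (suc z)) (sym same))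
      (sgn-square (suc (lex x (suc y) x' y')))
    where
    same : lex x (suc y) x' y' ≡ lex x y x' y'
    same = cong (θ x x' +_) (trans (trans (sym (ℕₚ.+-identityʳ _))
      (cong ((δ x x' * θ (suc y) y') +_) (sym (δδ-≢ u≢))))
      (trans (sym (ℕₚ.*-distribˡ-+ (δ x x') (θ (suc y) y') (δ (suc y) y')))
        (cong (δ x x' *_) (sym (θ-sucˡ y y')))))
  pair-sign s@f s'@e u≢ d≢ = pair-sign-swap s s' u≢ d≢
    (pair-sign s' s (λ (a , b) → u≢ (sym a , sym b)) (λ (a , b) → d≢ (sym a , sym b)))
  pair-sign {y = y} {x' = x'} {y'} (v {x}) f u≢ d≢ =
    vertical-first x x' (θ y y') (θ y y') (θ y' y) (δ y y') (trichotomy y y') (δδ-≢ u≢)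
  pair-sign {y = y} {x' = x'} {y'} (v {x}) e u≢ d≢ =
    vertical-first x x' (θ y y') (θ y (suc y')) (θ (suc y') y) (δ y (suc y')) (trichotomy y (suc y')) (δδ-≢ u≢)
  pair-sign s@f s'@v u≢ d≢ = pair-sign-swap s s' u≢ d≢
    (pair-sign s' s (λ (a , b) → u≢ (sym a , sym b)) (λ (a , b) → d≢ (sym a , sym b)))
  pair-sign s@e s'@v u≢ d≢ = pair-sign-swap s s' u≢ d≢
    (pair-sign s' s (λ (a , b) → u≢ (sym a , sym b)) (λ (a , b) → d≢ (sym a , sym b)))

  perms-injective : ∀ {n sp} → sp ∈ perms n → ∀ {i j} → proj₂ sp i ≡ proj₂ sp j → i ≡ j
  perms-injective {suc n} sp∈ {i} {j} with k , sp' , sp'∈ , refl ← perms-suc sp∈ = go i j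
    where
    go : ∀ i j → consPerm k (proj₂ sp') i ≡ consPerm k (proj₂ sp') j → i ≡ j
    go Fin.zero Fin.zero eq = refl
    go Fin.zero (Fin.suc j) eq = ⊥-elim (Fₚ.punchInᵢ≢i k _ (sym eq))
    go (Fin.suc i) Fin.zero eq = ⊥-elim (Fₚ.punchInᵢ≢i k _ eq)
    go (Fin.suc i) (Fin.suc j) eq = cong Fin.suc (perms-injective sp'∈ (Fₚ.punchIn-injective k _ _ eq))

  -- Row counts in the hexagon and signs of matchings

  cumulative : (ℕ → ℕ) → ℕ → ℕ
  cumulative φ zero = 0
  cumulative φ (suc r) = cumulative φ r + φ (suc r)

  module Hexagon (a b c : ℕ) (1≤b : 1 ≤ b) where

    -- The triangle with indices (j₁ , j₂ , j₃) has coordinates (r , p) = (j₁ , j₂); j₃ is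
    -- determined by the weight.
    record Up∈ (r p : ℕ) : Set where
      constructor up∈
      field
        r< : r < a + b
        p< : p < a + c
        lower : a ≤ r + p
        upper : suc (r + p) ≤ a + b + c

    record Down∈ (r p : ℕ) : Set where
      constructor down∈
      field
        r< : r < a + b
        p< : p < a + c
        lower : a ≤ suc (r + p)
        upper : suc (suc (r + p)) ≤ a + b + c

    module Enumerated {N : ℕ} {ux uy dx dy : Fin N → ℕ}
      (U : Enumeration Up∈ ux uy) (D : Enumeration Down∈ dx dy) where

      private
        module U = Enumeration U
        module D = Enumeration D

      -- Inside the rectangle both colours fill a band of antidiagonals. The band of the down
      -- triangles is shifted by one: it gains `suc (r + p) ≡ a` and loses
      -- `suc (r + p) ≡ a + b + c`.
      counts : ∀ r p → r < a + b → p < a + c →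
        count dx dy r p + δ (suc (r + p)) (a + b + c) ≡ count ux uy r p + δ (suc (r + p)) a
      counts r p r< p< with ℕₚ.<-cmp (suc (r + p)) a | ℕₚ.<-cmp (suc (r + p)) (a + b + c)
      ... | tri< l _ _ | _ = cong₂ _+_
        (trans (count-out dx dy D (λ i → ℕₚ.<⇒≱ l (Down∈.lower i)))
          (sym (count-out ux uy U (λ i → ℕₚ.<⇒≱ l (ℕₚ.≤-trans (Up∈.lower i) (ℕₚ.n≤1+n _))))))
        (trans (δ-≢ (λ eq → lia 3 (λ s a bc → s :< a :→ s :≡ a :+ bc :→ :goal :⊥) (suc (r + p)) a (b + c) l
          (trans eq (ℕₚ.+-assoc a b c))))
          (sym (δ-≢ (ℕₚ.<⇒≢ l))))
      ... | tri≈ _ eq _ | tri< l _ _ = trans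
        (cong₂ _+_ (count-in dx dy D (down∈ r< p< (ℕₚ.≤-reflexive (sym eq)) l)) (δ-≢ (ℕₚ.<⇒≢ l)))
        (sym (cong₂ _+_ (count-out ux uy U (λ i → ℕₚ.<⇒≱ (ℕₚ.≤-reflexive eq) (Up∈.lower i)))
          (trans (cong (δ (suc (r + p))) (sym eq)) (δ-refl (suc (r + p))))))
      ... | tri≈ _ eq _ | tri≈ _ eq' _ = ⊥-elim
        (lia 4 (λ s a b c → s :≡ a :→ s :≡ a :+ b :+ c :→ :con 1 :≤ b :→ :goal :⊥) (suc (r + p)) a b c eq eq'
          1≤b)
      ... | tri≈ _ eq _ | tri> _ _ l = ⊥-elim
        (lia 4 (λ s a b c → s :≡ a :→ a :+ b :+ c :< s :→ :goal :⊥) (suc (r + p)) a b c eq l)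
      ... | tri> _ _ g | tri< l _ _ = cong₂ _+_
        (trans (count-in dx dy D (down∈ r< p< (ℕₚ.<⇒≤ g) l))
          (sym (count-in ux uy U (up∈ r< p< (ℕ.s≤s⁻¹ g) (ℕₚ.<⇒≤ l)))))
        (trans (δ-≢ (ℕₚ.<⇒≢ l)) (sym (δ-≢ (ℕₚ.>⇒≢ g))))
      ... | tri> _ _ g | tri≈ _ eq _ = trans
        (cong₂ _+_ (count-out dx dy D (λ i → ℕₚ.<⇒≱ (Down∈.upper i) (ℕₚ.≤-reflexive (sym eq))))
          (trans (cong (δ (suc (r + p))) (sym eq)) (δ-refl (suc (r + p)))))
        (sym (cong₂ _+_ (count-in ux uy U (up∈ r< p< (ℕ.s≤s⁻¹ g) (ℕₚ.≤-reflexive eq))) (δ-≢ (ℕₚ.>⇒≢ g))))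
      ... | tri> _ _ g | tri> _ _ g' = cong₂ _+_
        (trans (count-out dx dy D (λ i → ℕₚ.<⇒≱ (Down∈.upper i) (ℕₚ.<⇒≤ g')))
          (sym (count-out ux uy U (λ i → ℕₚ.<⇒≱ g' (Up∈.upper i)))))
        (trans (δ-≢ (ℕₚ.>⇒≢ g')) (sym (δ-≢ (ℕₚ.>⇒≢ g))))

      -- The correction terms are the two antidiagonals of `counts`, each evaluated by `θ-sum`; the
      -- bounds on `r` and on `r + P` make one of the two factors equal to one in each case.
      rows-compare : ∀ r P → r < a + b → P ≤ a + c → a ≤ r + P →
        ∑[ i < N ] (δ (dx i) r * θ (dy i) P) + θ (a + b + c) (suc (r + P)) ≡
        ∑[ i < N ] (δ (ux i) r * θ (uy i) P) + θ r a
      rows-compare r P r< P≤ a≤ = begin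
        ∑[ i < N ] (δ (dx i) r * θ (dy i) P) + θ (a + b + c) (suc (r + P))
          ≡⟨ cong₂ _+_ (row-sum dx dy (Down∈.p< ∘ D.inside) r (λ p → θ p P))
               (sym (trans (θ-sum P≤ r (a + b + c)) (trans (cong (_* θ (a + b + c) (suc (r + P)))
                 (θ-< (ℕₚ.≤-trans r< (ℕₚ.m≤m+n (a + b) c)))) (ℕₚ.*-identityˡ _)))) ⟩
        ∑[ p < a + c ] (θ (toℕ p) P * count dx dy r (toℕ p)) +
        ∑[ p < a + c ] (θ (toℕ p) P * δ (suc (r + toℕ p)) (a + b + c))
          ≡⟨ combine dx dy (a + b + c) ⟩
        ∑[ p < a + c ] (θ (toℕ p) P * (count dx dy r (toℕ p) + δ (suc (r + toℕ p)) (a + b + c)))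
          ≡⟨ sum-cong-≗ (λ (p : Fin (a + c)) → cong (θ (toℕ p) P *_) (counts r (toℕ p) r< (Fₚ.toℕ<n p))) ⟩
        ∑[ p < a + c ] (θ (toℕ p) P * (count ux uy r (toℕ p) + δ (suc (r + toℕ p)) a))
          ≡⟨ combine ux uy a ⟨
        ∑[ p < a + c ] (θ (toℕ p) P * count ux uy r (toℕ p)) +
        ∑[ p < a + c ] (θ (toℕ p) P * δ (suc (r + toℕ p)) a)
          ≡⟨ cong₂ _+_ (row-sum ux uy (Up∈.p< ∘ U.inside) r (λ p → θ p P))
               (sym (trans (θ-sum P≤ r a) (trans (cong (θ r a *_) (θ-< (s≤s a≤))) (ℕₚ.*-identityʳ _)))) ⟨
        ∑[ i < N ] (δ (ux i) r * θ (uy i) P) + θ r a ∎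
        where
        open ≡-Reasoning
        combine : ∀ (x y : Fin N → ℕ) s →
          ∑[ p < a + c ] (θ (toℕ p) P * count x y r (toℕ p)) +
          ∑[ p < a + c ] (θ (toℕ p) P * δ (suc (r + toℕ p)) s) ≡
          ∑[ p < a + c ] (θ (toℕ p) P * (count x y r (toℕ p) + δ (suc (r + toℕ p)) s))
        combine x y s = trans
          (sym (∑-distrib-+ {a + c} (λ p → θ (toℕ p) P * count x y r (toℕ p)) _))
          (sum-cong-≗ (λ (p : Fin (a + c)) → sym (ℕₚ.*-distribˡ-+ (θ (toℕ p) P) _ _)))

      -- The vertical edges match the down triangles of level r with the up triangles of level r + 1.
      shifted-row : ∀ r (ψ : ℕ → ℕ) → suc r < a + b →
        ∑[ i < N ] (δ (dx i) r * ψ (dy i)) ≡ ∑[ i < N ] (δ (ux i) (suc r) * ψ (uy i))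
      shifted-row r ψ r< = begin
        ∑[ i < N ] (δ (dx i) r * ψ (dy i))
          ≡⟨ row-sum dx dy (Down∈.p< ∘ D.inside) r ψ ⟩
        ∑[ p < a + c ] (ψ (toℕ p) * count dx dy r (toℕ p))
          ≡⟨ sum-cong-≗ (λ (p : Fin (a + c)) → cong (ψ (toℕ p) *_) (same (toℕ p) (Fₚ.toℕ<n p))) ⟩
        ∑[ p < a + c ] (ψ (toℕ p) * count ux uy (suc r) (toℕ p))
          ≡⟨ row-sum ux uy (Up∈.p< ∘ U.inside) (suc r) ψ ⟨
        ∑[ i < N ] (δ (ux i) (suc r) * ψ (uy i)) ∎
        where
        open ≡-Reasoning
        same : ∀ p → p < a + c → count dx dy r p ≡ count ux uy (suc r) p
        same p p< with a ℕₚ.≤? suc (r + p) | suc (suc (r + p)) ℕₚ.≤? a + b + c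
        ... | yes l | yes u = trans (count-in dx dy D (down∈ (ℕₚ.<⇒≤ r<) p< l u))
          (sym (count-in ux uy U (up∈ r< p< l u)))
        ... | no ¬l | _ = trans (count-out dx dy D (¬l ∘ Down∈.lower))
          (sym (count-out ux uy U (¬l ∘ Up∈.lower)))
        ... | _ | no ¬u = trans (count-out dx dy D (¬u ∘ Down∈.upper))
          (sym (count-out ux uy U (¬u ∘ Up∈.upper)))

      module Matching {sp} (sp∈ : sp ∈ perms N)
        (s : ∀ i → Step (ux (proj₂ sp i)) (uy (proj₂ sp i)) (dx i) (dy i)) where

        mx my : Fin N → ℕ
        mx i = ux (proj₂ sp i)
        my i = uy (proj₂ sp i)

        flow : (ℕ → ℕ) → ℕ
        flow φ = ∑[ i < N ] (V (s i) * φ (mx i))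

        -- `cumulative φ` is a potential: it differs by `φ (suc x)` across a vertical edge from
        -- level `x` to `suc x` and agrees at both ends of any other edge. A matching uses every
        -- triangle once, so its flow depends only on the two colour classes.
        flow-telescopes : ∀ φ →
          ∑[ i < N ] cumulative φ (dx i) + flow φ ≡ ∑[ i < N ] cumulative φ (ux i)
        flow-telescopes φ = trans (sym (∑-distrib-+ (λ i → cumulative φ (dx i)) _))
          (trans (sum-cong-≗ (λ i → step (s i))) (sum-reindex sp∈ (λ i → cumulative φ (ux i))))
          where
          step : ∀ {r p x y} (s : Step r p x y) → cumulative φ x + V s * φ r ≡ cumulative φ r
          step (v {x}) = cong (cumulative φ x +_) (ℕₚ.*-identityˡ _)
          step e = ℕₚ.+-identityʳ _
          step f = ℕₚ.+-identityʳ _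

        inner : Fin N → Fin N → ℕ
        inner i j = NV (s j) * (δ (suc (dx j)) (mx i) * θ (my i) (dy j) + δ (mx j) (mx i) * θ (my j) (my i))

        inversions : ℕ
        inversions = ∑[ i < N ] ∑[ j < N ] inv (s i) (s j)

        vertical level : ℕ → ℕ
        vertical r = flow (λ x → δ x r)
        level r = ∑[ j < N ] δ (ux j) r

        -- The down triangles to the right of the vertical edge i and the up triangles to its left
        -- make up one level without i; the nonvertical ones among them are inverted with i.
        inversions-row : ∀ i r → mx i ≡ suc r → dx i ≡ r → my i ≡ dy i →
          ∑[ j < N ] inner i j + vertical (mx i) ≡ level (mx i)
        inversions-row i r eq eqd eqp rewrite eq | eqp = begin
          ∑[ j < N ] inner' j + vertical (suc r)
            ≡⟨ ∑-distrib-+ inner' (λ j → V (s j) * δ (mx j) (suc r)) ⟨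
          ∑[ j < N ] (inner' j + V (s j) * δ (mx j) (suc r))
            ≡⟨ sum-cong-≗ (λ j → split (s j)) ⟩
          ∑[ j < N ] (A j + B j + C j)
            ≡⟨ trans (∑-distrib-+ (λ j → A j + B j) C) (cong (_+ sum C) (∑-distrib-+ A B)) ⟩
          sum A + sum B + sum C
            ≡⟨ cong₂ _+_ (cong₂ _+_ (shifted-row r (θ P) r<)
                 (sum-reindex sp∈ (λ j → δ (ux j) (suc r) * θ (uy j) P)))
                   (trans C≡1 (sym (count-in ux uy U (subst (λ z → Up∈ z P) eq
                   (subst (Up∈ (mx i)) eqp (U.inside (proj₂ sp i))))))) ⟩
          sum (λ j → δ (ux j) (suc r) * θ P (uy j)) + sum (λ j → δ (ux j) (suc r) * θ (uy j) P) + count ux uy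
            (suc r) P
            ≡⟨ trans (∑-distrib-+ (λ j → δ (ux j) (suc r) * θ P (uy j) + δ (ux j) (suc r) * θ (uy j) P)
              (λ j → δ (ux j) (suc r) * δ (uy j) P))
                 (cong (_+ count ux uy (suc r) P)
                   (∑-distrib-+ (λ j → δ (ux j) (suc r) * θ P (uy j)) (λ j → δ (ux j) (suc r) * θ (uy j) P))) ⟨
          ∑[ j < N ] (δ (ux j) (suc r) * θ P (uy j) + δ (ux j) (suc r) * θ (uy j) P + δ (ux j) (suc r) * δ
            (uy j) P)
            ≡⟨ sum-cong-≗ (λ j → one (δ (ux j) (suc r)) (uy j)) ⟩
          level (suc r) ∎
          where
          open ≡-Reasoning
          P = dy i
          inner' A B C : Fin N → ℕ
          inner' j = NV (s j) * (δ (suc (dx j)) (suc r) * θ P (dy j) + δ (mx j) (suc r) * θ (my j) P)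
          A j = δ (dx j) r * θ P (dy j)
          B j = δ (mx j) (suc r) * θ (my j) P
          C j = V (s j) * (δ (dx j) r * δ (dy j) P)
          r< : suc r < a + b
          r< = subst (_< a + b) eq (Up∈.r< (U.inside (proj₂ sp i)))
          C≡1 : sum C ≡ 1
          C≡1 = trans (sum-single C i (λ j j≢i → trans (cong (V (s j) *_) (δδ-≢ (λ (x≡ , y≡) →
              j≢i (D.injective (trans x≡ (sym eqd)) y≡)))) (ℕₚ.*-zeroʳ (V (s j)))))
            (trans (cong₂ (λ x y → V (s i) * (x * y)) (trans (cong (λ z → δ z r) eqd) (δ-refl r)) (δ-refl P))
              (vert (s i) (trans eq (cong suc (sym eqd)))))
            where
            vert : ∀ {r p x y} (s : Step r p x y) → r ≡ suc x → V s * (1 * 1) ≡ 1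
            vert v eq = refl
            vert e eq = ⊥-elim (ℕₚ.1+n≢n (sym eq))
            vert f eq = ⊥-elim (ℕₚ.1+n≢n (sym eq))
          one : ∀ d q → d * θ P q + d * θ q P + d * δ q P ≡ d
          one d q = trans (sym (trans (ℕₚ.*-distribˡ-+ d (θ P q + θ q P) (δ q P))
            (cong (_+ d * δ q P) (ℕₚ.*-distribˡ-+ d (θ P q) (θ q P)))))
            (trans (cong (d *_) (trans (cong ((θ P q + θ q P) +_) (δ-sym q P)) (trichotomy P q)))
              (ℕₚ.*-identityʳ d))
          -- A vertical edge of this level occurs once on the right: through its down triangle if it
          -- lies to the right of `P`, through its up triangle if to the left, and in the last term
          -- if at `P`.
          split : ∀ {x y x' y'} (s : Step x y x' y') →
            NV s * (δ x' r * θ P y' + δ x (suc r) * θ y P) + V s * δ x (suc r) ≡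
            δ x' r * θ P y' + δ x (suc r) * θ y P + V s * (δ x' r * δ y' P)
          split {y = y} (v {x}) = trans (ℕₚ.*-identityˡ (δ x r))
            (sym (trans (cong ((δ x r * θ P y + δ x r * θ y P) +_) (ℕₚ.*-identityˡ _)) (one (δ x r) y)))
          split e = cong (_+ 0) (ℕₚ.*-identityˡ _)
          split f = cong (_+ 0) (ℕₚ.*-identityˡ _)

        -- Summing `inversions-row` over the vertical edges leaves only flows beside the inversions,
        -- and flows are known to be independent of the matching.
        inversions-total : inversions + flow vertical ≡ flow level
        inversions-total = begin
          ∑[ i < N ] ∑[ j < N ] inv (s i) (s j) + flow vertical
            ≡⟨ cong (_+ flow vertical) (sum-cong-≗ (λ i → *-distribˡ-sum (V (s i)) (inner i))) ⟨
          ∑[ i < N ] (V (s i) * ∑[ j < N ] inner i j) + flow vertical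
            ≡⟨ ∑-distrib-+ (λ i → V (s i) * ∑[ j < N ] inner i j) (λ i → V (s i) * vertical (mx i)) ⟨
          ∑[ i < N ] (V (s i) * ∑[ j < N ] inner i j + V (s i) * vertical (mx i))
            ≡⟨ sum-cong-≗ (λ i → trans (sym (ℕₚ.*-distribˡ-+ (V (s i)) _ _))
                 (V-* (s i) (λ r≡ p≡ → inversions-row i (dx i) r≡ refl p≡))) ⟩
          flow level ∎
          where open ≡-Reasoning

        -- The sign refers to the given numberings, the inversions to the lexicographic order.
        -- Inserting the squares of the lexicographic signs separates the two: `order` times `lexU`
        -- is symmetric, so its product over pairs is unchanged by the permutation, and the factor
        -- left over depends on the numberings alone.
        sign-inversions : proj₁ sp ≡
          sgn inversions ℤ.* (Π.pairs N (λ i j → order i j ℤ.* sgn (suc (lex (ux i) (uy i) (ux j) (uy j))))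
            ℤ.* Π.pairs N (λ i j → sgn (suc (lex (dx i) (dy i) (dx j) (dy j)))))
        sign-inversions = begin
          proj₁ sp
            ≡⟨ unit-square (proj₁ sp) (Π.pairs N (λ i j → lexU (proj₂ sp i) (proj₂ sp j))) (Π.pairs N lexD)
              (square lexU∘ lexU-square) (square lexD lexD-square) ⟩
          (Π.pairs N lexU∘ ℤ.* Π.pairs N lexD) ℤ.* ((proj₁ sp ℤ.* Π.pairs N lexU∘) ℤ.* Π.pairs N lexD)
            ≡⟨ cong₂ (λ x y → x ℤ.* (y ℤ.* Π.pairs N lexD)) to-inversions reindexed ⟩
          sgn inversions ℤ.* (Π.pairs N (λ i j → order i j ℤ.* lexU i j) ℤ.* Π.pairs N lexD) ∎
          where
          open ≡-Reasoning
          lexU lexU∘ lexD : Fin N → Fin N → ℤ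
          lexU i j = sgn (suc (lex (ux i) (uy i) (ux j) (uy j)))
          lexU∘ i j = lexU (proj₂ sp i) (proj₂ sp j)
          lexD i j = sgn (suc (lex (dx i) (dy i) (dx j) (dy j)))
          lexU-square : ∀ i j → lexU∘ i j ℤ.* lexU∘ i j ≡ 1ℤ
          lexU-square i j = sgn-square (suc (lex (mx i) (my i) (mx j) (my j)))
          lexD-square : ∀ i j → lexD i j ℤ.* lexD i j ≡ 1ℤ
          lexD-square i j = sgn-square (suc (lex (dx i) (dy i) (dx j) (dy j)))
          unit-square : ∀ x y z → y ℤ.* y ≡ 1ℤ → z ℤ.* z ≡ 1ℤ → x ≡ (y ℤ.* z) ℤ.* ((x ℤ.* y) ℤ.* z)
          unit-square x y z yy zz = sym (trans (rearrange x y z)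
            (trans (cong₂ (λ u v → x ℤ.* u ℤ.* v) yy zz) (trans (ℤₚ.*-identityʳ _) (ℤₚ.*-identityʳ x))))
            where
            rearrange : ∀ x y z → (y ℤ.* z) ℤ.* ((x ℤ.* y) ℤ.* z) ≡ x ℤ.* (y ℤ.* y) ℤ.* (z ℤ.* z)
            rearrange = solve-∀
          square : ∀ w → (∀ i j → w i j ℤ.* w i j ≡ 1ℤ) → Π.pairs N w ℤ.* Π.pairs N w ≡ 1ℤ
          square w w² = trans (sym (Π.pairs-distrib N w w))
            (trans (Π.pairs-cong N (λ i j _ → w² i j)) (Π.pairs-ε N))
          to-inversions : Π.pairs N lexU∘ ℤ.* Π.pairs N lexD ≡ sgn inversions
          to-inversions = trans (sym (Π.pairs-distrib N lexU∘ lexD)) (trans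
            (Π.pairs-cong N (λ i j i≢j → pair-sign (s i) (s j)
              (λ (x≡ , y≡) → i≢j (perms-injective sp∈ (U.injective x≡ y≡)))
              (λ (x≡ , y≡) → i≢j (D.injective x≡ y≡))))
            (pairs-sgn N (λ i j → inv (s i) (s j)) (λ i → irreflexive (s i))))
            where
            irreflexive : ∀ {r p x y} (s : Step r p x y) → inv s s ≡ 0
            irreflexive v = refl
            irreflexive e = refl
            irreflexive f = refl
          reindexed : proj₁ sp ℤ.* Π.pairs N lexU∘ ≡ Π.pairs N (λ i j → order i j ℤ.* lexU i j)
          reindexed = trans (cong (ℤ._* Π.pairs N lexU∘) (perm-sign sp∈))
            (trans (sym (Π.pairs-distrib N (λ i j → order (proj₂ sp i) (proj₂ sp j)) lexU∘))
              (Π.pairs-reindex sp∈ (λ i j → order i j ℤ.* lexU i j) symmetric))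
            where
            symmetric : ∀ i j → order i j ℤ.* lexU i j ≡ order j i ℤ.* lexU j i
            symmetric i j with i Fₚ.≟ j
            ... | yes refl = refl
            ... | no i≢j = sgn-flip₂ {θ (toℕ i) (toℕ j)} {lex (ux i) (uy i) (ux j) (uy j)}
              (trans (sym (trans (cong ((θ (toℕ i) (toℕ j) + θ (toℕ j) (toℕ i)) +_)
                (δ-≢ (i≢j ∘ Fₚ.toℕ-injective))) (ℕₚ.+-identityʳ _))) (trichotomy (toℕ i) (toℕ j)))
              (lex-antisym {ux i} {uy i} (λ (x≡ , y≡) → i≢j (U.injective x≡ y≡)))

      module _ {sp} (sp∈ : sp ∈ perms N) (s : ∀ i → Step (ux (proj₂ sp i)) (uy (proj₂ sp i)) (dx i) (dy i))
               {tp} (tp∈ : tp ∈ perms N) (t : ∀ i → Step (ux (proj₂ tp i)) (uy (proj₂ tp i)) (dx i) (dy i))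
                 where
        private
          module S = Matching sp∈ s
          module T = Matching tp∈ t

        flow-constant : ∀ φ → S.flow φ ≡ T.flow φ
        flow-constant φ = ℕₚ.+-cancelˡ-≡ (∑[ i < N ] cumulative φ (dx i)) _ _
          (trans (S.flow-telescopes φ) (sym (T.flow-telescopes φ)))

        inversions-constant : S.inversions ≡ T.inversions
        -- The function `vertical` itself depends on the matching. It is exchanged in two stages:
        -- first the edges that are summed over, then its values, each of which is again a flow.
        inversions-constant = ℕₚ.+-cancelʳ-≡ (S.flow S.vertical) _ _ (begin
          S.inversions + S.flow S.vertical ≡⟨ S.inversions-total ⟩
          S.flow S.level                   ≡⟨ flow-constant S.level ⟩
          T.flow T.level                   ≡⟨ T.inversions-total ⟨
          T.inversions + T.flow T.vertical ≡⟨ cong (T.inversions +_) (flow-constant T.vertical) ⟨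
          T.inversions + S.flow T.vertical ≡⟨ cong (T.inversions +_) (sum-cong-≗ (λ i →
                                                cong (V (s i) *_) (flow-constant (λ x → δ x (S.mx i))))) ⟨
          T.inversions + S.flow S.vertical ∎)
          where open ≡-Reasoning

        sign-constant : proj₁ sp ≡ proj₁ tp
        sign-constant = trans S.sign-inversions
          (trans (cong (λ n → sgn n ℤ.* _) inversions-constant) (sym T.sign-inversions))

  -- Counting with 0/1 sequences and their thresholds

  θ≤1 : ∀ x y → θ x y ≤ 1
  θ≤1 x y = subst (θ x y ≤_) (trichotomy x y) (ℕₚ.≤-trans (ℕₚ.m≤m+n (θ x y) (θ y x)) (ℕₚ.m≤m+n _ (δ x y)))

  θ-mono : ∀ {x y x' y'} → (x < y → x' < y') → θ x y ≤ θ x' y'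
  θ-mono {x} {y} imp with x ℕₚ.<? y
  ... | yes x<y = subst (θ x y ≤_) (sym (θ-< (imp x<y))) (θ≤1 x y)
  ... | no x≮y = subst (_≤ _) (sym (θ-≥ (ℕₚ.≮⇒≥ x≮y))) z≤n

  θ-cong : ∀ {x y x' y'} → (x < y → x' < y') → (x' < y' → x < y) → θ x y ≡ θ x' y'
  θ-cong to from = ℕₚ.≤-antisym (θ-mono to) (θ-mono from)

  tally : (ℕ → ℕ) → ℕ → ℕ
  tally φ zero = 0
  tally φ (suc n) = φ 0 + tally (λ k → φ (suc k)) n

  tally-mono : ∀ {φ ψ} n → (∀ k → k < n → φ k ≤ ψ k) → tally φ n ≤ tally ψ n
  tally-mono zero le = z≤n
  tally-mono (suc n) le = ℕₚ.+-mono-≤ (le 0 (s≤s z≤n)) (tally-mono n (λ k k<n → le (suc k) (s≤s k<n)))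

  tally-cong : ∀ {φ ψ} n → (∀ k → k < n → φ k ≡ ψ k) → tally φ n ≡ tally ψ n
  tally-cong n eq = ℕₚ.≤-antisym (tally-mono n (λ k k<n → ℕₚ.≤-reflexive (eq k k<n)))
    (tally-mono n (λ k k<n → ℕₚ.≤-reflexive (sym (eq k k<n))))

  tally-≤ : ∀ {φ} n → (∀ k → φ k ≤ 1) → tally φ n ≤ n
  tally-≤ zero φ≤1 = z≤n
  tally-≤ (suc n) φ≤1 = ℕₚ.+-mono-≤ (φ≤1 0) (tally-≤ n (λ k → φ≤1 (suc k)))

  tally-init : ∀ φ n → tally φ n ≤ tally φ (suc n)
  tally-init φ zero = z≤n
  tally-init φ (suc n) = ℕₚ.+-monoʳ-≤ (φ 0) (tally-init (λ k → φ (suc k)) n)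

  -- The first term of `φ` costs at most one and the others are dominated by `ψ` one place earlier.
  -- This is the source of all bounds by one on the steps of a surface.
  tally-shift : ∀ {φ ψ} n → φ 0 ≤ 1 → (∀ k → φ (suc k) ≤ ψ k) → tally φ n ≤ suc (tally ψ n)
  tally-shift zero φ≤1 le = z≤n
  tally-shift {ψ = ψ} (suc n) φ≤1 le =
    ℕₚ.+-mono-≤ φ≤1 (ℕₚ.≤-trans (tally-mono n (λ k _ → le k)) (tally-init ψ n))

  module _ {φ : ℕ → ℕ} (φ≤1 : ∀ k → φ k ≤ 1) (antitone : ∀ k → φ (suc k) ≤ φ k) where

    -- An antitone 0/1 sequence is a block of ones followed by zeros, so its sum is the place where
    -- it drops.
    tally-threshold : ∀ {n k} → k < n → φ k ≡ θ k (tally φ n)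
    tally-threshold = go φ≤1 antitone
      where
      go : ∀ {φ n k} → (∀ k → φ k ≤ 1) → (∀ k → φ (suc k) ≤ φ k) → k < n → φ k ≡ θ k (tally φ n)
      go {φ} {suc n} {k} φ≤1 antitone k<n with φ 0 in eq | φ≤1 0
      ... | suc zero | _ = rest k k<n
        where
        rest : ∀ k → k < suc n → φ k ≡ θ k (suc (tally (λ k → φ (suc k)) n))
        rest zero _ = eq
        rest (suc k) (s≤s k<n) = go (λ k → φ≤1 (suc k)) (λ k → antitone (suc k)) k<n
      ... | suc (suc _) | s≤s ()
      ... | zero | _ = trans (vanish k) (sym (θ-≥ {k} (subst (_≤ k)
          (sym (ℕₚ.n≤0⇒n≡0 (ℕₚ.≤-trans (tally-mono n (λ j _ → ℕₚ.≤-reflexive (vanish (suc j))))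
            (ℕₚ.≤-reflexive (tally-0 n))))) z≤n)))
        where
        vanish : ∀ k → φ k ≡ 0
        vanish zero = eq
        vanish (suc k) = ℕₚ.n≤0⇒n≡0 (subst (φ (suc k) ≤_) (vanish k) (antitone k))
        tally-0 : ∀ n → tally (λ _ → 0) n ≡ 0
        tally-0 zero = refl
        tally-0 (suc n) = tally-0 n

  tally-θ : ∀ {m n} → m ≤ n → tally (λ k → θ k m) n ≡ m
  tally-θ {n = zero} z≤n = refl
  tally-θ {n = suc n} z≤n = tally-θ {n = n} z≤n
  tally-θ (s≤s m≤n) = cong suc (tally-θ m≤n)

  ∸-suc-θ : ∀ m n → m ∸ n ≡ (m ∸ suc n) + θ n m
  ∸-suc-θ zero zero = refl
  ∸-suc-θ zero (suc n) = refl
  ∸-suc-θ (suc m) zero = sym (ℕₚ.+-comm m 1)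
  ∸-suc-θ (suc m) (suc n) = ∸-suc-θ m n

  suc-∸-θ : ∀ m n → suc m ∸ n ≡ (m ∸ n) + θ n (suc m)
  suc-∸-θ m zero = sym (ℕₚ.+-comm m 1)
  suc-∸-θ zero (suc n) rewrite ℕₚ.0∸n≡0 n = refl
  suc-∸-θ (suc m) (suc n) = suc-∸-θ m n

  -- Height functions of matchings

  module Heights (a b c : ℕ) (1≤b : 1 ≤ b) {N : ℕ} {ux uy dx dy : Fin N → ℕ}
    (U : Enumeration (Hexagon.Up∈ a b c 1≤b) ux uy) (D : Enumeration (Hexagon.Down∈ a b c 1≤b) dx dy)
    {sp} (sp∈ : sp ∈ perms N) (s : ∀ i → Step (ux (proj₂ sp i)) (uy (proj₂ sp i)) (dx i) (dy i)) where

    open Hexagon a b c 1≤b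
    open Enumerated U D
    open Matching sp∈ s using (mx; my)
    private
      module U = Enumeration U
      module D = Enumeration D

    edges : (∀ {r p x y} → Step r p x y → ℕ) → ℕ → ℕ → ℕ
    edges W r p = ∑[ i < N ] (W (s i) * (δ (mx i) r * δ (my i) p))

    prefix : ℕ → ℕ → ℕ
    prefix r p = ∑[ i < N ] (V (s i) * (δ (mx i) r * θ (my i) p))

    -- The height function of the tiling; a ∸ r is its value at the left end of level r.
    height : ℕ → ℕ → ℕ
    height r p = prefix r p + (a ∸ r)

    edges-total : ∀ r p → edges V r p + edges E r p + edges F r p ≡ count ux uy r p
    edges-total r p = begin
      edges V r p + edges E r p + edges F r p
        ≡⟨ trans (∑-distrib-+ (λ i → V (s i) * X i + E (s i) * X i) (λ i → F (s i) * X i))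
             (cong (_+ edges F r p) (∑-distrib-+ (λ i → V (s i) * X i) (λ i → E (s i) * X i))) ⟨
      ∑[ i < N ] (V (s i) * X i + E (s i) * X i + F (s i) * X i)
        ≡⟨ sum-cong-≗ (λ i → one (s i) (X i)) ⟩
      sum X
        ≡⟨ sum-reindex sp∈ (λ j → δ (ux j) r * δ (uy j) p) ⟩
      count ux uy r p ∎
      where
      open ≡-Reasoning
      X : Fin N → ℕ
      X i = δ (mx i) r * δ (my i) p
      one : ∀ {r p x y} (s : Step r p x y) n → V s * n + E s * n + F s * n ≡ n
      one v n = trans (ℕₚ.+-identityʳ _) (trans (ℕₚ.+-identityʳ _) (ℕₚ.*-identityˡ n))
      one e n = trans (ℕₚ.+-identityʳ _) (ℕₚ.*-identityˡ n)
      one f n = ℕₚ.*-identityˡ n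

    count≤1 : ∀ r p → count ux uy r p ≤ 1
    count≤1 r p with r ℕₚ.<? a + b | p ℕₚ.<? a + c | a ℕₚ.≤? r + p | suc (r + p) ℕₚ.≤? a + b + c
    ... | yes r< | yes p< | yes l | yes u = ℕₚ.≤-reflexive (count-in ux uy U (up∈ r< p< l u))
    ... | no ¬r | _ | _ | _ = subst (_≤ 1) (sym (count-out ux uy U (¬r ∘ Up∈.r<))) z≤n
    ... | _ | no ¬p | _ | _ = subst (_≤ 1) (sym (count-out ux uy U (¬p ∘ Up∈.p<))) z≤n
    ... | _ | _ | no ¬l | _ = subst (_≤ 1) (sym (count-out ux uy U (¬l ∘ Up∈.lower))) z≤n
    ... | _ | _ | _ | no ¬u = subst (_≤ 1) (sym (count-out ux uy U (¬u ∘ Up∈.upper))) z≤n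

    edges≤1 : ∀ r p → edges V r p + edges E r p + edges F r p ≤ 1
    edges≤1 r p = subst (_≤ 1) (sym (edges-total r p)) (count≤1 r p)

    edges-out : ∀ {r p} → ¬ Up∈ r p → edges V r p + edges E r p + edges F r p ≡ 0
    edges-out {r} {p} out = trans (edges-total r p) (count-out ux uy U out)

    V-out : ∀ {r p} → ¬ Up∈ r p → edges V r p ≡ 0
    V-out {r} {p} out = ℕₚ.m+n≡0⇒m≡0 _ (ℕₚ.m+n≡0⇒m≡0 _ (edges-out out))

    E-out : ∀ {r p} → ¬ Up∈ r p → edges E r p ≡ 0
    E-out {r} {p} out = ℕₚ.m+n≡0⇒n≡0 (edges V r p) (ℕₚ.m+n≡0⇒m≡0 _ (edges-out out))

    edge-present : ∀ (W : ∀ {r p x y} → Step r p x y → ℕ) i → W (s i) ≡ 1 → 1 ≤ edges W (mx i) (my i)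
    edge-present W i W≡1 = subst (_≤ edges W (mx i) (my i))
      (trans (cong₂ _*_ W≡1 (cong₂ _*_ (δ-refl (mx i)) (δ-refl (my i)))) refl)
      (term≤sum (λ j → W (s j) * (δ (mx j) (mx i) * δ (my j) (my i))) i)
      where
      term≤sum : ∀ {n} (φ : Fin n → ℕ) i → φ i ≤ sum φ
      term≤sum φ Fin.zero = ℕₚ.m≤m+n _ _
      term≤sum φ (Fin.suc i) = ℕₚ.≤-trans (term≤sum (λ j → φ (Fin.suc j)) i) (ℕₚ.m≤n+m _ _)

    prefix-suc : ∀ r p → prefix r (suc p) ≡ prefix r p + edges V r p
    prefix-suc r p = trans (sum-cong-≗ (λ i → trans
        (cong (λ z → V (s i) * (δ (mx i) r * z)) (θ-sucʳ (my i) p))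
        (rearrange (V (s i)) (δ (mx i) r) (θ (my i) p) (δ (my i) p))))
      (∑-distrib-+ (λ i → V (s i) * (δ (mx i) r * θ (my i) p)) _)
      where
      rearrange : ∀ V d t q → V * (d * (t + q)) ≡ V * (d * t) + V * (d * q)
      rearrange = solveℕ-∀

    height-suc : ∀ r p → height r (suc p) ≡ height r p + edges V r p
    height-suc r p = trans (cong (_+ (a ∸ r)) (prefix-suc r p)) (swap (prefix r p) (edges V r p) (a ∸ r))
      where
      swap : ∀ x y z → x + y + z ≡ x + z + y
      swap = solveℕ-∀

    -- This is a balance for the triangles of row `r` at positions below `P`: `f` edges pair them
    -- off, vertical edges join them to the neighbouring rows, and an `e` edge may straddle the cut
    -- at `P`. The difference between the two colours is supplied by `rows-compare`.
    prefix-row : ∀ r P → r < a + b → P ≤ a + c → a ≤ r + P →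
      prefix r P + θ r a ≡ prefix (suc r) P + edges E r P + θ (a + b + c) (suc (r + P))
    prefix-row r P r< P≤ a≤ = lia 7
      (λ Dr Ur g g' t χ ω → Dr :+ χ :≡ Ur :+ ω :→ Dr :+ g :≡ Ur :+ (g' :+ t) :→ :goal (g :+ ω :≡ g' :+ t :+ χ))
      (sum Dterm) (∑[ i < N ] (δ (ux i) r * θ (uy i) P)) (prefix r P) (prefix (suc r) P) (edges E r P)
      (θ (a + b + c) (suc (r + P))) (θ r a) (rows-compare r P r< P≤ a≤) balance
      where
      Dterm Uterm Gterm G'term Eterm : Fin N → ℕ
      Dterm i = δ (dx i) r * θ (dy i) P
      Uterm i = δ (mx i) r * θ (my i) P
      Gterm i = V (s i) * (δ (mx i) r * θ (my i) P)
      G'term i = V (s i) * (δ (mx i) (suc r) * θ (my i) P)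
      Eterm i = E (s i) * (δ (mx i) r * δ (my i) P)
      pointwise : ∀ {x y x' y'} (s : Step x y x' y') →
        δ x' r * θ y' P + V s * (δ x r * θ y P) ≡
        δ x r * θ y P + (V s * (δ x (suc r) * θ y P) + E s * (δ x r * δ y P))
      pointwise {y = y} (v {x}) = rearrange (δ x r * θ y P) (δ (suc x) r * θ y P)
        where
        rearrange : ∀ m n → m + 1 * n ≡ n + (1 * m + 0)
        rearrange = solveℕ-∀
      pointwise {x} {y' = y'} e = trans (ℕₚ.+-identityʳ _) (trans (cong (δ x r *_) (θ-sucˡ y' P))
        (trans (ℕₚ.*-distribˡ-+ (δ x r) _ _) (cong (δ x r * θ (suc y') P +_) (sym (ℕₚ.*-identityˡ _)))))
      pointwise f = refl
      balance : sum Dterm + prefix r P ≡ ∑[ i < N ] (δ (ux i) r * θ (uy i) P) + (prefix (suc r) P + edges E r P)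
      balance = begin
        sum Dterm + sum Gterm                ≡⟨ ∑-distrib-+ Dterm Gterm ⟨
        ∑[ i < N ] (Dterm i + Gterm i)       ≡⟨ sum-cong-≗ (λ i → pointwise (s i)) ⟩
        ∑[ i < N ] (Uterm i + (G'term i + Eterm i))
          ≡⟨ trans (∑-distrib-+ Uterm (λ i → G'term i + Eterm i))
            (cong (sum Uterm +_) (∑-distrib-+ G'term Eterm)) ⟩
        sum Uterm + (sum G'term + sum Eterm)
          ≡⟨ cong (_+ (sum G'term + sum Eterm)) (sum-reindex sp∈ (λ i → δ (ux i) r * θ (uy i) P)) ⟩
        ∑[ i < N ] (δ (ux i) r * θ (uy i) P) + (prefix (suc r) P + edges E r P) ∎
        where open ≡-Reasoning

    -- The summand `a ∸ r` of the height absorbs the term `θ r a` of `prefix-row`. The last term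
    -- appears only once `r + P` reaches the boundary `a + b + c`.
    height-row : ∀ r P → r < a + b → P ≤ a + c → a ≤ r + P →
      height r P ≡ height (suc r) P + edges E r P + θ (a + b + c) (suc (r + P))
    height-row r P r< P≤ a≤ = lia 7
      (λ g g' t χ ω A A' → g :+ ω :≡ g' :+ t :+ χ :→ A :≡ A' :+ ω :→ :goal (g :+ A :≡ g' :+ A' :+ t :+ χ))
      (prefix r P) (prefix (suc r) P) (edges E r P) (θ (a + b + c) (suc (r + P))) (θ r a) (a ∸ r) (a ∸ suc r)
      (prefix-row r P r< P≤ a≤) (∸-suc-θ a r)

    height-row-inside : ∀ r P → r < a + b → P ≤ a + c → a ≤ r + P → r + P < a + b + c →
      height r P ≡ height (suc r) P + edges E r P
    height-row-inside r P r< P≤ a≤ <S = trans (height-row r P r< P≤ a≤)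
      (trans (cong (height (suc r) P + edges E r P +_) (θ-≥ <S)) (ℕₚ.+-identityʳ _))

    -- Heights live on the lattice points of the closed hexagon. The down triangle `(x , y)` has the
    -- corners `(suc x , y)`, `(suc x , suc y)` and `(x , suc y)`.
    record Vertex (r p : ℕ) : Set where
      constructor vertex
      field
        r≤ : r ≤ a + b
        p≤ : p ≤ a + c
        lower : a ≤ r + p
        upper : r + p ≤ a + b + c

    height-mono : ∀ r p → height r p ≤ height r (suc p)
    height-mono r p = subst (height r p ≤_) (sym (height-suc r p)) (ℕₚ.m≤m+n _ _)

    height-mono-+ : ∀ r p k → height r p ≤ height r (p + k)
    height-mono-+ r p zero = ℕₚ.≤-reflexive (cong (height r) (sym (ℕₚ.+-identityʳ p)))
    height-mono-+ r p (suc k) = ℕₚ.≤-trans (height-mono-+ r p k)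
      (subst (λ q → height r (p + k) ≤ height r q) (sym (ℕₚ.+-suc p k)) (height-mono r (p + k)))

    V≤1 : ∀ r p → edges V r p ≤ 1
    V≤1 r p = ℕₚ.≤-trans (ℕₚ.≤-trans (ℕₚ.m≤m+n _ (edges E r p)) (ℕₚ.m≤m+n _ (edges F r p))) (edges≤1 r p)

    height-step : ∀ r p → height r (suc p) ≤ suc (height r p)
    height-step r p = lia 3 (λ h' h V → h' :≡ h :+ V :→ V :≤ :con 1 :→ :goal (h' :≤ :suc h))
      _ _ _ (height-suc r p) (V≤1 r p)

    height-step-+ : ∀ r p k → height r (p + k) ≤ height r p + k
    height-step-+ r p zero = ℕₚ.≤-reflexive
      (trans (cong (height r) (ℕₚ.+-identityʳ p)) (sym (ℕₚ.+-identityʳ _)))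
    height-step-+ r p (suc k) = subst₂ _≤_ (cong (height r) (sym (ℕₚ.+-suc p k))) (sym (ℕₚ.+-suc _ k))
      (ℕₚ.≤-trans (height-step r (p + k)) (s≤s (height-step-+ r p k)))

    height-stationary : ∀ r p k → (∀ q → p ≤ q → ¬ Up∈ r q) → height r (p + k) ≡ height r p
    height-stationary r p zero out = cong (height r) (ℕₚ.+-identityʳ p)
    height-stationary r p (suc k) out = trans (cong (height r) (ℕₚ.+-suc p k)) (trans (height-suc r (p + k))
      (trans (cong₂ _+_ (height-stationary r p k out) (V-out (out (p + k) (ℕₚ.m≤m+n p k)))) (ℕₚ.+-identityʳ _)))

    prefix-left : ∀ r p → r + p ≤ a → prefix r p ≡ 0
    prefix-left r zero le = sum-zero _
      (λ i → trans (cong (V (s i) *_) (ℕₚ.*-zeroʳ (δ (mx i) r))) (ℕₚ.*-zeroʳ (V (s i))))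
    prefix-left r (suc p) le = trans (prefix-suc r p) (cong₂ _+_
      (prefix-left r p (ℕₚ.≤-trans (ℕₚ.+-monoʳ-≤ r (ℕₚ.n≤1+n p)) le))
      (V-out (λ u → ℕₚ.<⇒≱ (subst (_≤ a) (ℕₚ.+-suc r p) le) (Up∈.lower u))))

    height-≤-position : ∀ r p → a ≤ r + p → height r p ≤ p
    height-≤-position r zero a≤ = ℕₚ.≤-reflexive (cong₂ _+_
      (sum-zero _ (λ i → trans (cong (V (s i) *_) (ℕₚ.*-zeroʳ (δ (mx i) r))) (ℕₚ.*-zeroʳ (V (s i)))))
      (ℕₚ.m≤n⇒m∸n≡0 (subst (a ≤_) (ℕₚ.+-identityʳ r) a≤)))
    height-≤-position r (suc p) a≤ with a ℕₚ.≤? r + p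
    ... | yes a≤' = ℕₚ.≤-trans (height-step r p) (s≤s (height-≤-position r p a≤'))
    ... | no a≰ = subst (_≤ suc p) (sym (cong (_+ (a ∸ r)) (prefix-left r (suc p)
            (subst (_≤ a) (sym (ℕₚ.+-suc r p)) (ℕₚ.≰⇒> a≰)))))
          (ℕₚ.≤-trans (ℕₚ.∸-monoˡ-≤ r a≤) (ℕₚ.≤-reflexive (ℕₚ.m+n∸m≡n r (suc p))))

    height-zero : ∀ p → height 0 p ≡ a
    height-zero p = cong (_+ a) (sum-zero _ (λ i → no-vertical (s i)))
      where
      no-vertical : ∀ {r q x y} (s : Step r q x y) → V s * (δ r 0 * θ q p) ≡ 0
      no-vertical v = refl
      no-vertical e = refl
      no-vertical f = refl

    -- At position `a + c` no `e` edge is left, so the height is constant up to level `b` and then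
    -- loses one per level through the boundary term of `height-row`.
    height-end : ∀ r → r ≤ a + b → height r (a + c) + (r ∸ b) ≡ a
    height-end zero _ = trans (cong (height 0 (a + c) +_) (ℕₚ.0∸n≡0 b))
      (trans (ℕₚ.+-identityʳ _) (height-zero (a + c)))
    height-end (suc r) r< = lia 7
      (λ h h' t χ R R' a → h :≡ h' :+ t :+ χ :→ t :≡ :con 0 :→ R' :≡ R :+ χ :→ h :+ R :≡ a :→ :goal
        (h' :+ R' :≡ a))
      (height r (a + c)) (height (suc r) (a + c)) (edges E r (a + c)) (θ b (suc r)) (r ∸ b) (suc r ∸ b) a
      (trans (height-row r (a + c) r< ℕₚ.≤-refl (ℕₚ.≤-trans (ℕₚ.m≤m+n a c) (ℕₚ.m≤n+m _ r)))
        (cong (height (suc r) (a + c) + edges E r (a + c) +_) (θ-cong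
          (lia 4 (λ a b c r → a :+ b :+ c :< :suc (r :+ (a :+ c)) :→ :goal (b :< :suc r)) a b c r)
          (lia 4 (λ a b c r → b :< :suc r :→ :goal (a :+ b :+ c :< :suc (r :+ (a :+ c)))) a b c r))))
      (E-out (λ u → ℕₚ.<-irrefl refl (Up∈.p< u)))
      (suc-∸-θ r b)
      (height-end r (ℕₚ.<⇒≤ r<))

    module _ {r p} (vx : Vertex r p) where
      open Vertex vx

      height-lower : a ≤ height r p + r
      height-lower = ℕₚ.≤-trans (ℕₚ.m≤n+m∸n a r) (ℕₚ.≤-trans (ℕₚ.≤-reflexive (ℕₚ.+-comm r (a ∸ r)))
        (ℕₚ.+-monoˡ-≤ r (ℕₚ.m≤n+m (a ∸ r) (prefix r p))))

      height≤end : height r p ≤ height r (a + c)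
      height≤end with k , eq ← ℕₚ.m≤n⇒∃[o]m+o≡n p≤ =
        subst (λ q → height r p ≤ height r q) eq (height-mono-+ r p k)

      height-≤a : height r p ≤ a
      height-≤a = ℕₚ.≤-trans height≤end (ℕₚ.≤-trans (ℕₚ.m≤m+n _ (r ∸ b)) (ℕₚ.≤-reflexive (height-end r r≤)))

      height-upper : height r p + r ≤ a + b
      height-upper = lia 6 (λ h h' r b a d → h :≤ h' :→ h' :+ d :≡ a :→ r :≤ b :+ d :→ :goal (h :+ r :≤ a :+ b))
        (height r p) (height r (a + c)) r b a (r ∸ b) height≤end (height-end r r≤) (ℕₚ.m≤n+m∸n r b)

      -- At the right end of the level the bound is an equality, and going back from there the
      -- height falls by at most one per step. The right end is `a + c` up to level `b` and
      -- `a + b + c - r` above it, where no up triangle follows and the height is already that of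
      -- `height-end`.
      position-≤-height : p ≤ height r p + c
      position-≤-height with r ℕₚ.≤? b
      ... | yes r≤b with k , eq ← ℕₚ.m≤n⇒∃[o]m+o≡n p≤ =
        lia 7 (λ a c p k h h' z → p :+ k :≡ a :+ c :→ h' :≤ h :+ k :→ h' :+ z :≡ a :→ z :≡ :con 0 :→ :goal
          (p :≤ h :+ c))
          a c p k (height r p) (height r (a + c)) (r ∸ b) eq
          (subst (λ q → height r q ≤ height r p + k) eq (height-step-+ r p k)) (height-end r r≤)
            (ℕₚ.m≤n⇒m∸n≡0 r≤b)
      ... | no r≰b
        with k , eq ← ℕₚ.m≤n⇒∃[o]m+o≡n upper
        with l , eq' ← ℕₚ.m≤n⇒∃[o]m+o≡n
          (lia 6 (λ a b c r p k → r :+ p :+ k :≡ a :+ b :+ c :→ b :< r :→ :goal (p :+ k :≤ a :+ c)) a b c r p k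
          eq (ℕₚ.≰⇒> r≰b)) =
        lia 9 (λ a b c p k r h h' z → r :+ p :+ k :≡ a :+ b :+ c :→ h' :≤ h :+ k :→ h' :+ z :≡ a :→ b :+ z :≡ r
          :→ :goal (p :≤ h :+ c))
          a b c p k r (height r p) (height r (p + k)) (r ∸ b) eq (height-step-+ r p k)
          (trans (cong (_+ (r ∸ b)) (sym (trans (cong (height r) (sym eq')) (height-stationary r (p + k) l
            (λ q pk≤q u → lia 4 (λ S r pk q → r :+ pk :≡ S :→ :suc (r :+ q) :≤ S :→ pk :≤ q :→ :goal :⊥)
              (a + b + c) r (p + k) q
              (trans (sym (ℕₚ.+-assoc r p k)) eq) (Up∈.upper u) pk≤q))))) (height-end r r≤))
          (ℕₚ.m+[n∸m]≡n (ℕₚ.<⇒≤ (ℕₚ.≰⇒> r≰b)))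

  -- Surfaces of plane partitions

  entry : ∀ {a b} → Vec (Vec ℕ b) a → ℕ → ℕ → ℕ
  entry {a} {b} M i j with i ℕₚ.<? a | j ℕₚ.<? b
  ... | yes i<a | yes j<b = lookup (lookup M (fromℕ< i<a)) (fromℕ< j<b)
  ... | yes _ | no _ = 0
  ... | no _ | _ = 0

  module _ {a b} (M : Vec (Vec ℕ b) a) where

    entry-in : ∀ {i j} (i<a : i < a) (j<b : j < b) → entry M i j ≡ lookup (lookup M (fromℕ< i<a)) (fromℕ< j<b)
    entry-in {i} {j} i<a j<b with i ℕₚ.<? a | j ℕₚ.<? b
    ... | yes _ | yes _ = refl
    ... | yes _ | no ¬j = ⊥-elim (¬j j<b)
    ... | no ¬i | _ = ⊥-elim (¬i i<a)

    entry-lookup : ∀ i j → entry M (toℕ i) (toℕ j) ≡ lookup (lookup M i) j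
    entry-lookup i j = trans (entry-in (Fₚ.toℕ<n i) (Fₚ.toℕ<n j))
      (cong₂ (λ i j → lookup (lookup M i) j) (Fₚ.fromℕ<-toℕ i _) (Fₚ.fromℕ<-toℕ j _))

    entry-outʳ : ∀ {i j} → ¬ j < b → entry M i j ≡ 0
    entry-outʳ {i} {j} ¬j with i ℕₚ.<? a | j ℕₚ.<? b
    ... | yes _ | yes j<b = ⊥-elim (¬j j<b)
    ... | yes _ | no _ = refl
    ... | no _ | _ = refl

  matrix : ∀ a b → (ℕ → ℕ → ℕ) → Vec (Vec ℕ b) a
  matrix a b φ = tabulate λ i → tabulate λ j → φ (toℕ i) (toℕ j)

  lookup-matrix : ∀ {a b} φ (i : Fin a) (j : Fin b) → lookup (lookup (matrix a b φ) i) j ≡ φ (toℕ i) (toℕ j)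
  lookup-matrix φ i j = trans (cong (λ w → lookup w j) (Vecₚ.lookup∘tabulate _ i)) (Vecₚ.lookup∘tabulate _ j)

  entry-matrix : ∀ {a b} φ {i j} → i < a → j < b → entry (matrix a b φ) i j ≡ φ i j
  entry-matrix {a} {b} φ i<a j<b = trans (entry-in (matrix a b φ) i<a j<b)
    (trans (lookup-matrix φ (fromℕ< i<a) (fromℕ< j<b)) (cong₂ φ (Fₚ.toℕ-fromℕ< i<a) (Fₚ.toℕ-fromℕ< j<b)))

  matrix-ext : ∀ {a b} (M M' : Vec (Vec ℕ b) a) → (∀ i j → lookup (lookup M i) j ≡ lookup (lookup M' i) j) → M
    ≡ M'
  matrix-ext M M' eq = vec-ext (λ i → vec-ext (eq i))
    where
    vec-ext : ∀ {A : Set} {n} {xs ys : Vec A n} → (∀ i → lookup xs i ≡ lookup ys i) → xs ≡ ys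
    vec-ext {xs = xs} {ys} eq = trans (sym (Vecₚ.tabulate∘lookup xs))
      (trans (Vecₚ.tabulate-cong eq) (Vecₚ.tabulate∘lookup ys))

  -- The height of cell (t , s - a), continued by a full box for s < a.
  extended : ∀ {a b} → ℕ → Vec (Vec ℕ b) a → ℕ → ℕ → ℕ
  extended {a} c M t s with s ℕₚ.<? a
  ... | yes _ = a + c
  ... | no _ = entry M t (s ∸ a)

  module _ {a b} (c : ℕ) (M : Vec (Vec ℕ b) a) where

    -- The value `a + c` exceeds `t + c` for every `t < a`, so `surface` counts all points in the
    -- continuation, whatever the position `p`.
    extended-in : ∀ {t s} → s < a → extended c M t s ≡ a + c
    extended-in {s = s} s<a with s ℕₚ.<? a
    ... | yes _ = refl
    ... | no ¬s = ⊥-elim (¬s s<a)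

    extended-out : ∀ {t s} → a ≤ s → extended c M t s ≡ entry M t (s ∸ a)
    extended-out {s = s} a≤s with s ℕₚ.<? a
    ... | yes s<a = ⊥-elim (ℕₚ.<⇒≱ s<a a≤s)
    ... | no _ = refl

  -- The surface of M as a height function: (r , p) is the line of points
  -- (t , r - a + t , t + c - p), and its height counts those in the partition.
  surface : ∀ {a b} → ℕ → Vec (Vec ℕ b) a → ℕ → ℕ → ℕ
  surface {a} c M r p = tally (λ t → θ (t + c) (extended c M t (r + t) + p)) a

  -- The condition concerns the two ends of the side shared by the triangles: a jump by one for `v`
  -- and `e`, equality for `f`. For a surface, the corners of a triangle in suitable order have
  -- values `w ≤ z ≤ q ≤ suc w`; the three gaps add up to one, so exactly one side qualifies.
  Fits : (ℕ → ℕ → ℕ) → ∀ {r p x y} → Step r p x y → Set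
  Fits S (v {x} {y}) = S (suc x) (suc y) ≡ suc (S (suc x) y)
  Fits S (e {x} {y}) = S x (suc y) ≡ suc (S (suc x) (suc y))
  Fits S (f {x} {y}) = S x (suc y) ≡ S (suc x) y

  Step-irrelevant : ∀ {r p x y} (s s' : Step r p x y) → s ≡ s'
  Step-irrelevant v v = refl
  Step-irrelevant e e = refl
  Step-irrelevant f f = refl

  two-values : ∀ {m n} → m ≤ n → n ≤ suc m → n ≡ m ⊎ n ≡ suc m
  two-values {m} {n} m≤n n≤ with n ℕₚ.≤? m
  ... | yes n≤m = inj₁ (ℕₚ.≤-antisym n≤m m≤n)
  ... | no n≰m = inj₂ (ℕₚ.≤-antisym n≤ (ℕₚ.≰⇒> n≰m))

  module Surface (a b c : ℕ) (1≤b : 1 ≤ b) (M : Vec (Vec ℕ b) a) (pp : IsPP a b c M) where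
    open Hexagon a b c 1≤b

    S : ℕ → ℕ → ℕ
    S = surface c M

    private
      X : ℕ → ℕ → ℕ
      X = extended c M

    entry-≤c : ∀ i j → entry M i j ≤ c
    entry-≤c i j with i ℕₚ.<? a | j ℕₚ.<? b
    ... | yes i<a | yes j<b = proj₁ pp _ _
    ... | yes _ | no _ = z≤n
    ... | no _ | _ = z≤n

    entry-antitone : ∀ {i i' j j'} → i ≤ i' → j ≤ j' → entry M i' j' ≤ entry M i j
    entry-antitone {i} {i'} {j} {j'} i≤ j≤ with i' ℕₚ.<? a | j' ℕₚ.<? b
    ... | yes i'<a | yes j'<b = ℕₚ.≤-trans
      (proj₁ (proj₂ pp) (fromℕ< i'<a) (fromℕ< j<b) (fromℕ< j'<b) (to-fin j<b j'<b j≤))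
      (ℕₚ.≤-trans (proj₂ (proj₂ pp) (fromℕ< i<a) (fromℕ< i'<a) (fromℕ< j<b) (to-fin i<a i'<a i≤))
        (ℕₚ.≤-reflexive (sym (entry-in M i<a j<b))))
      where
      i<a = ℕₚ.≤-<-trans i≤ i'<a
      j<b = ℕₚ.≤-<-trans j≤ j'<b
      to-fin : ∀ {n k k'} (k<n : k < n) (k'<n : k' < n) → k ≤ k' → toℕ (fromℕ< k<n) ≤ toℕ (fromℕ< k'<n)
      to-fin k<n k'<n = subst₂ _≤_ (sym (Fₚ.toℕ-fromℕ< k<n)) (sym (Fₚ.toℕ-fromℕ< k'<n))
    ... | yes _ | no _ = z≤n
    ... | no _ | _ = z≤n

    extended-≤c : ∀ {t s} → a ≤ s → X t s ≤ c
    extended-≤c {t} {s} a≤s = subst (_≤ c) (sym (extended-out c M a≤s)) (entry-≤c t (s ∸ a))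

    extended-antitone : ∀ {t t' s s'} → t ≤ t' → s ≤ s' → X t' s' ≤ X t s
    extended-antitone {t} {t'} {s} {s'} t≤ s≤ with s ℕₚ.<? a
    ... | no s≮a = subst (_≤ entry M t (s ∸ a)) (sym (extended-out c M (ℕₚ.≤-trans (ℕₚ.≮⇒≥ s≮a) s≤)))
      (entry-antitone t≤ (ℕₚ.∸-monoˡ-≤ a s≤))
    ... | yes s<a with s' ℕₚ.<? a
    ...   | yes _ = ℕₚ.≤-refl
    ...   | no _ = ℕₚ.≤-trans (entry-≤c t' (s' ∸ a)) (ℕₚ.m≤n+m c a)

    surface-suc : ∀ r p → S r p ≤ S r (suc p)
    surface-suc r p = tally-mono a (λ t _ → θ-mono
      (lia 4 (λ t c x p → t :+ c :< x :+ p :→ :goal (t :+ c :< x :+ :suc p)) t c (X t (r + t)) p))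

    surface-row : ∀ r p → S (suc r) p ≤ S r p
    surface-row r p = tally-mono a (λ t _ → θ-mono
      (lia 5 (λ t c x' x p → x' :≤ x :→ t :+ c :< x' :+ p :→ :goal (t :+ c :< x :+ p)) t c _ (X t (r + t)) p
        (extended-antitone ℕₚ.≤-refl (ℕₚ.n≤1+n (r + t)))))

    -- If the point `suc t` is counted on the new line, then the point `t` is counted on the old
    -- one, because `extended` is antitone; only one point can be gained.
    surface-suc-≤ : ∀ r p → S r (suc p) ≤ suc (S r p)
    surface-suc-≤ r p = tally-shift a (θ≤1 c (X 0 (r + 0) + suc p)) (λ t → θ-mono
      (lia 5 (λ t c x' x p → x' :≤ x :→ :suc t :+ c :< x' :+ :suc p :→ :goal (t :+ c :< x :+ p)) t c
        (X (suc t) (r + suc t)) (X t (r + t)) p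
        (extended-antitone (ℕₚ.n≤1+n t) (ℕₚ.+-monoʳ-≤ r (ℕₚ.n≤1+n t)))))

    surface-row-≤ : ∀ r p → S r p ≤ suc (S (suc r) p)
    surface-row-≤ r p = tally-shift a (θ≤1 c (X 0 (r + 0) + p)) (λ t → θ-mono
      (lia 5 (λ t c x' x p → x' :≤ x :→ :suc t :+ c :< x' :+ p :→ :goal (t :+ c :< x :+ p)) t c
        (X (suc t) (r + suc t)) (X t (suc r + t)) p
        (extended-antitone (ℕₚ.n≤1+n t) (ℕₚ.≤-reflexive (sym (ℕₚ.+-suc r t))))))

    -- This inequality closes the cycle around a triangle: together with monotonicity in both
    -- arguments it makes the three gaps add up to one.
    surface-diagonal-≤ : ∀ r p → S r (suc p) ≤ suc (S (suc r) p)
    surface-diagonal-≤ r p = tally-shift a (θ≤1 c (X 0 (r + 0) + suc p)) (λ t → θ-mono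
      (lia 5 (λ t c x' x p → x' :≤ x :→ :suc t :+ c :< x' :+ :suc p :→ :goal (t :+ c :< x :+ p)) t c
        (X (suc t) (r + suc t)) (X t (suc r + t)) p
        (extended-antitone (ℕₚ.n≤1+n t) (ℕₚ.≤-reflexive (sym (ℕₚ.+-suc r t))))))

    surface-threshold : ∀ {i} r p → i < a → θ (i + c) (X i (r + i) + p) ≡ θ i (S r p)
    surface-threshold r p i<a = tally-threshold (λ t → θ≤1 (t + c) (X t (r + t) + p))
      (λ t → θ-mono (lia 5 (λ t c x' x p → x' :≤ x :→ :suc t :+ c :< x' :+ p :→ :goal (t :+ c :< x :+ p)) t c
        (X (suc t) (r + suc t)) (X t (r + t)) p
        (extended-antitone (ℕₚ.n≤1+n t) (ℕₚ.+-monoʳ-≤ r (ℕₚ.n≤1+n t))))) i<a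

    surface-zero : ∀ r p → a ≤ r → (∀ t → t < a → X t (r + t) + p ≤ t + c) → S r p ≡ 0
    surface-zero r p a≤r le = trans (tally-cong a (λ t t<a → θ-≥ (le t t<a))) (tally-θ {0} {a} z≤n)

    surface-start : ∀ r → a ≤ r → S r 0 ≡ 0
    surface-start r a≤r = surface-zero r 0 a≤r
      (λ t _ → lia 3 (λ x t c → x :≤ c :→ :goal (x :+ :con 0 :≤ t :+ c)) (X t (r + t)) t c
      (extended-≤c (ℕₚ.≤-trans a≤r (ℕₚ.m≤m+n r t))))

    surface-top : ∀ p → p ≤ c → S (a + b) p ≡ 0
    surface-top p p≤c = surface-zero (a + b) p (ℕₚ.m≤m+n a b)
      (λ t _ → lia 4 (λ x t c p → x :≡ :con 0 :→ p :≤ c :→ :goal (x :+ p :≤ t :+ c)) (X t (a + b + t)) t c p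
      (trans (extended-out c M (ℕₚ.≤-trans (ℕₚ.m≤m+n a b) (ℕₚ.m≤m+n (a + b) t))) (entry-outʳ M (λ lt →
        lia 4 (λ a b t d → d :< b :→ a :+ d :≡ a :+ b :+ t :→ :goal :⊥) a b t (a + b + t ∸ a) lt
          (ℕₚ.m+[n∸m]≡n (ℕₚ.≤-trans (ℕₚ.m≤m+n a b) (ℕₚ.m≤m+n (a + b) t)))))) p≤c)

    surface-right : ∀ r → S r (a + c) ≡ a
    surface-right r = trans (tally-cong a
      (λ t t<a → trans (θ-< (lia 4 (λ t a c x → t :< a :→ :goal (t :+ c :< x :+ (a :+ c))) t a c (X t (r + t))
      t<a)) (sym (θ-< t<a))))
      (tally-θ {a} ℕₚ.≤-refl)

    -- Here the point `t` of the line has second coordinate `t - p` and height `t + c - p`: for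
    -- `t < p` it lies in the full continuation, and for `t ≥ p` it lies at or above the ceiling
    -- `c`.
    surface-left : ∀ r p → r + p ≡ a → S r p ≡ p
    surface-left r p eq = trans (tally-cong a (λ t t<a → go t)) (tally-θ {p} (subst (p ≤_) eq (ℕₚ.m≤n+m p r)))
      where
      go : ∀ t → θ (t + c) (X t (r + t) + p) ≡ θ t p
      go t with t ℕₚ.<? p
      ... | yes t<p = trans (θ-< (lia 6
        (λ t c x p r a → t :< p :→ x :≡ a :+ c :→ r :+ p :≡ a :→ :goal (t :+ c :< x :+ p)) t c (X t (r + t)) p
        r a t<p
          (extended-in c M (subst (r + t <_) eq (ℕₚ.+-monoʳ-< r t<p))) eq)) (sym (θ-< t<p))
      ... | no t≮p = trans (θ-≥ (lia 4 (λ t c x p → p :≤ t :→ x :≤ c :→ :goal (x :+ p :≤ t :+ c)) t c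
        (X t (r + t)) p (ℕₚ.≮⇒≥ t≮p)
          (extended-≤c (subst (_≤ r + t) eq (ℕₚ.+-monoʳ-≤ r (ℕₚ.≮⇒≥ t≮p)))))) (sym (θ-≥ (ℕₚ.≮⇒≥ t≮p)))

    -- The gaps select the side, and the partner across it must still be inside the hexagon. A side
    -- on the boundary is impossible, since it would contradict the values in `surface-top`,
    -- `surface-right` or `surface-left`.
    match-down : ∀ {x y} → Down∈ x y → ∃[ r ] ∃[ p ] Up∈ r p × Σ[ s ∈ Step r p x y ] Fits S s
    match-down {x} {y} (down∈ x< y< lower upper)
      with two-values (surface-suc (suc x) y) (surface-suc-≤ (suc x) y)
         | two-values (surface-row x (suc y)) (surface-row-≤ x (suc y))
    ... | inj₂ z≡ | _ = suc x , y , up∈ r< y< lower upper , v , z≡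
      where
      r< : suc x < a + b
      r< with suc x ℕₚ.<? a + b
      ... | yes lt = lt
      ... | no ≮ = ⊥-elim (ℕₚ.0≢1+n (trans (sym (trans (cong (λ r → S r (suc y)) eq) (surface-top (suc y)
            (lia 5 (λ x y a b c → :suc x :≡ a :+ b :→ :suc (:suc (x :+ y)) :≤ a :+ b :+ c :→ :goal
              (:suc y :≤ c)) x y a b c eq upper)))) z≡))
        where
        eq : suc x ≡ a + b
        eq = ℕₚ.≤-antisym x< (ℕₚ.≮⇒≥ ≮)
    ... | inj₁ z≡ | inj₂ q≡ = x , suc y , up∈ x< p< (subst (a ≤_) (sym (ℕₚ.+-suc x y)) lower)
        (subst (λ n → suc n ≤ a + b + c) (sym (ℕₚ.+-suc x y)) upper) , e , q≡
      where
      p< : suc y < a + c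
      p< with suc y ℕₚ.<? a + c
      ... | yes lt = lt
      ... | no ≮ = ⊥-elim (ℕₚ.1+n≢n (trans (sym (subst (λ q → S x q ≡ suc (S (suc x) q)) eq q≡ ))
            (trans (surface-right x) (sym (surface-right (suc x))))))
        where
        eq : suc y ≡ a + c
        eq = ℕₚ.≤-antisym y< (ℕₚ.≮⇒≥ ≮)
    ... | inj₁ z≡ | inj₁ q≡ = x , y , up∈ x< y< l (ℕₚ.<⇒≤ upper) , f , trans q≡ z≡
      where
      l : a ≤ x + y
      l with a ℕₚ.≤? x + y
      ... | yes le = le
      ... | no ≰ = ⊥-elim (ℕₚ.1+n≢n (trans (sym (surface-left x (suc y) (trans (ℕₚ.+-suc x y) eq)))
            (trans (trans q≡ z≡) (surface-left (suc x) y eq))))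
        where
        eq : suc (x + y) ≡ a
        eq = ℕₚ.≤-antisym (ℕₚ.≰⇒> ≰) lower

    private
      clash : ∀ {m n} → m ≤ n → n < m → ⊥
      clash m≤n n<m = ℕₚ.<⇒≱ n<m m≤n

    -- Two different types at one up triangle would need two of its three gaps to be one, although
    -- they add up to one.
    fits-injective : ∀ {r p x y x' y'} (s : Step r p x y) (s' : Step r p x' y') → Fits S s → Fits S s' → x ≡ x'
      × y ≡ y'
    fits-injective v v _ _ = refl , refl
    fits-injective e e _ _ = refl , refl
    fits-injective f f _ _ = refl , refl
    fits-injective {r} {p} v e p₁ p₂ = ⊥-elim
      (clash (surface-diagonal-≤ r p) (ℕₚ.≤-reflexive (sym (trans p₁ (cong suc p₂)))))
    fits-injective {r} {p} e v p₁ p₂ = ⊥-elim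
      (clash (surface-diagonal-≤ r p) (ℕₚ.≤-reflexive (sym (trans p₂ (cong suc p₁)))))
    fits-injective {r} {p} v f p₁ p₂ = ⊥-elim (clash (surface-row r p) (ℕₚ.≤-reflexive (trans (sym p₁) p₂)))
    fits-injective {r} {p} f v p₁ p₂ = ⊥-elim (clash (surface-row r p) (ℕₚ.≤-reflexive (trans (sym p₂) p₁)))
    fits-injective {r} {p} e f p₁ p₂ = ⊥-elim
      (clash (surface-suc r p) (ℕₚ.≤-reflexive (sym (trans p₁ (cong suc (sym p₂))))))
    fits-injective {r} {p} f e p₁ p₂ = ⊥-elim
      (clash (surface-suc r p) (ℕₚ.≤-reflexive (sym (trans p₂ (cong suc (sym p₁))))))

    -- The gaps are now those around the common down triangle.
    fits-functional : ∀ {r p r' p' x y} (s : Step r p x y) (s' : Step r' p' x y) → Fits S s → Fits S s' → r ≡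
      r' × p ≡ p'
    fits-functional v v _ _ = refl , refl
    fits-functional e e _ _ = refl , refl
    fits-functional f f _ _ = refl , refl
    fits-functional {x = x} {y} v e p₁ p₂ = ⊥-elim
      (clash (surface-diagonal-≤ x y) (ℕₚ.≤-reflexive (sym (trans p₂ (cong suc p₁)))))
    fits-functional {x = x} {y} e v p₁ p₂ = ⊥-elim
      (clash (surface-diagonal-≤ x y) (ℕₚ.≤-reflexive (sym (trans p₁ (cong suc p₂)))))
    fits-functional {x = x} {y} v f p₁ p₂ = ⊥-elim
      (clash (surface-row x (suc y)) (ℕₚ.≤-reflexive (trans (cong suc p₂) (sym p₁))))
    fits-functional {x = x} {y} f v p₁ p₂ = ⊥-elim
      (clash (surface-row x (suc y)) (ℕₚ.≤-reflexive (trans (cong suc p₁) (sym p₂))))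
    fits-functional {x = x} {y} e f p₁ p₂ = ⊥-elim
      (clash (surface-suc (suc x) y) (ℕₚ.≤-reflexive (trans (sym p₁) p₂)))
    fits-functional {x = x} {y} f e p₁ p₂ = ⊥-elim
      (clash (surface-suc (suc x) y) (ℕₚ.≤-reflexive (trans (sym p₂) p₁)))

    -- For `e` and `f` another gap already uses up the total of one. Hence the vertical edges
    -- determine the surface along each level.
    fits-V : ∀ {r p x y} (s : Step r p x y) → Fits S s → S (suc x) (suc y) ≡ S (suc x) y + V s
    fits-V {x = x} {y} v fit = trans fit (ℕₚ.+-comm 1 (S (suc x) y))
    fits-V {x = x} {y} e fit = lia 3
      (λ q w z → q :≡ :suc z :→ q :≤ :suc w :→ w :≤ z :→ :goal (z :≡ w :+ :con 0))
      (S x (suc y)) (S (suc x) y) (S (suc x) (suc y)) fit (surface-diagonal-≤ x y) (surface-suc (suc x) y)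
    fits-V {x = x} {y} f fit = lia 3 (λ q w z → q :≡ w :→ z :≤ q :→ w :≤ z :→ :goal (z :≡ w :+ :con 0))
      (S x (suc y)) (S (suc x) y) (S (suc x) (suc y)) fit (surface-row x (suc y)) (surface-suc (suc x) y)

  -- The correspondence between matchings and plane partitions

  antitone-steps : ∀ {n} (φ : ℕ → ℕ) → (∀ k → suc k < n → φ (suc k) ≤ φ k) → ∀ {k l} → k ≤ l → l < n → φ l ≤ φ k
  antitone-steps {n} φ step {k} {l} k≤l l<n with d , refl ← ℕₚ.m≤n⇒∃[o]m+o≡n k≤l = go d l<n
    where
    go : ∀ d → k + d < n → φ (k + d) ≤ φ k
    go zero _ = ℕₚ.≤-reflexive (cong φ (ℕₚ.+-identityʳ k))
    go (suc d) lt = subst (λ m → φ m ≤ φ k) (sym (ℕₚ.+-suc k d))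
      (ℕₚ.≤-trans (step (k + d) (subst (_< n) (ℕₚ.+-suc k d) lt))
        (go d (ℕₚ.<-trans (ℕₚ.+-monoʳ-< k (ℕₚ.n<1+n d)) lt)))

  module Correspondence (a b c : ℕ) (1≤b : 1 ≤ b) {N : ℕ} {ux uy dx dy : Fin N → ℕ}
    (U : Enumeration (Hexagon.Up∈ a b c 1≤b) ux uy) (D : Enumeration (Hexagon.Down∈ a b c 1≤b) dx dy) where

    open Hexagon a b c 1≤b
    private
      module U = Enumeration U
      module D = Enumeration D

    Steps : ℤ × (Fin N → Fin N) → Set
    Steps sp = ∀ i → Step (ux (proj₂ sp i)) (uy (proj₂ sp i)) (dx i) (dy i)

    Corresponds : ℤ × (Fin N → Fin N) → Vec (Vec ℕ b) a → Set
    Corresponds sp M = Σ[ s ∈ Steps sp ] ∀ i → Fits (surface c M) (s i)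

    module FromMatching {sp} (sp∈ : sp ∈ perms N) (s : Steps sp) where
      open Heights a b c 1≤b U D sp∈ s
      open Enumerated.Matching U D sp∈ s using (mx; my)

      -- This inverts the parametrisation in `surface`: the cell `(i , j , k)` is point `i` of the
      -- line with `r = a + j - i` and `p = i + c - k`, and the partition is to contain the first
      -- `height r p` points of that line.
      box : ℕ → ℕ → ℕ → ℕ
      box i j k = θ i (height (a + j ∸ i) (i + c ∸ k))

      heap : ℕ → ℕ → ℕ
      heap i j = tally (box i j) c

      partition : Vec (Vec ℕ b) a
      partition = matrix a b heap

      height-mono-≤ : ∀ r {p q} → p ≤ q → height r p ≤ height r q
      height-mono-≤ r {p} p≤q with k , refl ← ℕₚ.m≤n⇒∃[o]m+o≡n p≤q = height-mono-+ r p k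

      heap-threshold : ∀ i j {k} → k < c → box i j k ≡ θ k (heap i j)
      heap-threshold i j = tally-threshold {box i j} (λ k → θ≤1 i (height (a + j ∸ i) (i + c ∸ k)))
        (λ k → θ-mono (λ lt →
        ℕₚ.≤-trans lt (height-mono-≤ (a + j ∸ i) (ℕₚ.∸-monoʳ-≤ (i + c) (ℕₚ.n≤1+n k)))))

      heap-≤c : ∀ i j → heap i j ≤ c
      heap-≤c i j = tally-≤ {box i j} c (λ k → θ≤1 i (height (a + j ∸ i) (i + c ∸ k)))

      -- Passing to `suc j` raises the level by one at the same position, and by `height-row` this
      -- never raises the height.
      heap-right : ∀ {i} → i < a → ∀ j → suc j < b → heap i (suc j) ≤ heap i j
      heap-right {i} i<a j j< = tally-mono c λ k k<c → θ-mono (λ lt → ℕₚ.≤-trans lt (lower k k<c))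
        where
        r = a + j ∸ i
        i+r : i + r ≡ a + j
        i+r = ℕₚ.m+[n∸m]≡n (ℕₚ.≤-trans (ℕₚ.<⇒≤ i<a) (ℕₚ.m≤m+n a j))
        next : a + suc j ∸ i ≡ suc r
        next = trans (cong (_∸ i) (ℕₚ.+-suc a j)) (ℕₚ.+-∸-assoc 1 (ℕₚ.≤-trans (ℕₚ.<⇒≤ i<a) (ℕₚ.m≤m+n a j)))
        lower : ∀ k → k < c → height (a + suc j ∸ i) (i + c ∸ k) ≤ height r (i + c ∸ k)
        lower k k<c = subst (λ z → height z p ≤ height r p) (sym next)
          (ℕₚ.≤-trans (ℕₚ.≤-trans (ℕₚ.m≤m+n _ _) (ℕₚ.m≤m+n _ _)) (ℕₚ.≤-reflexive (sym (height-row r p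
            (lia 5 (λ a b i j r → i :+ r :≡ a :+ j :→ :suc j :< b :→ :goal (r :< a :+ b)) a b i j r i+r j<)
            (lia 5 (λ a c i k p → k :+ p :≡ i :+ c :→ i :< a :→ :goal (p :≤ a :+ c)) a c i k p k+p i<a)
            (lia 7 (λ a c i j k r p → k :+ p :≡ i :+ c :→ i :+ r :≡ a :+ j :→ k :< c :→ :goal (a :≤ r :+ p)) a
              c i j k r p k+p i+r k<c)))))
          where
          p = i + c ∸ k
          k+p : k + p ≡ i + c
          k+p = ℕₚ.m+[n∸m]≡n (ℕₚ.≤-trans (ℕₚ.<⇒≤ k<c) (ℕₚ.m≤n+m c i))

      -- Passing to `suc i` lowers the level and advances the position by one. The height gains at
      -- most one, since the up triangle `(r , p)` cannot carry a vertical and an `e` edge together,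
      -- and the index to be exceeded has grown by one as well.
      heap-down : ∀ {j} → j < b → ∀ i → suc i < a → heap (suc i) j ≤ heap i j
      heap-down {j} j<b i i< = tally-mono c λ k k<c → θ-mono (λ lt → ℕ.s≤s⁻¹ (ℕₚ.≤-trans lt (lower k k<c)))
        where
        r = a + j ∸ suc i
        i+r : suc i + r ≡ a + j
        i+r = ℕₚ.m+[n∸m]≡n (ℕₚ.≤-trans (ℕₚ.<⇒≤ i<) (ℕₚ.m≤m+n a j))
        next : a + j ∸ i ≡ suc r
        next = trans (cong (_∸ i) (sym i+r)) (trans (cong (_∸ i) (sym (ℕₚ.+-suc i r))) (ℕₚ.m+n∸m≡n i (suc r)))
        lower : ∀ k → k < c → height r (suc i + c ∸ k) ≤ suc (height (a + j ∸ i) (i + c ∸ k))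
        lower k k<c = subst₂ (λ q r' → height r q ≤ suc (height r' p)) (sym q≡) (sym next)
          (lia 6 (λ h h' V E F g → h :≡ h' :+ V :→ h' :≡ g :+ E :→ V :+ E :+ F :≤ :con 1 :→ :goal (h :≤ :suc g))
            (height r (suc p)) (height r p) (edges V r p) (edges E r p) (edges F r p) (height (suc r) p)
            (height-suc r p)
            (height-row-inside r p
              (lia 5 (λ a b i j r → :suc i :+ r :≡ a :+ j :→ j :< b :→ :goal (r :< a :+ b)) a b i j r i+r j<b)
              (lia 5 (λ a c i k p → k :+ p :≡ i :+ c :→ :suc i :< a :→ :goal (p :≤ a :+ c)) a c i k p k+p i<)
              (lia 7 (λ a c i j k r p → k :+ p :≡ i :+ c :→ :suc i :+ r :≡ a :+ j :→ k :< c :→ :goal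
                (a :≤ r :+ p)) a c i j k r p k+p i+r k<c)
              (lia 8 (λ a b c i j k r p → k :+ p :≡ i :+ c :→ :suc i :+ r :≡ a :+ j :→ j :< b :→ :goal
                (r :+ p :< a :+ b :+ c)) a b c i j k r p k+p i+r j<b))
            (edges≤1 r p))
          where
          p = i + c ∸ k
          k≤ : k ≤ i + c
          k≤ = ℕₚ.≤-trans (ℕₚ.<⇒≤ k<c) (ℕₚ.m≤n+m c i)
          k+p : k + p ≡ i + c
          k+p = ℕₚ.m+[n∸m]≡n k≤
          q≡ : suc i + c ∸ k ≡ suc p
          q≡ = ℕₚ.+-∸-assoc 1 k≤

      partition-isPP : IsPP a b c partition
      partition-isPP =
        (λ i j → subst (_≤ c) (sym (lookup-matrix heap i j)) (heap-≤c (toℕ i) (toℕ j))) ,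
        (λ i j j' j≤j' → subst₂ _≤_ (sym (lookup-matrix heap i j')) (sym (lookup-matrix heap i j))
          (antitone-steps (heap (toℕ i)) (heap-right (Fₚ.toℕ<n i)) j≤j' (Fₚ.toℕ<n j'))) ,
        (λ i i' j i≤i' → subst₂ _≤_ (sym (lookup-matrix heap i' j)) (sym (lookup-matrix heap i j))
          (antitone-steps (λ i → heap i (toℕ j)) (heap-down (Fₚ.toℕ<n j)) i≤i' (Fₚ.toℕ<n i')))

      -- Inside the box `heap-threshold` decides whether a point is counted. The line may also run
      -- in front of the box, beyond `b`, below the floor or above the ceiling; there membership is
      -- forced, and it agrees with the height by `height-lower`, `height-upper`,
      -- `position-≤-height` and `height-≤-position` respectively.
      surface-height : ∀ {r p} → Vertex r p → surface c partition r p ≡ height r p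
      surface-height {r} {p} vx = trans (tally-cong a agree) (tally-θ (height-≤a vx))
        where
        open Vertex vx
        outside : ∀ t j m → m ≡ 0 → b ≤ j → a + j ≡ r + t → θ (t + c) (m + p) ≡ θ t (height r p)
        outside t j m m≡ b≤j a+j = trans
          (θ-≥ (lia 8 (λ a b c r p t j m → m :≡ :con 0 :→ r :+ p :≤ a :+ b :+ c :→ a :+ j :≡ r :+ t :→ b :≤ j
            :→ :goal (m :+ p :≤ t :+ c))
            a b c r p t j m m≡ upper a+j b≤j))
          (sym (θ-≥ (lia 6 (λ a b r t j h → h :+ r :≤ a :+ b :→ a :+ j :≡ r :+ t :→ b :≤ j :→ :goal (h :≤ t))
            a b r t j (height r p) (height-upper vx) a+j b≤j)))
        inside : ∀ t j m → m ≡ heap t j → a + j ≡ r + t → θ (t + c) (m + p) ≡ θ t (height r p)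
        inside t j m refl a+j with p ℕₚ.≤? t + c
        ... | no p≰ = trans
          (θ-< (lia 4 (λ t c p m → t :+ c :< p :→ :goal (t :+ c :< m :+ p)) t c p m (ℕₚ.≰⇒> p≰)))
          (sym (θ-< (lia 4 (λ t c p h → t :+ c :< p :→ p :≤ h :+ c :→ :goal (t :< h)) t c p (height r p)
            (ℕₚ.≰⇒> p≰) (position-≤-height vx))))
        ... | yes p≤ with k , p+k ← ℕₚ.m≤n⇒∃[o]m+o≡n p≤ with k ℕₚ.<? c
        ...   | no k≮c = trans
          (θ-≥ (lia 5 (λ t c p m k → p :+ k :≡ t :+ c :→ c :≤ k :→ m :≤ c :→ :goal (m :+ p :≤ t :+ c))
            t c p m k p+k (ℕₚ.≮⇒≥ k≮c) (heap-≤c t j)))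
          (sym (θ-≥ (lia 5 (λ t c p h k → p :+ k :≡ t :+ c :→ c :≤ k :→ h :≤ p :→ :goal (h :≤ t))
            t c p (height r p) k p+k (ℕₚ.≮⇒≥ k≮c) (height-≤-position r p lower))))
        ...   | yes k<c = trans
          (θ-cong (lia 5 (λ t c p m k → p :+ k :≡ t :+ c :→ t :+ c :< m :+ p :→ :goal (k :< m)) t c p m k p+k)
                  (lia 5 (λ t c p m k → p :+ k :≡ t :+ c :→ k :< m :→ :goal (t :+ c :< m :+ p)) t c p m k p+k))
          (trans (sym (heap-threshold t j k<c)) (cong₂ (λ r p → θ t (height r p))
            (trans (cong (_∸ t) a+j) (ℕₚ.m+n∸n≡m r t)) (trans (cong (_∸ k) (sym p+k)) (ℕₚ.m+n∸n≡m p k))))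
        agree : ∀ t → t < a → θ (t + c) (extended c partition t (r + t) + p) ≡ θ t (height r p)
        agree t t<a with r + t ℕₚ.<? a
        ... | yes r+t<a = trans
          (θ-< (lia 4 (λ t a c p → t :< a :→ :goal (t :+ c :< a :+ c :+ p)) t a c p t<a))
          (sym (θ-< (lia 4 (λ t a r h → r :+ t :< a :→ a :≤ h :+ r :→ :goal (t :< h)) t a r (height r p) r+t<a
            (height-lower vx))))
        ... | no r+t≮a = cell (r + t ∸ a ℕₚ.<? b)
          where
          a+j : a + (r + t ∸ a) ≡ r + t
          a+j = ℕₚ.m+[n∸m]≡n (ℕₚ.≮⇒≥ r+t≮a)
          cell : Dec (r + t ∸ a < b) → θ (t + c) (entry partition t (r + t ∸ a) + p) ≡ θ t (height r p)
          cell (yes j<b) = inside t _ _ (entry-matrix heap t<a j<b) a+j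
          cell (no j≮b) = outside t _ _ (entry-outʳ partition j≮b) (ℕₚ.≮⇒≥ j≮b) a+j

      -- An edge of one type at an up triangle excludes the other two. A `v` or `e` edge is thus
      -- exactly one jump of the height, and for `f` both jumps vanish.
      fits : ∀ {r p x y} (st : Step r p x y) → Down∈ x y →
        (V st ≡ 1 → 1 ≤ edges V r p) → (E st ≡ 1 → 1 ≤ edges E r p) → (F st ≡ 1 → 1 ≤ edges F r p) →
        Fits height st
      fits {x = x} {y} v d V≥1 _ _ = lia 5
        (λ h h' V E F → h :≡ h' :+ V :→ V :+ E :+ F :≤ :con 1 :→ :con 1 :≤ V :→ :goal (h :≡ :suc h'))
        _ _ _ _ _ (height-suc (suc x) y) (edges≤1 (suc x) y) (V≥1 refl)
      fits {x = x} {y} e (down∈ x< y< l u) _ E≥1 _ =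
        lia 5 (λ h h' V E F → h :≡ h' :+ E :→ V :+ E :+ F :≤ :con 1 :→ :con 1 :≤ E :→ :goal (h :≡ :suc h'))
        (height x (suc y)) (height (suc x) (suc y)) (edges V x (suc y)) (edges E x (suc y)) (edges F x (suc y))
          (height-row-inside x (suc y) x< y< (subst (a ≤_) (sym (ℕₚ.+-suc x y)) l)
          (subst (λ n → suc n ≤ a + b + c) (sym (ℕₚ.+-suc x y)) u)) (edges≤1 x (suc y)) (E≥1 refl)
      fits {x = x} {y} f (down∈ x< y< l u) _ _ F≥1 =
        lia 6 (λ h h' h'' V E F → h :≡ h' :+ V :→ h' :≡ h'' :+ E :→ V :+ E :+ F :≤ :con 1 :→ :con 1 :≤ F :→
          :goal (h :≡ h''))
        _ _ _ _ _ _ (height-suc x y) (height-row-inside x y x< (ℕₚ.<⇒≤ y<) lower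
          (ℕₚ.<⇒≤ u)) (edges≤1 x y) (F≥1 refl)
        where
        lower : a ≤ x + y
        lower with a ℕₚ.≤? x + y
        ... | yes le = le
        ... | no a≰ = ⊥-elim (ℕₚ.<⇒≢ (F≥1 refl)
          (sym (ℕₚ.m+n≡0⇒n≡0 (edges V x y + edges E x y) (edges-out (a≰ ∘ Up∈.lower)))))

      fits-surface : ∀ {r p x y} (st : Step r p x y) → Down∈ x y → Fits height st → Fits (surface c partition)
        st
      fits-surface {x = x} {y} v (down∈ x< y< l u) fit = trans (surface-height right)
        (trans fit (cong suc (sym (surface-height top))))
        where
        top : Vertex (suc x) y
        top = vertex x< (ℕₚ.<⇒≤ y<) l (ℕₚ.<⇒≤ u)
        right : Vertex (suc x) (suc y)
        right = vertex x< y< (lia 3 (λ a x y → a :≤ :suc (x :+ y) :→ :goal (a :≤ :suc x :+ :suc y)) a x y l)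
          (lia 3 (λ S x y → :suc (:suc (x :+ y)) :≤ S :→ :goal (:suc x :+ :suc y :≤ S)) (a + b + c) x y u)
      fits-surface {x = x} {y} e (down∈ x< y< l u) fit = trans (surface-height left)
        (trans fit (cong suc (sym (surface-height right))))
        where
        left : Vertex x (suc y)
        left = vertex (ℕₚ.<⇒≤ x<) y< (subst (a ≤_) (sym (ℕₚ.+-suc x y)) l)
          (subst (_≤ a + b + c) (sym (ℕₚ.+-suc x y)) (ℕₚ.<⇒≤ u))
        right : Vertex (suc x) (suc y)
        right = vertex x< y< (lia 3 (λ a x y → a :≤ :suc (x :+ y) :→ :goal (a :≤ :suc x :+ :suc y)) a x y l)
          (lia 3 (λ S x y → :suc (:suc (x :+ y)) :≤ S :→ :goal (:suc x :+ :suc y :≤ S)) (a + b + c) x y u)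
      fits-surface {x = x} {y} f (down∈ x< y< l u) fit = trans (surface-height left)
        (trans fit (sym (surface-height top)))
        where
        left : Vertex x (suc y)
        left = vertex (ℕₚ.<⇒≤ x<) y< (subst (a ≤_) (sym (ℕₚ.+-suc x y)) l)
          (subst (_≤ a + b + c) (sym (ℕₚ.+-suc x y)) (ℕₚ.<⇒≤ u))
        top : Vertex (suc x) y
        top = vertex x< (ℕₚ.<⇒≤ y<) l (ℕₚ.<⇒≤ u)

      partition-corresponds : Corresponds sp partition
      partition-corresponds = s , λ i → fits-surface (s i) (D.inside i)
        (fits (s i) (D.inside i) (edge-present V i) (edge-present E i) (edge-present F i))

module Counting where

  open Lozenges
  open import Data.Nat.Base using (_+_; _<_; _≤_; _∸_)
  open import Data.Integer.Base using (+_)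
  open import Data.Vec.Base using (lookup)
  open import Data.List.Base using (allFin; upTo; filter; length; foldr)

  -- Lists

  AllPairs-lookup : ∀ {A : Set} {R : A → A → Set} {xs} → AllPairs R xs →
    ∀ i j → i Fin.< j → R (List.lookup xs i) (List.lookup xs j)
  AllPairs-lookup (r ∷ rs) Fin.zero (Fin.suc j) lt = All.lookup r (∈ₚ.∈-lookup j)
  AllPairs-lookup (r ∷ rs) (Fin.suc i) (Fin.suc j) (s≤s lt) = AllPairs-lookup rs i j lt

  module _ {A B : Set} {_~_ : A → A → Set} (R : A → B → Set)
    (~-sym : ∀ {x y} → x ~ y → y ~ x) (R-injective : ∀ {x x' y} → R x y → R x' y → x ~ x') where

    -- This is the pigeonhole principle for lists without repetition up to `~`. Permutations are
    -- functions and are compared only pointwise, hence a relation `~` in place of equality.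
    length-≤ : ∀ {xs ys} → AllPairs (λ x y → ¬ x ~ y) xs → (∀ {x} → x ∈ xs → ∃[ y ] y ∈ ys × R x y) →
      length xs ≤ length ys
    length-≤ {xs} {ys} distinct related = Fₚ.injective⇒≤ {f = position} injective
      where
      image : ∀ i → ∃[ y ] y ∈ ys × R (List.lookup xs i) y
      image i = related (∈ₚ.∈-lookup i)
      position : Fin (length xs) → Fin (length ys)
      position i = Any.index (proj₁ (proj₂ (image i)))
      lookup-position : ∀ i → proj₁ (image i) ≡ List.lookup ys (position i)
      lookup-position i = Anyₚ.lookup-index (proj₁ (proj₂ (image i)))
      equivalent : ∀ {i j} → position i ≡ position j → List.lookup xs i ~ List.lookup xs j
      equivalent {i} {j} eq = R-injective (proj₂ (proj₂ (image i)))
        (subst (R (List.lookup xs j)) (trans (lookup-position j)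
          (sym (trans (lookup-position i) (cong (List.lookup ys) eq))))
          (proj₂ (proj₂ (image j))))
      injective : ∀ {i j} → position i ≡ position j → i ≡ j
      injective {i} {j} eq with Fₚ.<-cmp i j
      ... | tri< i<j _ _ = ⊥-elim (AllPairs-lookup distinct i j i<j (equivalent eq))
      ... | tri≈ _ i≡j _ = i≡j
      ... | tri> _ _ j<i = ⊥-elim (AllPairs-lookup distinct j i j<i (~-sym (equivalent eq)))

  _≗ₚ_ : ∀ {n} → ℤ × (Fin n → Fin n) → ℤ × (Fin n → Fin n) → Set
  sp ≗ₚ tp = ∀ i → proj₂ sp i ≡ proj₂ tp i

  perms-distinct : ∀ n → AllPairs (λ sp tp → ¬ sp ≗ₚ tp) (perms n)
  perms-distinct zero = [] ∷ []
  perms-distinct (suc n) = AllPairsₚ.concat⁺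
    (Allₚ.map⁺ (All.universal (λ k → AllPairsₚ.map⁺ (AllPairs.map
      (λ {sp} {tp} ≠ eq → ≠ (λ i → Fₚ.punchIn-injective k (proj₂ sp i) (proj₂ tp i) (eq (Fin.suc i))))
        (perms-distinct n))) (allFin (suc n))))
    (AllPairsₚ.map⁺ (AllPairs.map (λ {k} {l} k≢l → Allₚ.map⁺ (All.universal (λ sp → Allₚ.map⁺ (All.universal
      (λ tp eq → k≢l (eq Fin.zero)) (perms n))) (perms n))) (Uniqueₚ.allFin⁺ (suc n))))

  extend-∈ : ∀ {n} k {sp} → sp ∈ perms n → extend k sp ∈ perms (suc n)
  extend-∈ {n} k sp∈ = ∈ₚ.∈-concatMap⁺ (λ k → List.map (extend k) (perms n))
    (Any.map (λ { refl → ∈ₚ.∈-map⁺ (extend k) sp∈ }) (∈ₚ.∈-allFin k))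

  -- The value at zero is the first choice `k`; injectivity keeps the other values away from it, and
  -- `punchOut` renumbers them.
  perms-complete : ∀ {n} (φ : Fin n → Fin n) → (∀ {i j} → φ i ≡ φ j → i ≡ j) →
    ∃[ sp ] sp ∈ perms n × (∀ i → proj₂ sp i ≡ φ i)
  perms-complete {zero} φ inj = _ , here refl , λ ()
  perms-complete {suc n} φ inj = insert (perms-complete (λ i → punchOut (first≢ i))
      (λ {i} {j} eq → Fₚ.suc-injective (inj (Fₚ.punchOut-injective (first≢ i) (first≢ j) eq))))
    where
    first≢ : ∀ i → φ Fin.zero ≢ φ (Fin.suc i)
    first≢ i eq with inj eq
    ... | ()
    insert : ∃[ sp ] sp ∈ perms n × (∀ i → proj₂ sp i ≡ punchOut (first≢ i)) →
      ∃[ sp ] sp ∈ perms (suc n) × (∀ i → proj₂ sp i ≡ φ i)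
    insert (sp , sp∈ , eq) = extend (φ Fin.zero) sp , extend-∈ (φ Fin.zero) sp∈ ,
      λ { Fin.zero → refl ; (Fin.suc i) → trans (cong (punchIn (φ Fin.zero)) (eq i))
        (Fₚ.punchIn-punchOut (first≢ i)) }

  allVecs-complete : ∀ {A : Set} {xs : List A} {n} (w : Vec A n) → (∀ i → lookup w i ∈ xs) → w ∈ allVecs xs n
  allVecs-complete Vec.[] _ = here refl
  allVecs-complete {xs = xs} {suc n} (x Vec.∷ w) ∈xs = ∈ₚ.∈-concatMap⁺
    (λ x → List.map (x Vec.∷_) (allVecs xs n))
    (Any.map (λ { refl → ∈ₚ.∈-map⁺ (x Vec.∷_) (allVecs-complete w (λ i → ∈xs (Fin.suc i))) }) (∈xs Fin.zero))

  allVecs-distinct : ∀ {A : Set} {xs : List A} n → AllPairs _≢_ xs → AllPairs _≢_ (allVecs xs n)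
  allVecs-distinct zero distinct = [] ∷ []
  allVecs-distinct {xs = xs} (suc n) distinct = AllPairsₚ.concat⁺
    (Allₚ.map⁺ (All.universal (λ x → AllPairsₚ.map⁺
      (AllPairs.map (λ ≠ eq → ≠ (Vecₚ.∷-injectiveʳ eq)) (allVecs-distinct n distinct))) xs))
    (AllPairsₚ.map⁺ (AllPairs.map (λ x≢y → Allₚ.map⁺ (All.universal (λ _ → Allₚ.map⁺ (All.universal
      (λ _ eq → x≢y (Vecₚ.∷-injectiveˡ eq)) (allVecs xs n))) (allVecs xs n))) distinct))

  sum-constant : ∀ {A : Set} (φ : A → ℤ) m (xs : List A) → (∀ {x} → x ∈ xs → φ x ≢ 0ℤ → φ x ≡ m) →
    foldr ℤ._+_ 0ℤ (List.map φ xs) ≡ m ℤ.* + length (filter (λ x → ¬? (φ x ℤₚ.≟ 0ℤ)) xs)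
  sum-constant φ m [] const = sym (ℤₚ.*-zeroʳ m)
  sum-constant φ m (x ∷ xs) const with φ x ℤₚ.≟ 0ℤ
  ... | yes eq = trans (cong₂ ℤ._+_ eq (sum-constant φ m xs (λ x∈ → const (there x∈)))) (ℤₚ.+-identityˡ _)
  ... | no ≠ = trans (cong₂ ℤ._+_ (const (here refl) ≠) (sum-constant φ m xs (λ x∈ → const (there x∈))))
    (sym (ℤₚ.*-suc m (+ length (filter (λ x → ¬? (φ x ℤₚ.≟ 0ℤ)) xs))))

  -- Counting matchings

  -- If `m' < m`, then the threshold at `k = m'`, which is below `c`, tells the two apart.
  θ-separates : ∀ {c m m'} → m ≤ c → (∀ k → k < c → θ k m ≡ θ k m') → m ≤ m'
  θ-separates {c} {m} {m'} m≤c eq with m ℕₚ.≤? m'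
  ... | yes m≤m' = m≤m'
  ... | no m≰m' = ⊥-elim (ℕₚ.0≢1+n
    (trans (sym (θ-≥ {m'} ℕₚ.≤-refl)) (trans (sym (eq m' (ℕₚ.<-≤-trans (ℕₚ.≰⇒> m≰m') m≤c)))
    (θ-< (ℕₚ.≰⇒> m≰m')))))

  module Bijection (a b c : ℕ) (1≤b : 1 ≤ b) {N : ℕ} {ux uy dx dy : Fin N → ℕ}
    (U : Enumeration (Hexagon.Up∈ a b c 1≤b) ux uy) (D : Enumeration (Hexagon.Down∈ a b c 1≤b) dx dy) where

    open Hexagon a b c 1≤b
    open Correspondence a b c 1≤b U D public
    private
      module U = Enumeration U
      module D = Enumeration D

    permutation-unique : ∀ {sp tp M} → IsPP a b c M → Corresponds sp M → Corresponds tp M → sp ≗ₚ tp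
    permutation-unique {M = M} pp (s , fit) (s' , fit') i =
      let x≡ , y≡ = Surface.fits-functional a b c 1≤b M pp (s i) (s' i) (fit i) (fit' i) in U.injective x≡ y≡

    module _ {sp M M'} (pp : IsPP a b c M) (pp' : IsPP a b c M')
      (corr : Corresponds sp M) (corr' : Corresponds sp M') where
      private
        module S = Surface a b c 1≤b M pp
        module S' = Surface a b c 1≤b M' pp'

      -- Both partitions correspond to the same edge at this down triangle, and `fits-V` reads the
      -- increment of either surface off its type.
      same-increment : ∀ {x y} → Down∈ x y → ∃[ n ] S.S (suc x) (suc y) ≡ S.S (suc x) y + n × S'.S (suc x)
        (suc y) ≡ S'.S (suc x) y + n
      same-increment down with i , refl , refl ← D.surjective down =
        V (proj₁ corr i) , S.fits-V (proj₁ corr i) (proj₂ corr i) ,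
        subst (λ st → S'.S (suc (dx i)) (suc (dy i)) ≡ S'.S (suc (dx i)) (dy i) + V st)
          (Step-irrelevant (proj₁ corr' i) (proj₁ corr i))
          (S'.fits-V (proj₁ corr' i) (proj₂ corr' i))

      -- Induction runs along the level from its left end, where the value is prescribed. Positive
      -- levels suffice, because the line through a cell of the box has level `a + j - i` with
      -- `i < a`.
      same-surface : ∀ x p → suc x ≤ a + b → p ≤ a + c → a ≤ suc x + p → suc x + p ≤ a + b + c →
        S.S (suc x) p ≡ S'.S (suc x) p
      same-surface x zero x< p≤ l u = trans (S.surface-start (suc x) a≤) (sym (S'.surface-start (suc x) a≤))
        where
        a≤ : a ≤ suc x
        a≤ = subst (a ≤_) (ℕₚ.+-identityʳ (suc x)) l
      same-surface x (suc p) x< p< l u with a ℕₚ.≤? suc x + p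
      ... | no a≰ = trans (S.surface-left (suc x) (suc p) eq) (sym (S'.surface-left (suc x) (suc p) eq))
        where
        eq : suc x + suc p ≡ a
        eq = ℕₚ.≤-antisym (subst (_≤ a) (sym (ℕₚ.+-suc (suc x) p)) (ℕₚ.≰⇒> a≰)) l
      ... | yes l' with u' ← subst (_≤ a + b + c) (ℕₚ.+-suc (suc x) p) u
                   with n , eq , eq' ← same-increment (down∈ x< p< l' u') =
        trans eq (trans (cong (_+ n) (same-surface x p x< (ℕₚ.<⇒≤ p<) l' (ℕₚ.<⇒≤ u'))) (sym eq'))

      same-entry : ∀ i j → i < a → j < b → ∀ k → k < c → θ k (entry M i j) ≡ θ k (entry M' i j)
      same-entry i j i<a j<b k k<c
        with r , i+r ← ℕₚ.m≤n⇒∃[o]m+o≡n (ℕₚ.≤-trans i<a (ℕₚ.m≤m+n a j))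
        with p , k+p ← ℕₚ.m≤n⇒∃[o]m+o≡n (ℕₚ.≤-trans (ℕₚ.<⇒≤ k<c) (ℕₚ.m≤n+m c i)) = begin
        θ k (entry M i j)                                   ≡⟨ shift (entry M i j) ⟩
        θ (i + c) (entry M i j + p)                         ≡⟨ cong (λ z → θ (i + c) (z + p)) (cell M) ⟨
        θ (i + c) (extended c M i (suc r + i) + p)          ≡⟨ S.surface-threshold (suc r) p i<a ⟩
        θ i (S.S (suc r) p)                                 ≡⟨ cong (θ i) (same-surface r p r≤ p≤ l u) ⟩
        θ i (S'.S (suc r) p)                                ≡⟨ S'.surface-threshold (suc r) p i<a ⟨
        θ (i + c) (extended c M' i (suc r + i) + p)         ≡⟨ cong (λ z → θ (i + c) (z + p)) (cell M') ⟩
        θ (i + c) (entry M' i j + p)                        ≡⟨ shift (entry M' i j) ⟨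
        θ k (entry M' i j)                                  ∎
        where
        open ≡-Reasoning
        r≤ : suc r ≤ a + b
        r≤ = lia 5 (λ a b i j r → :suc i :+ r :≡ a :+ j :→ j :< b :→ :goal (:suc r :≤ a :+ b)) a b i j r i+r j<b
        p≤ : p ≤ a + c
        p≤ = lia 5 (λ a c i k p → k :+ p :≡ i :+ c :→ i :< a :→ :goal (p :≤ a :+ c)) a c i k p k+p i<a
        l : a ≤ suc r + p
        l = lia 7 (λ a c i j k r p → k :+ p :≡ i :+ c :→ :suc i :+ r :≡ a :+ j :→ k :< c :→ :goal
          (a :≤ :suc r :+ p)) a c i j k r p k+p i+r k<c
        u : suc r + p ≤ a + b + c
        u = lia 8 (λ a b c i j k r p → k :+ p :≡ i :+ c :→ :suc i :+ r :≡ a :+ j :→ j :< b :→ :goal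
          (:suc r :+ p :≤ a :+ b :+ c)) a b c i j k r p k+p i+r j<b
        s≡ : suc r + i ≡ a + j
        s≡ = trans (ℕₚ.+-comm (suc r) i) (trans (ℕₚ.+-suc i r) i+r)
        cell : ∀ M → extended c M i (suc r + i) ≡ entry M i j
        cell M = trans (extended-out c M (subst (a ≤_) (sym s≡) (ℕₚ.m≤m+n a j)))
          (cong (entry M i) (trans (cong (_∸ a) s≡) (ℕₚ.m+n∸m≡n a j)))
        shift : ∀ m → θ k m ≡ θ (i + c) (m + p)
        shift m = θ-cong (lia 5 (λ i c m k p → k :+ p :≡ i :+ c :→ k :< m :→ :goal (i :+ c :< m :+ p)) i c m k
          p k+p)
          (lia 5 (λ i c m k p → k :+ p :≡ i :+ c :→ i :+ c :< m :+ p :→ :goal (k :< m)) i c m k p k+p)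

      partition-unique : M ≡ M'
      partition-unique = matrix-ext M M' (λ i j → trans (sym (entry-lookup M i j)) (trans
        (ℕₚ.≤-antisym
          (θ-separates (S.entry-≤c (toℕ i) (toℕ j)) (same-entry (toℕ i) (toℕ j) (Fₚ.toℕ<n i) (Fₚ.toℕ<n j)))
          (θ-separates (S'.entry-≤c (toℕ i) (toℕ j))
            (λ k k<c → sym (same-entry (toℕ i) (toℕ j) (Fₚ.toℕ<n i) (Fₚ.toℕ<n j) k k<c))))
        (entry-lookup M' i j)))

    -- Each down triangle gets the partner found by `match-down`. By `fits-injective` no partner is
    -- used twice, and as both colours are numbered by `Fin N`, the injection is one of the listed
    -- permutations.
    matching-exists : ∀ {M} → IsPP a b c M → ∃[ sp ] sp ∈ perms N × Corresponds sp M
    matching-exists {M} pp = build (perms-complete image injective)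
      where
      open Surface a b c 1≤b M pp
      mate : ∀ i → ∃[ k ] Σ[ st ∈ Step (ux k) (uy k) (dx i) (dy i) ] Fits S st
      mate i =
        let r , p , up , st , fit = match-down (D.inside i)
            k , x≡ , y≡ = U.surjective up
        in k , locate x≡ y≡ st fit
        where
        locate : ∀ {k r p} → ux k ≡ r → uy k ≡ p → (st : Step r p (dx i) (dy i)) → Fits S st →
          Σ[ st ∈ Step (ux k) (uy k) (dx i) (dy i) ] Fits S st
        locate refl refl st fit = st , fit
      image : Fin N → Fin N
      image i = proj₁ (mate i)
      step-at : ∀ i {k} → k ≡ image i → Σ[ st ∈ Step (ux k) (uy k) (dx i) (dy i) ] Fits S st
      step-at i refl = proj₂ (mate i)
      injective : ∀ {i j} → image i ≡ image j → i ≡ j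
      injective {i} {j} eq =
        let st , fit = step-at i refl
            st' , fit' = step-at j eq
            x≡ , y≡ = fits-injective st st' fit fit'
        in D.injective x≡ y≡
      build : ∃[ sp ] sp ∈ perms N × (∀ i → proj₂ sp i ≡ image i) → ∃[ sp ] sp ∈ perms N × Corresponds sp M
      build (sp , sp∈ , eq) = sp , sp∈ , (λ i → proj₁ (step-at i (eq i))) , (λ i → proj₂ (step-at i (eq i)))

    partitions : List (Vec (Vec ℕ b) a)
    partitions = allVecs (allVecs (upTo (suc c)) b) a

    partitions-complete : ∀ {M} → IsPP a b c M → M ∈ partitions
    partitions-complete {M} pp = allVecs-complete M (λ i → allVecs-complete (lookup M i)
      (λ j → ∈ₚ.∈-upTo⁺ (s≤s (proj₁ pp i j))))

    module _ {P : ℤ × (Fin N → Fin N) → Set} (P? : Decidable P)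
      (P⇒steps : ∀ {sp} → P sp → Steps sp) (steps⇒P : ∀ {sp} → sp ∈ perms N → Steps sp → P sp) where

      -- The relation `Corresponds` is total and injective in both directions, which gives the two
      -- inequalities between the lengths.
      matchings-count : length (filter P? (perms N)) ≡ numPP a b c
      matchings-count = ℕₚ.≤-antisym
        (length-≤ (λ sp M → IsPP a b c M × Corresponds sp M) (λ eq i → sym (eq i))
          (λ {sp} {tp} (pp , corr) (_ , corr') → permutation-unique {sp} {tp} pp corr corr')
          (AllPairsₚ.filter⁺ P? (perms-distinct N))
          (λ sp∈ → let sp∈perms , Psp = ∈ₚ.∈-filter⁻ P? {xs = perms N} sp∈
                       open FromMatching sp∈perms (P⇒steps Psp)
            in partition , ∈ₚ.∈-filter⁺ (isPP? a b c) (partitions-complete partition-isPP) partition-isPP ,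
               partition-isPP , partition-corresponds))
        (length-≤ (λ M sp → IsPP a b c M × Corresponds sp M) sym
          (λ {_} {_} {sp} (pp , corr) (pp' , corr') → partition-unique {sp} pp pp' corr corr')
          (AllPairsₚ.filter⁺ (isPP? a b c) (allVecs-distinct a (allVecs-distinct b (Uniqueₚ.upTo⁺ (suc c)))))
          (λ M∈ → let pp = proj₂ (∈ₚ.∈-filter⁻ (isPP? a b c) {xs = partitions} M∈)
                      sp , sp∈ , corr = matching-exists pp
            in sp , ∈ₚ.∈-filter⁺ P? sp∈ (steps⇒P sp∈ (proj₁ corr)) , pp , corr))

  -- The Leibniz expansion

  product-≢0 : ∀ {n} (φ : Fin n → ℤ) → (∀ i → φ i ≢ 0ℤ) → prodFin n φ ≢ 0ℤ
  product-≢0 {suc n} φ φ≢0 eq with ℤₚ.i*j≡0⇒i≡0∨j≡0 (φ Fin.zero) eq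
  ... | inj₁ zero-head = φ≢0 Fin.zero zero-head
  ... | inj₂ zero-tail = product-≢0 (λ i → φ (Fin.suc i)) (λ i → φ≢0 (Fin.suc i)) zero-tail

  factor-≢0 : ∀ {n} (φ : Fin n → ℤ) → prodFin n φ ≢ 0ℤ → ∀ i → φ i ≢ 0ℤ
  factor-≢0 φ prod≢0 Fin.zero eq = prod≢0 (cong (ℤ._* prodFin _ (λ i → φ (Fin.suc i))) eq)
  factor-≢0 φ prod≢0 (Fin.suc i) =
    factor-≢0 (λ i → φ (Fin.suc i))
      (λ eq → prod≢0 (trans (cong (φ Fin.zero ℤ.*_) eq) (ℤₚ.*-zeroʳ (φ Fin.zero)))) i

  prodFin-sum : ∀ {n} (φ : Fin n → ℤ) → prodFin n φ ≡ Π.sum φ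
  prodFin-sum {zero} φ = refl
  prodFin-sum {suc n} φ = cong (φ Fin.zero ℤ.*_) (prodFin-sum (λ i → φ (Fin.suc i)))

  sign-≢0 : ∀ {n sp} → sp ∈ perms n → proj₁ sp ≢ 0ℤ
  sign-≢0 {zero} (here refl) ()
  sign-≢0 {suc n} sp∈ eq = case-k (perms-suc sp∈) eq
    where
    sgn-≢0 : ∀ k → sgn k ≢ 0ℤ
    sgn-≢0 k eq with trans (sym (sgn-square k)) (cong (λ z → z ℤ.* z) eq)
    ... | ()
    case-k : ∀ {sp} → ∃[ k ] ∃[ sp' ] sp' ∈ perms n × sp ≡ extend k sp' → proj₁ sp ≢ 0ℤ
    case-k (k , sp' , sp'∈ , refl) eq = [ sgn-≢0 (toℕ k) , sign-≢0 sp'∈ ]′ (ℤₚ.i*j≡0⇒i≡0∨j≡0 (sgn (toℕ k)) eq)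

  module _ (a b c : ℕ) (1≤b : 1 ≤ b) {N : ℕ} {ux uy dx dy : Fin N → ℕ}
    (U : Enumeration (Hexagon.Up∈ a b c 1≤b) ux uy) (D : Enumeration (Hexagon.Down∈ a b c 1≤b) dx dy)
    (A : Fin N → Fin N → ℤ) (gaugeU gaugeD : Fin N → ℤ)
    (gaugeU≢0 : ∀ j → gaugeU j ≢ 0ℤ) (gaugeD≢0 : ∀ i → gaugeD i ≢ 0ℤ)
    (support : ∀ i j → A i j ≢ 0ℤ → Step (ux j) (uy j) (dx i) (dy i))
    (gauge : ∀ i j → Step (ux j) (uy j) (dx i) (dy i) → A i j ℤ.* gaugeD i ≡ gaugeU j) where

    open Bijection a b c 1≤b U D

    private
      Perm : Set
      Perm = ℤ × (Fin N → Fin N)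

    weight term : Perm → ℤ
    weight sp = prodFin N (λ i → A i (proj₂ sp i))
    term sp = proj₁ sp ℤ.* weight sp

    term⇒steps : ∀ {sp} → term sp ≢ 0ℤ → Steps sp
    term⇒steps {sp} term≢0 i = support i (proj₂ sp i) (factor-≢0 (λ i → A i (proj₂ sp i))
      (λ eq → term≢0 (trans (cong (proj₁ sp ℤ.*_) eq) (ℤₚ.*-zeroʳ (proj₁ sp)))) i)

    weight-gauge : ∀ {sp} → sp ∈ perms N → Steps sp → weight sp ℤ.* prodFin N gaugeD ≡ prodFin N gaugeU
    weight-gauge {sp} sp∈ s = begin
      weight sp ℤ.* prodFin N gaugeD
        ≡⟨ cong₂ ℤ._*_ (prodFin-sum (λ i → A i (proj₂ sp i))) (prodFin-sum gaugeD) ⟩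
      Π.sum (λ i → A i (proj₂ sp i)) ℤ.* Π.sum gaugeD
        ≡⟨ Π.∑-distrib-+ (λ i → A i (proj₂ sp i)) gaugeD ⟨
      Π.sum (λ i → A i (proj₂ sp i) ℤ.* gaugeD i)
        ≡⟨ Π.sum-cong-≗ (λ i → gauge i (proj₂ sp i) (s i)) ⟩
      Π.sum (λ i → gaugeU (proj₂ sp i))                        ≡⟨ Π.sum-reindex sp∈ gaugeU ⟩
      Π.sum gaugeU                                             ≡⟨ prodFin-sum gaugeU ⟨
      prodFin N gaugeU                                         ∎
      where open ≡-Reasoning

    steps⇒term : ∀ {sp} → sp ∈ perms N → Steps sp → term sp ≢ 0ℤ
    steps⇒term {sp} sp∈ s eq with ℤₚ.i*j≡0⇒i≡0∨j≡0 (proj₁ sp) eq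
    ... | inj₁ eq' = sign-≢0 sp∈ eq'
    ... | inj₂ eq' = product-≢0 gaugeU gaugeU≢0
      (trans (sym (weight-gauge sp∈ s)) (cong (ℤ._* prodFin N gaugeD) eq'))

    term-constant : ∀ {sp tp} → sp ∈ perms N → Steps sp → tp ∈ perms N → Steps tp → term sp ≡ term tp
    term-constant {sp} {tp} sp∈ s tp∈ t = cong₂ ℤ._*_ (sign-constant sp∈ s tp∈ t)
      (ℤₚ.*-cancelʳ-≡ (weight sp) (weight tp) (prodFin N gaugeD) {{ℤ.≢-nonZero (product-≢0 gaugeD gaugeD≢0)}}
        (trans (weight-gauge sp∈ s) (sym (weight-gauge tp∈ t))))
      where open Hexagon.Enumerated a b c 1≤b U D

    -- Its matching shows that nonzero terms exist, and the term of that matching serves as `m`.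
    zero-partition : Vec (Vec ℕ b) a
    zero-partition = matrix a b (λ _ _ → 0)

    zero-isPP : IsPP a b c zero-partition
    zero-isPP = (λ i j → ℕₚ.≤-trans (ℕₚ.≤-reflexive (zero-entry i j)) z≤n) ,
      (λ i j j' _ → ℕₚ.≤-trans (ℕₚ.≤-reflexive (zero-entry i j')) z≤n) ,
      (λ i i' j _ → ℕₚ.≤-trans (ℕₚ.≤-reflexive (zero-entry i' j)) z≤n)
      where
      zero-entry : ∀ i j → lookup (lookup zero-partition i) j ≡ 0
      zero-entry = lookup-matrix (λ _ _ → 0)

    constant : ∀ {sp tp} → sp ∈ perms N → term sp ≢ 0ℤ → tp ∈ perms N → Steps tp → term sp ≡ term tp
    constant {sp} sp∈ ≢0 = term-constant sp∈ (term⇒steps {sp} ≢0)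

    alternative : ∀ {sp tp} → sp ∈ perms N → tp ∈ perms N → Steps tp → term sp ≡ 0ℤ ⊎ term sp ≡ term tp
    alternative {sp} sp∈ tp∈ t with term sp ℤₚ.≟ 0ℤ
    ... | yes eq = inj₁ eq
    ... | no ≢0 = inj₂ (constant sp∈ ≢0 tp∈ t)

    leibniz-from : ∀ {tp} → tp ∈ perms N → Steps tp →
      Σ[ m ∈ ℤ ] (m ≢ 0ℤ) × All (λ t → t ≡ 0ℤ ⊎ t ≡ m) (leibnizTerms A) × det A ≡ m ℤ.* + numPP a b c
    leibniz-from {tp} tp∈ t =
      term tp , steps⇒term tp∈ t ,
      Allₚ.map⁺ (All.tabulate (λ sp∈ → alternative sp∈ tp∈ t)) ,
      trans (sum-constant term (term tp) (perms N) (λ sp∈ ≢0 → constant sp∈ ≢0 tp∈ t))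
        (cong (λ n → term tp ℤ.* + n) (matchings-count (λ sp → ¬? (term sp ℤₚ.≟ 0ℤ)) (λ {sp} → term⇒steps {sp})
          steps⇒term))

    leibniz : Σ[ m ∈ ℤ ] (m ≢ 0ℤ) × All (λ t → t ≡ 0ℤ ⊎ t ≡ m) (leibnizTerms A) × det A ≡ m ℤ.* + numPP a b c
    leibniz = let tp , tp∈ , t , _ = matching-exists {zero-partition} zero-isPP in leibniz-from tp∈ t

module Representation where

  open Lozenges
  open Counting
  open import Data.Integer.Base using (+_; _+_; _*_; _-_; -_; _≤_; ∣_∣)
  open import Data.Nat.Base using (_!)

  -- The entries of α(X)

  Xmat-entry : ∀ {n} (i j : Fin (suc n)) → toℕ j ≡ suc (toℕ i) → Xmat n i j ≡ + toℕ j
  Xmat-entry i j eq = cong (if_then + toℕ j else 0ℤ) (dec-true (toℕ j ℕₚ.≟ suc (toℕ i)) eq)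

  Xmat-support : ∀ {n} (i j : Fin (suc n)) → Xmat n i j ≢ 0ℤ → toℕ j ≡ suc (toℕ i)
  Xmat-support i j ≢0 with toℕ j ℕₚ.≟ suc (toℕ i)
  ... | yes eq = eq
  ... | no ne = ⊥-elim (≢0 (cong (if_then + toℕ j else 0ℤ) (dec-false (toℕ j ℕₚ.≟ suc (toℕ i)) ne)))

  Imat-diagonal : ∀ {n} (i : Fin (suc n)) → Imat n i i ≡ 1ℤ
  Imat-diagonal i = cong (if_then 1ℤ else 0ℤ) (dec-true (i Fₚ.≟ i) refl)

  Imat-support : ∀ {n} (i j : Fin (suc n)) → Imat n i j ≢ 0ℤ → i ≡ j
  Imat-support i j ≢0 with i Fₚ.≟ j
  ... | yes eq = eq
  ... | no ne = ⊥-elim (≢0 refl)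

  Imat-lowered : ∀ {n} (i j : Fin (suc n)) → toℕ j ≡ suc (toℕ i) → Imat n i j ≡ 0ℤ
  Imat-lowered i j eq = cong (if_then 1ℤ else 0ℤ)
    (dec-false (i Fₚ.≟ j) (λ i≡j → ℕₚ.1+n≢n (trans (sym eq) (cong toℕ (sym i≡j)))))

  *-≢0 : ∀ x y → x * y ≢ 0ℤ → x ≢ 0ℤ × y ≢ 0ℤ
  *-≢0 x y ≢0 = (λ eq → ≢0 (cong (_* y) eq)) , (λ eq → ≢0 (trans (cong (x *_) eq) (ℤₚ.*-zeroʳ x)))

  +-≢0 : ∀ x y → x + y ≢ 0ℤ → x ≢ 0ℤ ⊎ y ≢ 0ℤ
  +-≢0 x y ≢0 with x ℤₚ.≟ 0ℤ
  ... | no x≢0 = inj₁ x≢0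
  ... | yes refl = inj₂ (λ eq → ≢0 (trans (ℤₚ.+-identityˡ y) eq))

  module _ {n₁ n₂ n₃ : ℕ} where

    -- The last argument is the lowered index before the step, which is also the coefficient with
    -- which X performs it.
    data Lowers : Basis n₁ n₂ n₃ → Basis n₁ n₂ n₃ → ℕ → Set where
      first : ∀ {i j k l} → toℕ i ≡ suc (toℕ l) → Lowers (i , j , k) (l , j , k) (toℕ i)
      second : ∀ {i j k l} → toℕ j ≡ suc (toℕ l) → Lowers (i , j , k) (i , l , k) (toℕ j)
      third : ∀ {i j k l} → toℕ k ≡ suc (toℕ l) → Lowers (i , j , k) (i , j , l) (toℕ k)

    first-by-index : ∀ {i i' j j' k k'} → toℕ i ≡ suc (toℕ i') → toℕ j ≡ toℕ j' → toℕ k ≡ toℕ k' →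
      Lowers (i , j , k) (i' , j' , k') (toℕ i)
    first-by-index i≡ j≡ k≡ with refl ← Fₚ.toℕ-injective j≡ | refl ← Fₚ.toℕ-injective k≡ = first i≡

    second-by-index : ∀ {i i' j j' k k'} → toℕ i ≡ toℕ i' → toℕ j ≡ suc (toℕ j') → toℕ k ≡ toℕ k' →
      Lowers (i , j , k) (i' , j' , k') (toℕ j)
    second-by-index i≡ j≡ k≡ with refl ← Fₚ.toℕ-injective i≡ | refl ← Fₚ.toℕ-injective k≡ = second j≡

    third-by-index : ∀ {i i' j j' k k'} → toℕ i ≡ toℕ i' → toℕ j ≡ toℕ j' → toℕ k ≡ suc (toℕ k') →
      Lowers (i , j , k) (i' , j' , k') (toℕ k)
    third-by-index i≡ j≡ k≡ with refl ← Fₚ.toℕ-injective i≡ | refl ← Fₚ.toℕ-injective j≡ = third k≡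

    -- In the two summands where X acts on another factor, the identity meets the lowered index and
    -- vanishes.
    tensorAct-entry : ∀ {t s m} → Lowers t s m → tensorAct Xmat n₁ n₂ n₃ s t ≡ + m
    tensorAct-entry {i , j , k} {l , _ , _} (first eq)
      rewrite Xmat-entry l i eq | Imat-lowered l i eq | Imat-diagonal j | Imat-diagonal k = simplify (+ toℕ i)
        (Xmat n₂ j j) (Xmat n₃ k k)
      where
      simplify : ∀ x y z → x * 1ℤ * 1ℤ + 0ℤ * y * 1ℤ + 0ℤ * 1ℤ * z ≡ x
      simplify = solve-∀
    tensorAct-entry {i , j , k} {_ , l , _} (second eq)
      rewrite Xmat-entry l j eq | Imat-lowered l j eq | Imat-diagonal i | Imat-diagonal k = simplify (+ toℕ j)
        (Xmat n₁ i i) (Xmat n₃ k k)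
      where
      simplify : ∀ x y z → y * 0ℤ * 1ℤ + 1ℤ * x * 1ℤ + 1ℤ * 0ℤ * z ≡ x
      simplify = solve-∀
    tensorAct-entry {i , j , k} {_ , _ , l} (third eq)
      rewrite Xmat-entry l k eq | Imat-lowered l k eq | Imat-diagonal i | Imat-diagonal j = simplify (+ toℕ k)
        (Xmat n₁ i i) (Xmat n₂ j j)
      where
      simplify : ∀ x y z → y * 1ℤ * 0ℤ + 1ℤ * z * 0ℤ + 1ℤ * 1ℤ * x ≡ x
      simplify = solve-∀

    tensorAct-support : ∀ {s t} → tensorAct Xmat n₁ n₂ n₃ s t ≢ 0ℤ → ∃[ m ] Lowers t s m
    tensorAct-support {i , j , k} {i' , j' , k'} ≢0
      with +-≢0 (Xmat n₁ i i' * Imat n₂ j j' * Imat n₃ k k' + Imat n₁ i i' * Xmat n₂ j j' * Imat n₃ k k') _ ≢0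
    ... | inj₂ ≢0'
      with ij , x ← *-≢0 (Imat n₁ i i' * Imat n₂ j j') _ ≢0'
      with i≢ , j≢ ← *-≢0 (Imat n₁ i i') _ ij
      with refl ← Imat-support i i' i≢ | refl ← Imat-support j j' j≢ = _ , third (Xmat-support k k' x)
    ... | inj₁ ≢0' with +-≢0 (Xmat n₁ i i' * Imat n₂ j j' * Imat n₃ k k') _ ≢0'
    ...   | inj₁ ≢0''
      with xj , k≢ ← *-≢0 (Xmat n₁ i i' * Imat n₂ j j') _ ≢0''
      with x , j≢ ← *-≢0 (Xmat n₁ i i') _ xj
      with refl ← Imat-support j j' j≢ | refl ← Imat-support k k' k≢ = _ , first (Xmat-support i i' x)
    ...   | inj₂ ≢0''
      with ix , k≢ ← *-≢0 (Imat n₁ i i' * Xmat n₂ j j') _ ≢0''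
      with i≢ , x ← *-≢0 (Imat n₁ i i') _ ix
      with refl ← Imat-support i i' i≢ | refl ← Imat-support k k' k≢ = _ , second (Xmat-support j j' x)

  -- Weight spaces

  -- With `a` and `b` written as successors, the truncated subtractions in the dimensions of `Bas`
  -- compute away.
  module WeightSpaces (a' b' c : ℕ) where

    a b : ℕ
    a = suc a'
    b = suc b'

    index : ∀ {λ'} → EigBasis a b c λ' → ℕ × ℕ × ℕ
    index ((i , j , k) , _) = toℕ i , toℕ j , toℕ k

    level₁ level₂ level₃ : ∀ {λ'} → EigBasis a b c λ' → ℕ
    level₁ t = proj₁ (index t)
    level₂ t = proj₁ (proj₂ (index t))
    level₃ t = proj₂ (proj₂ (index t))

    top : ℕ
    top = (a' ℕ.+ b) ℕ.+ (a' ℕ.+ c) ℕ.+ (b' ℕ.+ c)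

    depth : Bas a b c → ℕ
    depth (i , j , k) = 2 ℕ.* toℕ i ℕ.+ 2 ℕ.* toℕ j ℕ.+ 2 ℕ.* toℕ k

    wt-depth : ∀ t → wt a b c t + + depth t ≡ + top
    wt-depth (i , j , k) = rearrange (+ (a' ℕ.+ b)) (+ (a' ℕ.+ c)) (+ (b' ℕ.+ c))
        (+ (2 ℕ.* toℕ i)) (+ (2 ℕ.* toℕ j)) (+ (2 ℕ.* toℕ k))
      where
      rearrange : ∀ n₁ n₂ n₃ i j k → (n₁ - i) + (n₂ - j) + (n₃ - k) + (i + j + k) ≡ n₁ + n₂ + n₃
      rearrange = solve-∀

    weight-index : ∀ {λ'} (t : EigBasis a b c λ') → λ' + + depth (proj₁ t) ≡ + top
    weight-index (t , refl) = wt-depth t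

    index-weight : ∀ {λ'} t → λ' + + depth t ≡ + top → wt a b c t ≡ λ'
    index-weight {λ'} t eq = ∙-cancelʳ (+ depth t) (wt a b c t) λ' (trans (wt-depth t) (sym eq))

    -- The integer weight equation becomes a condition on a sum of three naturals: `top` equals
    -- `2 (a' + b' + c) + 1`, so the weights 1 and -1 correspond to the totals `a' + b' + c` and its
    -- successor.
    record WeightLevel (λ' : ℤ) : Set where
      field
        total : ℕ
        to-total : (t : EigBasis a b c λ') → level₁ t ℕ.+ level₂ t ℕ.+ level₃ t ≡ total
        from-total : ∀ i j k → toℕ i ℕ.+ toℕ j ℕ.+ toℕ k ≡ total → wt a b c (i , j , k) ≡ λ'

    weight-1 : WeightLevel 1ℤ
    weight-1 = record
      { total = a' ℕ.+ b' ℕ.+ c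
      ; to-total = λ where
          t@((i , j , k) , _) → lia 6 (λ i j k a b c →
            :suc ((i :+ (i :+ :con 0)) :+ (j :+ (j :+ :con 0)) :+ (k :+ (k :+ :con 0))) :≡ (a :+ :suc b) :+
              (a :+ c) :+ (b :+ c) :→
            :goal (i :+ j :+ k :≡ a :+ b :+ c)) (toℕ i) (toℕ j) (toℕ k) a' b' c
              (ℤₚ.+-injective (weight-index t))
      ; from-total = λ i j k eq → index-weight (i , j , k) (cong +_ (lia 6 (λ i j k a b c →
            i :+ j :+ k :≡ a :+ b :+ c :→
            :goal (:suc ((i :+ (i :+ :con 0)) :+ (j :+ (j :+ :con 0)) :+ (k :+ (k :+ :con 0))) :≡ (a :+ :suc b)
              :+ (a :+ c) :+ (b :+ c)))
            (toℕ i) (toℕ j) (toℕ k) a' b' c eq))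
      }

    weight-neg-1 : WeightLevel -1ℤ
    weight-neg-1 = record
      { total = suc (a' ℕ.+ b' ℕ.+ c)
      ; to-total = λ where
          t@((i , j , k) , _) → lia 6 (λ i j k a b c →
            ((i :+ (i :+ :con 0)) :+ (j :+ (j :+ :con 0)) :+ (k :+ (k :+ :con 0))) :≡ :suc
              ((a :+ :suc b) :+ (a :+ c) :+ (b :+ c)) :→
            :goal (i :+ j :+ k :≡ :suc (a :+ b :+ c))) (toℕ i) (toℕ j) (toℕ k) a' b' c
            (ℤₚ.+-injective (trans (shift (+ depth (i , j , k))) (cong (λ z → 1ℤ + z) (weight-index t))))
      ; from-total = λ i j k eq → index-weight (i , j , k)
        (trans (cong (λ n → -1ℤ + + n) (lia 6 (λ i j k a b c →
            i :+ j :+ k :≡ :suc (a :+ b :+ c) :→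
            :goal ((i :+ (i :+ :con 0)) :+ (j :+ (j :+ :con 0)) :+ (k :+ (k :+ :con 0)) :≡ :suc
              ((a :+ :suc b) :+ (a :+ c) :+ (b :+ c))))
            (toℕ i) (toℕ j) (toℕ k) a' b' c eq)) refl)
      }
      where
      shift : ∀ x → x ≡ 1ℤ + (-1ℤ + x)
      shift = solve-∀

    -- The total fixes the third index, and two proofs of the same weight equation are equal by
    -- `uip`.
    EigBasis-≡ : ∀ {λ'} (W : WeightLevel λ') {t t' : EigBasis a b c λ'} →
      level₁ t ≡ level₁ t' → level₂ t ≡ level₂ t' → t ≡ t'
    EigBasis-≡ W {t@((i , j , k) , w)} {t'@((i' , j' , k') , w')} eq₁ eq₂
      with refl ← Fₚ.toℕ-injective eq₁ | refl ← Fₚ.toℕ-injective eq₂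
      with refl ← Fₚ.toℕ-injective {i = k} {j = k'} (ℕₚ.+-cancelˡ-≡ (toℕ i ℕ.+ toℕ j) _ _
        (trans (WeightLevel.to-total W t) (sym (WeightLevel.to-total W t'))))
      = cong ((i , j , k) ,_) (uip w w')

    module Build {λ'} (W : WeightLevel λ') where
      open WeightLevel W

      build : ∀ r p q → r ℕ.< a ℕ.+ b → p ℕ.< a ℕ.+ c → q ℕ.< b ℕ.+ c → r ℕ.+ p ℕ.+ q ≡ total → EigBasis a b c
        λ'
      build r p q r< p< q< eq = (fromℕ< r< , fromℕ< p< , fromℕ< q<) , from-total (fromℕ< r<) (fromℕ< p<)
        (fromℕ< q<)
        (trans (cong₂ ℕ._+_ (cong₂ ℕ._+_ (Fₚ.toℕ-fromℕ< r<) (Fₚ.toℕ-fromℕ< p<)) (Fₚ.toℕ-fromℕ< q<)) eq)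

    open WeightLevel
    open Hexagon a b c (s≤s z≤n)

    level₁< : ∀ {λ'} (t : EigBasis a b c λ') → level₁ t ℕ.< a ℕ.+ b
    level₁< ((i , _ , _) , _) = Fₚ.toℕ<n i

    level₂< : ∀ {λ'} (t : EigBasis a b c λ') → level₂ t ℕ.< a ℕ.+ c
    level₂< ((_ , j , _) , _) = Fₚ.toℕ<n j

    level₃< : ∀ {λ'} (t : EigBasis a b c λ') → level₃ t ℕ.< b ℕ.+ c
    level₃< ((_ , _ , k) , _) = Fₚ.toℕ<n k

    up-total : (t : EigBasis a b c -1ℤ) → level₁ t ℕ.+ level₂ t ℕ.+ level₃ t ≡ suc (a' ℕ.+ b' ℕ.+ c)
    up-total = to-total weight-neg-1

    down-total : (t : EigBasis a b c 1ℤ) → level₁ t ℕ.+ level₂ t ℕ.+ level₃ t ≡ a' ℕ.+ b' ℕ.+ c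
    down-total = to-total weight-1

    step : ∀ {s : EigBasis a b c 1ℤ} {t : EigBasis a b c -1ℤ} {m} → Lowers (proj₁ t) (proj₁ s) m →
      Step (level₁ t) (level₂ t) (level₁ s) (level₂ s)
    step (first eq) = subst (λ r → Step r _ _ _) (sym eq) v
    step (second eq) = subst (λ p → Step _ p _ _) (sym eq) e
    step (third eq) = f

    module _ (s : EigBasis a b c 1ℤ) (t : EigBasis a b c -1ℤ) where
      private
        total≡ : level₁ t ℕ.+ level₂ t ℕ.+ level₃ t ≡ suc (level₁ s ℕ.+ level₂ s ℕ.+ level₃ s)
        total≡ = trans (up-total t) (cong suc (sym (down-total s)))

      lowers₁ : level₂ t ≡ level₂ s → level₃ t ≡ level₃ s → Lowers (proj₁ t) (proj₁ s) (level₁ t)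
      lowers₁ eq₂ eq₃ = first-by-index
        (lia 6 (λ r r' p p' q q' → r' :+ p' :+ q' :≡ :suc (r :+ p :+ q) :→ p' :≡ p :→ q' :≡ q :→ :goal
          (r' :≡ :suc r))
          (level₁ s) (level₁ t) (level₂ s) (level₂ t) (level₃ s) (level₃ t) total≡ eq₂ eq₃) eq₂ eq₃

      lowers₂ : level₂ t ≡ suc (level₂ s) → level₃ t ≡ level₃ s → Lowers (proj₁ t) (proj₁ s) (level₂ t)
      lowers₂ eq₂ eq₃ = second-by-index
        (lia 6 (λ r r' p p' q q' → r' :+ p' :+ q' :≡ :suc (r :+ p :+ q) :→ p' :≡ :suc p :→ q' :≡ q :→ :goal
          (r' :≡ r))
          (level₁ s) (level₁ t) (level₂ s) (level₂ t) (level₃ s) (level₃ t) total≡ eq₂ eq₃) eq₂ eq₃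

      lowers₃ : level₂ t ≡ level₂ s → level₃ t ≡ suc (level₃ s) → Lowers (proj₁ t) (proj₁ s) (level₃ t)
      lowers₃ eq₂ eq₃ = third-by-index
        (lia 6 (λ r r' p p' q q' → r' :+ p' :+ q' :≡ :suc (r :+ p :+ q) :→ p' :≡ p :→ q' :≡ :suc q :→ :goal
          (r' :≡ r))
          (level₁ s) (level₁ t) (level₂ s) (level₂ t) (level₃ s) (level₃ t) total≡ eq₂ eq₃) eq₂ eq₃

      lowers : Step (level₁ t) (level₂ t) (level₁ s) (level₂ s) → ∃[ m ] Lowers (proj₁ t) (proj₁ s) m
      lowers st = go st refl refl refl refl
        where
        go : ∀ {r p x y} → Step r p x y → level₁ t ≡ r → level₂ t ≡ p → level₁ s ≡ x → level₂ s ≡ y →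
          ∃[ m ] Lowers (proj₁ t) (proj₁ s) m
        go (v {x} {y}) eqr eqp eqx eqy = _ , lowers₁ (trans eqp (sym eqy))
          (lia 8 (λ r r' p p' q q' x y → r' :+ p' :+ q' :≡ :suc (r :+ p :+ q) :→ r' :≡ :suc x :→ p' :≡ y :→ r
            :≡ x :→ p :≡ y :→ :goal (q' :≡ q))
            (level₁ s) (level₁ t) (level₂ s) (level₂ t) (level₃ s) (level₃ t) x y total≡ eqr eqp eqx eqy)
        go (e {x} {y}) eqr eqp eqx eqy = _ , lowers₂ (trans eqp (cong suc (sym eqy)))
          (lia 8 (λ r r' p p' q q' x y → r' :+ p' :+ q' :≡ :suc (r :+ p :+ q) :→ r' :≡ x :→ p' :≡ :suc y :→ r
            :≡ x :→ p :≡ y :→ :goal (q' :≡ q))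
            (level₁ s) (level₁ t) (level₂ s) (level₂ t) (level₃ s) (level₃ t) x y total≡ eqr eqp eqx eqy)
        go (f {x} {y}) eqr eqp eqx eqy = _ , lowers₃ (trans eqp (sym eqy))
          (lia 8 (λ r r' p p' q q' x y → r' :+ p' :+ q' :≡ :suc (r :+ p :+ q) :→ r' :≡ x :→ p' :≡ y :→ r :≡ x
            :→ p :≡ y :→ :goal (q' :≡ :suc q))
            (level₁ s) (level₁ t) (level₂ s) (level₂ t) (level₃ s) (level₃ t) x y total≡ eqr eqp eqx eqy)

    -- The gauge j₁! j₂! j₃! absorbs every entry of α(X).
    gauge : ∀ {λ'} → EigBasis a b c λ' → ℤ
    gauge t = + (level₁ t ! ℕ.* level₂ t ! ℕ.* level₃ t !)

    gauge-≢0 : ∀ {λ'} (t : EigBasis a b c λ') → gauge t ≢ 0ℤ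
    gauge-≢0 t eq = ℕ.≢-nonZero⁻¹ (level₁ t ! ℕ.* level₂ t ! ℕ.* level₃ t !)
      {{ℕₚ.m*n≢0 _ _ {{ℕₚ.m*n≢0 _ _ {{level₁ t ℕₚ.!≢0}} {{level₂ t ℕₚ.!≢0}}}} {{level₃ t ℕₚ.!≢0}}}}
      (ℤₚ.+-injective eq)

    gauge-lowers : ∀ (s : EigBasis a b c 1ℤ) (t : EigBasis a b c -1ℤ) {m} → Lowers (proj₁ t) (proj₁ s) m →
      + m * gauge s ≡ gauge t
    gauge-lowers s@((l , j , k) , _) ((i , _ , _) , _) (first eq) = trans (sym (ℤₚ.pos-* (toℕ i) _)) (cong +_
      (subst (λ n → n ℕ.* (toℕ l ! ℕ.* toℕ j ! ℕ.* toℕ k !) ≡ n ! ℕ.* toℕ j ! ℕ.* toℕ k !) (sym eq)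
        (rearrange (suc (toℕ l)) (toℕ l !) (toℕ j !) (toℕ k !))))
      where
      rearrange : ∀ n x y z → n ℕ.* (x ℕ.* y ℕ.* z) ≡ n ℕ.* x ℕ.* y ℕ.* z
      rearrange = solveℕ-∀
    gauge-lowers s@((i , l , k) , _) ((_ , j , _) , _) (second eq) = trans (sym (ℤₚ.pos-* (toℕ j) _)) (cong +_
      (subst (λ n → n ℕ.* (toℕ i ! ℕ.* toℕ l ! ℕ.* toℕ k !) ≡ toℕ i ! ℕ.* n ! ℕ.* toℕ k !) (sym eq)
        (rearrange (suc (toℕ l)) (toℕ i !) (toℕ l !) (toℕ k !))))
      where
      rearrange : ∀ n x y z → n ℕ.* (x ℕ.* y ℕ.* z) ≡ x ℕ.* (n ℕ.* y) ℕ.* z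
      rearrange = solveℕ-∀
    gauge-lowers s@((i , j , l) , _) ((_ , _ , k) , _) (third eq) = trans (sym (ℤₚ.pos-* (toℕ k) _)) (cong +_
      (subst (λ n → n ℕ.* (toℕ i ! ℕ.* toℕ j ! ℕ.* toℕ l !) ≡ toℕ i ! ℕ.* toℕ j ! ℕ.* n !) (sym eq)
        (rearrange (suc (toℕ l)) (toℕ i !) (toℕ j !) (toℕ l !))))
      where
      rearrange : ∀ n x y z → n ℕ.* (x ℕ.* y ℕ.* z) ≡ x ℕ.* y ℕ.* (n ℕ.* z)
      rearrange = solveℕ-∀

    up-inside : (t : EigBasis a b c -1ℤ) → Up∈ (level₁ t) (level₂ t)
    up-inside t = up∈ (level₁< t) (level₂< t)
      (lia 6 (λ r p q a b c → r :+ p :+ q :≡ :suc (a :+ b :+ c) :→ q :< :suc b :+ c :→ :goal (:suc a :≤ r :+ p))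
        (level₁ t) (level₂ t) (level₃ t) a' b' c (up-total t) (level₃< t))
      (lia 6 (λ r p q a b c → r :+ p :+ q :≡ :suc (a :+ b :+ c) :→ :goal
        (:suc (r :+ p) :≤ :suc a :+ :suc b :+ c))
        (level₁ t) (level₂ t) (level₃ t) a' b' c (up-total t))

    down-inside : (t : EigBasis a b c 1ℤ) → Down∈ (level₁ t) (level₂ t)
    down-inside t = down∈ (level₁< t) (level₂< t)
      (lia 6 (λ r p q a b c → r :+ p :+ q :≡ a :+ b :+ c :→ q :< :suc b :+ c :→ :goal (:suc a :≤ :suc (r :+ p)))
        (level₁ t) (level₂ t) (level₃ t) a' b' c (down-total t) (level₃< t))
      (lia 6 (λ r p q a b c → r :+ p :+ q :≡ a :+ b :+ c :→ :goal
        (:suc (:suc (r :+ p)) :≤ :suc a :+ :suc b :+ c))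
        (level₁ t) (level₂ t) (level₃ t) a' b' c (down-total t))

    up-exists : ∀ {r p} → Up∈ r p → Σ[ t ∈ EigBasis a b c -1ℤ ] level₁ t ≡ r × level₂ t ≡ p
    up-exists {r} {p} (up∈ r< p< l u) =
      let q , eq = ℕₚ.m≤n⇒∃[o]m+o≡n {r ℕ.+ p} {suc (a' ℕ.+ b' ℕ.+ c)}
            (lia 5 (λ r p a b c → :suc (r :+ p) :≤ :suc a :+ :suc b :+ c :→ :goal
              (r :+ p :≤ :suc (a :+ b :+ c))) r p a' b' c u)
      in Build.build weight-neg-1 r p q r< p<
          (lia 6 (λ r p q a b c → r :+ p :+ q :≡ :suc (a :+ b :+ c) :→ :suc a :≤ r :+ p :→ :goal
            (q :< :suc b :+ c)) r p q a' b' c eq l) eq ,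
        Fₚ.toℕ-fromℕ< r< , Fₚ.toℕ-fromℕ< p<

    down-exists : ∀ {r p} → Down∈ r p → Σ[ t ∈ EigBasis a b c 1ℤ ] level₁ t ≡ r × level₂ t ≡ p
    down-exists {r} {p} (down∈ r< p< l u) =
      let q , eq = ℕₚ.m≤n⇒∃[o]m+o≡n {r ℕ.+ p} {a' ℕ.+ b' ℕ.+ c}
            (lia 5 (λ r p a b c → :suc (:suc (r :+ p)) :≤ :suc a :+ :suc b :+ c :→ :goal
              (r :+ p :≤ a :+ b :+ c)) r p a' b' c u)
      in Build.build weight-1 r p q r< p<
          (lia 6 (λ r p q a b c → r :+ p :+ q :≡ a :+ b :+ c :→ :suc a :≤ :suc (r :+ p) :→ :goal
            (q :< :suc b :+ c)) r p q a' b' c eq l) eq ,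
        Fₚ.toℕ-fromℕ< r< , Fₚ.toℕ-fromℕ< p<

    enumeration : ∀ {N λ'} {In : ℕ → ℕ → Set} (W : WeightLevel λ') (eq : Fin N ↔ EigBasis a b c λ') →
      (∀ t → In (level₁ t) (level₂ t)) →
        (∀ {r p} → In r p → Σ[ t ∈ EigBasis a b c λ' ] level₁ t ≡ r × level₂ t ≡ p) →
      Enumeration In (λ i → level₁ (Inverse.to eq i)) (λ i → level₂ (Inverse.to eq i))
    enumeration W eq inside exists = record
      { inside = λ i → inside (Inverse.to eq i)
      ; injective = λ {i} {j} eq₁ eq₂ → trans (sym (Inverse.strictlyInverseʳ eq i))
          (trans (cong (Inverse.from eq) (EigBasis-≡ W {Inverse.to eq i} {Inverse.to eq j} eq₁ eq₂))
            (Inverse.strictlyInverseʳ eq j))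
      ; surjective = λ In-rp → let t , eq₁ , eq₂ = exists In-rp in Inverse.from eq t ,
          trans (cong level₁ (Inverse.strictlyInverseˡ eq t)) eq₁ , trans
            (cong level₂ (Inverse.strictlyInverseˡ eq t)) eq₂
      }

    XRes-support : ∀ (s : EigBasis a b c 1ℤ) (t : EigBasis a b c -1ℤ) → XRes a b c s t ≢ 0ℤ → ∃[ m ] Lowers
      (proj₁ t) (proj₁ s) m
    XRes-support s t = tensorAct-support

    XRes-entry : ∀ (s : EigBasis a b c 1ℤ) (t : EigBasis a b c -1ℤ) {m} → Lowers (proj₁ t) (proj₁ s) m → XRes a
      b c s t ≡ + m
    XRes-entry s t = tensorAct-entry

    -- Rows are down triangles and columns are up triangles, so a permutation sends each down
    -- triangle to its partner. The sign of `m` may vary with the chosen numberings.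
    determinant : (N : ℕ) (eR : Fin N ↔ EigBasis a b c 1ℤ) (eC : Fin N ↔ EigBasis a b c -1ℤ) →
      Σ[ m ∈ ℤ ] (m ≢ 0ℤ)
        × All (λ t → t ≡ 0ℤ ⊎ t ≡ m) (leibnizTerms (λ i j → XRes a b c (Inverse.to eR i) (Inverse.to eC j)))
        × det (λ i j → XRes a b c (Inverse.to eR i) (Inverse.to eC j)) ≡ m * + numPP a b c
    determinant N eR eC = leibniz a b c (s≤s z≤n)
      (enumeration weight-neg-1 eC up-inside up-exists) (enumeration weight-1 eR down-inside down-exists)
      (λ i j → XRes a b c (Inverse.to eR i) (Inverse.to eC j))
      (λ j → gauge (Inverse.to eC j)) (λ i → gauge (Inverse.to eR i))
      (λ j → gauge-≢0 (Inverse.to eC j)) (λ i → gauge-≢0 (Inverse.to eR i))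
      (λ i j ≢0 → step {Inverse.to eR i} {Inverse.to eC j}
        (proj₂ (XRes-support (Inverse.to eR i) (Inverse.to eC j) ≢0)))
      (λ i j st → let m , low = lowers (Inverse.to eR i) (Inverse.to eC j) st in
        trans (cong (_* gauge (Inverse.to eR i)) (XRes-entry (Inverse.to eR i) (Inverse.to eC j) low))
          (gauge-lowers (Inverse.to eR i) (Inverse.to eC j) low))

  -- Triangles of the hexagon

  -- Adding `k` makes both sides natural. The bounds on `x` and `x + y` use `k = c`, because `x` may
  -- be as small as `- c`.
  ≤-shift : ∀ k {i j m n} → i + + k ≡ + m → j + + k ≡ + n → i ≤ j → m ℕ.≤ n
  ≤-shift k eq eq' i≤j = ℤₚ.drop‿+≤+ (subst₂ _≤_ eq eq' (ℤₚ.+-monoˡ-≤ (+ k) i≤j))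

  ≤-unshift : ∀ k {i j m n} → i + + k ≡ + m → j + + k ≡ + n → m ℕ.≤ n → i ≤ j
  ≤-unshift k {i} {j} eq eq' m≤n = subst₂ _≤_ (cancel i (+ k)) (cancel j (+ k))
    (ℤₚ.+-monoˡ-≤ (- (+ k)) (subst₂ _≤_ (sym eq) (sym eq') (ℤ.+≤+ m≤n)))
    where
    cancel : ∀ i k → i + k + - k ≡ i
    cancel = solve-∀

  ×-irrelevant : ∀ {A B : Set} → (∀ (x y : A) → x ≡ y) → (∀ (x y : B) → x ≡ y) → ∀ (x y : A × B) → x ≡ y
  ×-irrelevant irrA irrB (a , b) (a' , b') = cong₂ _,_ (irrA a a') (irrB b b')

  module _ (a b c : ℕ) where

    Up-≡ : ∀ {x y x' y'} (u : UpIn a b c x y) (u' : UpIn a b c x' y') → x ≡ x' → y ≡ y' →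
      _≡_ {A = Up a b c} (x , y , u) (x' , y' , u')
    Up-≡ u u' refl refl = cong (λ u → _ , _ , u)
      (×-irrelevant ℤₚ.≤-irrelevant (×-irrelevant ℤₚ.≤-irrelevant (×-irrelevant ℤₚ.≤-irrelevant
        (×-irrelevant ℤₚ.≤-irrelevant (×-irrelevant ℤₚ.≤-irrelevant ℤₚ.≤-irrelevant)))) u u')

    Down-≡ : ∀ {x y x' y'} (d : DownIn a b c x y) (d' : DownIn a b c x' y') → x ≡ x' → y ≡ y' →
      _≡_ {A = Down a b c} (x , y , d) (x' , y' , d')
    Down-≡ d d' refl refl = cong (λ d → _ , _ , d)
      (×-irrelevant ℤₚ.≤-irrelevant (×-irrelevant ℤₚ.≤-irrelevant (×-irrelevant ℤₚ.≤-irrelevant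
        (×-irrelevant ℤₚ.≤-irrelevant (×-irrelevant ℤₚ.≤-irrelevant ℤₚ.≤-irrelevant)))) d d')

    module _ {x y p q} (x≡ : x + + c ≡ + p) (y≡ : y ≡ + q) where

      private
        y+0 : y + 0ℤ ≡ + q
        y+0 = trans (ℤₚ.+-identityʳ y) y≡

        y+1 : y + 1ℤ + 0ℤ ≡ + suc q
        y+1 = trans (rearrange y) (cong (λ z → 1ℤ + z) y≡)
          where
          rearrange : ∀ y → y + 1ℤ + 0ℤ ≡ 1ℤ + y
          rearrange = solve-∀

        x+1 : x + 1ℤ + + c ≡ + suc p
        x+1 = trans (rearrange x (+ c)) (cong (λ z → 1ℤ + z) x≡)
          where
          rearrange : ∀ x c → x + 1ℤ + c ≡ 1ℤ + (x + c)
          rearrange = solve-∀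

        x+y : x + y + + c ≡ + (p ℕ.+ q)
        x+y = trans (rearrange x y (+ c)) (cong₂ _+_ x≡ y≡)
          where
          rearrange : ∀ x y c → x + y + c ≡ x + c + y
          rearrange = solve-∀

        x+y+1 : x + y + 1ℤ + + c ≡ + suc (p ℕ.+ q)
        x+y+1 = trans (rearrange (x + y) (+ c)) (cong (λ z → 1ℤ + z) x+y)
          where
          rearrange : ∀ x c → x + 1ℤ + c ≡ 1ℤ + (x + c)
          rearrange = solve-∀

        x+y+2 : x + y + 1ℤ + 1ℤ + + c ≡ + suc (suc (p ℕ.+ q))
        x+y+2 = trans (rearrange (x + y + 1ℤ) (+ c)) (cong (λ z → 1ℤ + z) x+y+1)
          where
          rearrange : ∀ x c → x + 1ℤ + c ≡ 1ℤ + (x + c)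
          rearrange = solve-∀

        c-c : - (+ c) + + c ≡ + 0
        c-c = ℤₚ.+-inverseˡ (+ c)

        b+c : + (b ℕ.+ c) + 0ℤ ≡ + (b ℕ.+ c)
        b+c = ℤₚ.+-identityʳ _

      up-in : q ℕ.< b ℕ.+ c → p ℕ.< a ℕ.+ c → c ℕ.≤ p ℕ.+ q → suc (p ℕ.+ q) ℕ.≤ a ℕ.+ b ℕ.+ c → UpIn a b c x y
      up-in q< p< l u = ≤-unshift 0 refl y+0 z≤n , ≤-unshift 0 y+1 b+c q< , ≤-unshift c c-c x≡ z≤n ,
        ≤-unshift c x+1 refl p< , ≤-unshift c refl x+y l , ≤-unshift c x+y+1 refl u

      up-out : UpIn a b c x y → (q ℕ.< b ℕ.+ c) × (p ℕ.< a ℕ.+ c) × (c ℕ.≤ p ℕ.+ q) ×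
        (suc (p ℕ.+ q) ℕ.≤ a ℕ.+ b ℕ.+ c)
      up-out (_ , q< , _ , p< , l , u) = ≤-shift 0 y+1 b+c q< , ≤-shift c x+1 refl p< , ≤-shift c refl x+y l ,
        ≤-shift c x+y+1 refl u

      down-in : q ℕ.< b ℕ.+ c → p ℕ.< a ℕ.+ c → c ℕ.≤ suc (p ℕ.+ q) → suc (suc (p ℕ.+ q)) ℕ.≤ a ℕ.+ b ℕ.+ c →
        DownIn a b c x y
      down-in q< p< l u = ≤-unshift 0 refl y+0 z≤n , ≤-unshift 0 y+1 b+c q< , ≤-unshift c c-c x≡ z≤n ,
        ≤-unshift c x+1 refl p< , ≤-unshift c refl x+y+1 l , ≤-unshift c x+y+2 refl u

      down-out : DownIn a b c x y → (q ℕ.< b ℕ.+ c) × (p ℕ.< a ℕ.+ c) × (c ℕ.≤ suc (p ℕ.+ q)) ×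
        (suc (suc (p ℕ.+ q)) ℕ.≤ a ℕ.+ b ℕ.+ c)
      down-out (_ , q< , _ , p< , l , u) = ≤-shift 0 y+1 b+c q< , ≤-shift c x+1 refl p< , ≤-shift c refl x+y+1
        l , ≤-shift c x+y+2 refl u

    shifted-position : ∀ {x} → - (+ c) ≤ x → + ∣ x + + c ∣ ≡ x + + c
    shifted-position {x} -c≤x = ℤₚ.0≤i⇒+∣i∣≡i
      (subst (_≤ x + + c) (ℤₚ.+-inverseˡ (+ c)) (ℤₚ.+-monoˡ-≤ (+ c) -c≤x))

  sub-add : ∀ p c → p - c + c ≡ p
  sub-add = solve-∀

  add-sub : ∀ p c → p + c - c ≡ p
  add-sub = solve-∀

  module _ (a b c : ℕ) (N : Up a b c → Down a b c → ℤ) (r x y : Up a b c → ℤ)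
    (here : ∀ u d → proj₁ d ≡ proj₁ u → proj₁ (proj₂ d) ≡ proj₁ (proj₂ u) → N u d ≡ r u)
    (left : ∀ u d → proj₁ d ≡ proj₁ u - 1ℤ → proj₁ (proj₂ d) ≡ proj₁ (proj₂ u) → N u d ≡ x u)
    (below : ∀ u d → proj₁ d ≡ proj₁ u → proj₁ (proj₂ d) ≡ proj₁ (proj₂ u) - 1ℤ → N u d ≡ y u)
    (r-cong : ∀ u u' → proj₁ u + proj₁ (proj₂ u) ≡ proj₁ u' + proj₁ (proj₂ u') → r u ≡ r u')
    (x-cong : ∀ u u' → proj₁ u ≡ proj₁ u' → x u ≡ x u')
    (y-cong : ∀ u u' → proj₁ (proj₂ u) ≡ proj₁ (proj₂ u') → y u ≡ y u') where

    -- Opposite edges of a face lower the same index from the same value, so their weights agree,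
    -- and they belong to different sides of the flatness identity.
    flat-from-levels : IsKFlat a b c N
    flat-from-levels p q u₁ d₁ u₂ d₂ u₃ d₃ = begin
      N U₁ D₁ * N U₂ D₂ * N U₃ D₃ ≡⟨ cong₂ _*_ (cong₂ _*_ (left U₁ D₁ refl refl) (below U₂ D₂ refl refl))
        (here U₃ D₃ refl refl) ⟩
      x U₁ * y U₂ * r U₃          ≡⟨ cong₂ _*_ (cong₂ _*_ (x-cong U₁ U₃ refl) (y-cong U₂ U₁ refl))
        (r-cong U₃ U₂ (exchange p q)) ⟩
      x U₃ * y U₁ * r U₂          ≡⟨ rearrange (x U₃) (y U₁) (r U₂) ⟩
      r U₂ * x U₃ * y U₁          ≡⟨ cong₂ _*_ (cong₂ _*_ (here U₂ D₁ refl refl) (left U₃ D₂ refl refl))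
        (below U₁ D₃ refl refl) ⟨
      N U₂ D₁ * N U₃ D₂ * N U₁ D₃ ∎
      where
      open ≡-Reasoning
      U₁ U₂ U₃ : Up a b c
      U₁ = p , q , u₁
      U₂ = p - 1ℤ , q , u₂
      U₃ = p , q - 1ℤ , u₃
      D₁ D₂ D₃ : Down a b c
      D₁ = p - 1ℤ , q , d₁
      D₂ = p - 1ℤ , q - 1ℤ , d₂
      D₃ = p , q - 1ℤ , d₃
      rearrange : ∀ x y r → x * y * r ≡ r * x * y
      rearrange = solve-∀
      exchange : ∀ p q → p + (q - 1ℤ) ≡ p - 1ℤ + q
      exchange = solve-∀

  module Triangles (a' b' c : ℕ) where
    open WeightSpaces a' b' c

    EigBasis-≡₂₃ : ∀ {λ'} (W : WeightLevel λ') {t t' : EigBasis a b c λ'} →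
      level₂ t ≡ level₂ t' → level₃ t ≡ level₃ t' → t ≡ t'
    EigBasis-≡₂₃ W {t} {t'} eq₂ eq₃ = EigBasis-≡ W {t} {t'}
      (lia 7 (λ r r' p p' q q' k → r :+ p :+ q :≡ k :→ r' :+ p' :+ q' :≡ k :→ p :≡ p' :→ q :≡ q' :→ :goal
        (r :≡ r'))
        (level₁ t) (level₁ t') (level₂ t) (level₂ t') (level₃ t) (level₃ t') (WeightLevel.total W)
        (WeightLevel.to-total W t) (WeightLevel.to-total W t') eq₂ eq₃)
      eq₂

    -- The coordinates are `x = j₂ - c` and `y = j₃`. As the indices add up to `a + b + c - 1`, one
    -- has `x + y = a + b - 1 - j₁`, so the bounds on `x + y` express the range of `j₁`.
    to-up : EigBasis a b c -1ℤ → Up a b c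
    to-up t = + level₂ t - + c , + level₃ t , up-in a b c (sub-add (+ level₂ t) (+ c)) refl (level₃< t)
      (level₂< t)
      (lia 6 (λ r p q a b c → r :+ p :+ q :≡ :suc (a :+ b :+ c) :→ r :< :suc a :+ :suc b :→ :goal (c :≤ p :+ q))
        (level₁ t) (level₂ t) (level₃ t) a' b' c (up-total t) (level₁< t))
      (lia 6 (λ r p q a b c → r :+ p :+ q :≡ :suc (a :+ b :+ c) :→ :goal
        (:suc (p :+ q) :≤ :suc a :+ :suc b :+ c))
        (level₁ t) (level₂ t) (level₃ t) a' b' c (up-total t))

    to-down : EigBasis a b c 1ℤ → Down a b c
    to-down t = + level₂ t - + c , + level₃ t , down-in a b c (sub-add (+ level₂ t) (+ c)) refl (level₃< t)
      (level₂< t)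
      (lia 6 (λ r p q a b c → r :+ p :+ q :≡ a :+ b :+ c :→ r :< :suc a :+ :suc b :→ :goal (c :≤ :suc (p :+ q)))
        (level₁ t) (level₂ t) (level₃ t) a' b' c (down-total t) (level₁< t))
      (lia 6 (λ r p q a b c → r :+ p :+ q :≡ a :+ b :+ c :→ :goal
        (:suc (:suc (p :+ q)) :≤ :suc a :+ :suc b :+ c))
        (level₁ t) (level₂ t) (level₃ t) a' b' c (down-total t))

    abstract
      up-basis : ∀ p q → q ℕ.< b ℕ.+ c → p ℕ.< a ℕ.+ c → c ℕ.≤ p ℕ.+ q → suc (p ℕ.+ q) ℕ.≤ a ℕ.+ b ℕ.+ c →
        Σ[ t ∈ EigBasis a b c -1ℤ ] level₂ t ≡ p × level₃ t ≡ q
      up-basis p q q< p< l u =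
        let r , eq = ℕₚ.m≤n⇒∃[o]m+o≡n {p ℕ.+ q} {suc (a' ℕ.+ b' ℕ.+ c)}
              (lia 5 (λ p q a b c → :suc (p :+ q) :≤ :suc a :+ :suc b :+ c :→ :goal
                (p :+ q :≤ :suc (a :+ b :+ c))) p q a' b' c u)
        in Build.build weight-neg-1 r p q
             (lia 6 (λ r p q a b c → p :+ q :+ r :≡ :suc (a :+ b :+ c) :→ c :≤ p :+ q :→ :goal
               (r :< :suc a :+ :suc b)) r p q a' b' c eq l) p< q<
             (lia 4 (λ r p q k → p :+ q :+ r :≡ k :→ :goal (r :+ p :+ q :≡ k)) r p q (suc (a' ℕ.+ b' ℕ.+ c))
               eq) ,
           Fₚ.toℕ-fromℕ< p< , Fₚ.toℕ-fromℕ< q<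

      down-basis : ∀ p q → q ℕ.< b ℕ.+ c → p ℕ.< a ℕ.+ c → c ℕ.≤ suc (p ℕ.+ q) → suc (suc (p ℕ.+ q)) ℕ.≤ a ℕ.+
        b ℕ.+ c →
        Σ[ t ∈ EigBasis a b c 1ℤ ] level₂ t ≡ p × level₃ t ≡ q
      down-basis p q q< p< l u =
        let r , eq = ℕₚ.m≤n⇒∃[o]m+o≡n {p ℕ.+ q} {a' ℕ.+ b' ℕ.+ c}
              (lia 5 (λ p q a b c → :suc (:suc (p :+ q)) :≤ :suc a :+ :suc b :+ c :→ :goal
                (p :+ q :≤ a :+ b :+ c)) p q a' b' c u)
        in Build.build weight-1 r p q
             (lia 6 (λ r p q a b c → p :+ q :+ r :≡ a :+ b :+ c :→ c :≤ :suc (p :+ q) :→ :goal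
               (r :< :suc a :+ :suc b)) r p q a' b' c eq l) p< q<
             (lia 4 (λ r p q k → p :+ q :+ r :≡ k :→ :goal (r :+ p :+ q :≡ k)) r p q (a' ℕ.+ b' ℕ.+ c) eq) ,
           Fₚ.toℕ-fromℕ< p< , Fₚ.toℕ-fromℕ< q<

    from-up-levels : ((x , y , _) : Up a b c) → Σ[ t ∈ EigBasis a b c -1ℤ ] level₂ t ≡ ∣ x + + c ∣ × level₃ t ≡
      ∣ y ∣
    from-up-levels (x , y , u@(0≤y , _ , -c≤x , _)) =
      let q< , p< , l , h = up-out a b c (sym (shifted-position a b c -c≤x)) (sym (ℤₚ.0≤i⇒+∣i∣≡i 0≤y)) u
      in up-basis ∣ x + + c ∣ ∣ y ∣ q< p< l h

    from-down-levels : ((x , y , _) : Down a b c) → Σ[ t ∈ EigBasis a b c 1ℤ ] level₂ t ≡ ∣ x + + c ∣ × level₃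
      t ≡ ∣ y ∣
    from-down-levels (x , y , d@(0≤y , _ , -c≤x , _)) =
      let q< , p< , l , h = down-out a b c (sym (shifted-position a b c -c≤x)) (sym (ℤₚ.0≤i⇒+∣i∣≡i 0≤y)) d
      in down-basis ∣ x + + c ∣ ∣ y ∣ q< p< l h

    from-up : Up a b c → EigBasis a b c -1ℤ
    from-up u = proj₁ (from-up-levels u)

    from-down : Down a b c → EigBasis a b c 1ℤ
    from-down d = proj₁ (from-down-levels d)

    up-x : (u : Up a b c) → + level₂ (from-up u) ≡ proj₁ u + + c
    up-x u@(_ , _ , _ , _ , -c≤x , _) = trans (cong +_ (proj₁ (proj₂ (from-up-levels u))))
      (shifted-position a b c -c≤x)

    up-y : (u : Up a b c) → + level₃ (from-up u) ≡ proj₁ (proj₂ u)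
    up-y u@(_ , _ , 0≤y , _) = trans (cong +_ (proj₂ (proj₂ (from-up-levels u)))) (ℤₚ.0≤i⇒+∣i∣≡i 0≤y)

    down-x : (d : Down a b c) → + level₂ (from-down d) ≡ proj₁ d + + c
    down-x d@(_ , _ , _ , _ , -c≤x , _) = trans (cong +_ (proj₁ (proj₂ (from-down-levels d))))
      (shifted-position a b c -c≤x)

    down-y : (d : Down a b c) → + level₃ (from-down d) ≡ proj₁ (proj₂ d)
    down-y d@(_ , _ , 0≤y , _) = trans (cong +_ (proj₂ (proj₂ (from-down-levels d)))) (ℤₚ.0≤i⇒+∣i∣≡i 0≤y)

    basis↔up : EigBasis a b c -1ℤ ↔ Up a b c
    basis↔up = mk↔ₛ′ to-up from-up
      (λ u → Up-≡ a b c (proj₂ (proj₂ (to-up (from-up u)))) (proj₂ (proj₂ u))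
        (trans (cong (_- + c) (up-x u)) (add-sub (proj₁ u) (+ c))) (up-y u))
      (λ t → EigBasis-≡₂₃ weight-neg-1 {from-up (to-up t)} {t}
        (ℤₚ.+-injective (trans (up-x (to-up t)) (sub-add (+ level₂ t) (+ c))))
          (ℤₚ.+-injective (up-y (to-up t))))

    basis↔down : EigBasis a b c 1ℤ ↔ Down a b c
    basis↔down = mk↔ₛ′ to-down from-down
      (λ d → Down-≡ a b c (proj₂ (proj₂ (to-down (from-down d)))) (proj₂ (proj₂ d))
        (trans (cong (_- + c) (down-x d)) (add-sub (proj₁ d) (+ c))) (down-y d))
      (λ t → EigBasis-≡₂₃ weight-1 {from-down (to-down t)} {t}
        (ℤₚ.+-injective (trans (down-x (to-down t)) (sub-add (+ level₂ t) (+ c))))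
          (ℤₚ.+-injective (down-y (to-down t))))

    module _ (u : Up a b c) (d : Down a b c) where
      private
        x y x' y' : ℤ
        x = proj₁ u
        y = proj₁ (proj₂ u)
        x' = proj₁ d
        y' = proj₁ (proj₂ d)
        t : EigBasis a b c -1ℤ
        t = from-up u
        s : EigBasis a b c 1ℤ
        s = from-down d

      entry-≢0 : ∀ {m} → Lowers (proj₁ t) (proj₁ s) m → XRes a b c s t ≢ 0ℤ
      entry-≢0 low eq = lowers-≢0 low (ℤₚ.+-injective (trans (sym (XRes-entry s t low)) eq))
        where
        lowers-≢0 : ∀ {n₁ n₂ n₃ m} {t s : Basis n₁ n₂ n₃} → Lowers t s m → m ≢ 0
        lowers-≢0 (first eq) m≡0 = ℕₚ.1+n≢0 (trans (sym eq) m≡0)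
        lowers-≢0 (second eq) m≡0 = ℕₚ.1+n≢0 (trans (sym eq) m≡0)
        lowers-≢0 (third eq) m≡0 = ℕₚ.1+n≢0 (trans (sym eq) m≡0)

      same-x : x' ≡ x → level₂ t ≡ level₂ s
      same-x eq = ℤₚ.+-injective (trans (up-x u) (trans (cong (_+ + c) (sym eq)) (sym (down-x d))))

      same-y : y' ≡ y → level₃ t ≡ level₃ s
      same-y eq = ℤₚ.+-injective (trans (up-y u) (trans (sym eq) (sym (down-y d))))

      left-x : x' ≡ x - 1ℤ → level₂ t ≡ suc (level₂ s)
      left-x eq = ℤₚ.+-injective (trans (up-x u) (trans (rearrange x (+ c))
        (cong (λ z → 1ℤ + z) (trans (cong (_+ + c) (sym eq)) (sym (down-x d))))))
        where
        rearrange : ∀ x c → x + c ≡ 1ℤ + (x - 1ℤ + c)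
        rearrange = solve-∀

      below-y : y' ≡ y - 1ℤ → level₃ t ≡ suc (level₃ s)
      below-y eq = ℤₚ.+-injective (trans (up-y u) (trans (rearrange y)
        (cong (λ z → 1ℤ + z) (trans (sym eq) (sym (down-y d))))))
        where
        rearrange : ∀ y → y ≡ 1ℤ + (y - 1ℤ)
        rearrange = solve-∀

      entry-here : x' ≡ x → y' ≡ y → XRes a b c s t ≡ + level₁ t
      entry-here x≡ y≡ = XRes-entry s t (lowers₁ s t (same-x x≡) (same-y y≡))

      entry-left : x' ≡ x - 1ℤ → y' ≡ y → XRes a b c s t ≡ + level₂ t
      entry-left x≡ y≡ = XRes-entry s t (lowers₂ s t (left-x x≡) (same-y y≡))

      entry-below : x' ≡ x → y' ≡ y - 1ℤ → XRes a b c s t ≡ + level₃ t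
      entry-below x≡ y≡ = XRes-entry s t (lowers₃ s t (same-x x≡) (below-y y≡))

      adjacent-≢0 : Adj u d → XRes a b c s t ≢ 0ℤ
      adjacent-≢0 (inj₁ (x≡ , y≡)) = entry-≢0 (lowers₁ s t (same-x x≡) (same-y y≡))
      adjacent-≢0 (inj₂ (inj₁ (x≡ , y≡))) = entry-≢0 (lowers₂ s t (left-x x≡) (same-y y≡))
      adjacent-≢0 (inj₂ (inj₂ (x≡ , y≡))) = entry-≢0 (lowers₃ s t (same-x x≡) (below-y y≡))

      private
        to-same-x : level₂ t ≡ level₂ s → x' ≡ x
        to-same-x eq = ∙-cancelʳ (+ c) x' x (trans (sym (down-x d)) (trans (cong +_ (sym eq)) (up-x u)))

        to-same-y : level₃ t ≡ level₃ s → y' ≡ y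
        to-same-y eq = trans (sym (down-y d)) (trans (cong +_ (sym eq)) (up-y u))

        to-left-x : level₂ t ≡ suc (level₂ s) → x' ≡ x - 1ℤ
        to-left-x eq = trans (rearrange x' (+ c)) (trans
          (cong (λ z → 1ℤ + z - + c - 1ℤ) (sym (down-x d)))
            (trans (cong (λ z → z - + c - 1ℤ) (trans (cong +_ (sym eq)) (up-x u)))
          (cong (_- 1ℤ) (add-sub x (+ c)))))
          where
          rearrange : ∀ x c → x ≡ 1ℤ + (x + c) - c - 1ℤ
          rearrange = solve-∀

        to-below-y : level₃ t ≡ suc (level₃ s) → y' ≡ y - 1ℤ
        to-below-y eq = trans (rearrange y')
          (cong (_- 1ℤ) (trans (cong (λ z → 1ℤ + z) (sym (down-y d))) (trans (cong +_ (sym eq)) (up-y u))))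
          where
          rearrange : ∀ y → y ≡ 1ℤ + y - 1ℤ
          rearrange = solve-∀

        lowers-levels : ∀ {n₁ n₂ n₃ i j k i' j' k' m} → Lowers {n₁} {n₂} {n₃} (i , j , k) (i' , j' , k') m →
          (toℕ j ≡ toℕ j' × toℕ k ≡ toℕ k') ⊎ (toℕ j ≡ suc (toℕ j') × toℕ k ≡ toℕ k') ⊎
            (toℕ j ≡ toℕ j' × toℕ k ≡ suc (toℕ k'))
        lowers-levels (first eq) = inj₁ (refl , refl)
        lowers-levels (second eq) = inj₂ (inj₁ (eq , refl))
        lowers-levels (third eq) = inj₂ (inj₂ (refl , eq))

      lowers⇒adjacent : ∀ {m} → Lowers (proj₁ t) (proj₁ s) m → Adj u d
      lowers⇒adjacent low = Sum.map (Product.map to-same-x to-same-y)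
        (Sum.map (Product.map to-left-x to-same-y) (Product.map to-same-x to-below-y)) (lowers-levels low)

      not-adjacent-0 : ¬ Adj u d → XRes a b c s t ≡ 0ℤ
      not-adjacent-0 ¬adj = decidable-stable (XRes a b c s t ℤₚ.≟ 0ℤ)
        (λ ≢0 → ¬adj (lowers⇒adjacent (proj₂ (XRes-support s t ≢0))))

    entries : Up a b c → Down a b c → ℤ
    entries u d = XRes a b c (from-down d) (from-up u)

    up-antidiagonal : (u u' : Up a b c) → proj₁ u + proj₁ (proj₂ u) ≡ proj₁ u' + proj₁ (proj₂ u') →
      level₁ (from-up u) ≡ level₁ (from-up u')
    up-antidiagonal u u' eq = lia 7
      (λ r p q r' p' q' k → r :+ p :+ q :≡ k :→ r' :+ p' :+ q' :≡ k :→ p :+ q :≡ p' :+ q' :→ :goal (r :≡ r'))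
      (level₁ (from-up u)) (level₂ (from-up u)) (level₃ (from-up u)) (level₁ (from-up u'))
        (level₂ (from-up u')) (level₃ (from-up u'))
      (suc (a' ℕ.+ b' ℕ.+ c)) (up-total (from-up u)) (up-total (from-up u'))
      (ℤₚ.+-injective (trans (position-sum u) (trans (cong (_+ + c) eq) (sym (position-sum u')))))
      where
      position-sum : (u : Up a b c) → + (level₂ (from-up u) ℕ.+ level₃ (from-up u)) ≡ proj₁ u + proj₁ (proj₂ u)
        + + c
      position-sum u = trans (cong₂ _+_ (up-x u) (up-y u)) (rearrange (proj₁ u) (proj₁ (proj₂ u)) (+ c))
        where
        rearrange : ∀ x y c → x + c + y ≡ x + y + c
        rearrange = solve-∀

    flat : IsKFlat a b c entries
    flat = flat-from-levels a b c entries
      (λ u → + level₁ (from-up u)) (λ u → + level₂ (from-up u)) (λ u → + level₃ (from-up u))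
      entry-here entry-left entry-below
      (λ u u' eq → cong +_ (up-antidiagonal u u' eq))
      (λ u u' eq → trans (up-x u) (trans (cong (_+ + c) eq) (sym (up-x u'))))
      (λ u u' eq → trans (up-y u) (trans eq (sym (up-y u'))))

open import Data.Nat using (_≤_)
open import Data.Integer using (+_; _*_)

theorem1 : (a b c : ℕ) → 1 ≤ a → 1 ≤ b → 1 ≤ c →
    ((Σ[ φ ∈ EigBasis a b c -1ℤ ↔ Up a b c ] Σ[ ψ ∈ EigBasis a b c 1ℤ ↔ Down a b c ]
        IsKFlatAdj a b c (λ u d → XRes a b c (Inverse.from ψ d) (Inverse.from φ u)))
     ⊎ (Σ[ φ ∈ EigBasis a b c -1ℤ ↔ Down a b c ] Σ[ ψ ∈ EigBasis a b c 1ℤ ↔ Up a b c ]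
        IsKFlatAdj a b c (λ u d → XRes a b c (Inverse.from ψ u) (Inverse.from φ d))))
    × ((N : ℕ) (eR : Fin N ↔ EigBasis a b c 1ℤ) (eC : Fin N ↔ EigBasis a b c -1ℤ) →
       Σ[ m ∈ ℤ ] (m ≢ 0ℤ)
         × All (λ t → t ≡ 0ℤ ⊎ t ≡ m)
               (leibnizTerms (λ i j → XRes a b c (Inverse.to eR i) (Inverse.to eC j)))
         × det (λ i j → XRes a b c (Inverse.to eR i) (Inverse.to eC j)) ≡ m * + numPP a b c)
theorem1 (suc a') (suc b') c _ _ _ =
  inj₁ (basis↔up , basis↔down , (λ u d → adjacent-≢0 u d , not-adjacent-0 u d) , flat) , determinant
  where
  open Representation.WeightSpaces a' b' c
  open Representation.Triangles a' b' c
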